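{- Let $\mathcal{M}$ be a structure in a language $\mathcal{L}$ with universe $M$, let $t\in\mathbb{R}_{\ge2}$ and let $s,u$ be positive integers. Assume that $E(x,y)\subseteq M^{|x|}\times M^{|y|}$ is a definable relation given by an instance of a formula $\theta(x,y;z)\in\mathcal{L}$, such that the formula $\theta'(x;y,z):=\theta(x,y;z)$ has a distal cell decomposition of exponent $t$, and the graph $E(x,y)$ does not contain $K_{s,u}$. Then there is a constant $\alpha=\alpha(\theta,s,u)$ such that for any finite $P\subseteq M^{|x|}$, $Q\subseteq M^{|y|}$ with $|P|=m$, $|Q|=n$, we have $$|E(P,Q)|\le\alpha\left(m^{\frac{(t-1)s}{ts-1}}n^{\frac{t(s-1)}{ts-1}}+m+n\right).$$
   Context: An instance of $\theta(x,y;z)$ is $\theta(x,y;c)$ for some $c\in M^{|z|}$. $E(P,Q)=E\cap(P\times Q)$. A relation $E\subseteq X\times Y$ is viewed as a bipartite graph with parts $X,Y$; it contains $K_{s,u}$ if there are $A\subseteq X$ with $|A|=s$ and $B\subseteq Y$ with $|B|=u$ such that $A\times B\subseteq E$. The notation $\alpha(\theta,s,u)$ means that $\alpha$ depends only on $\theta,s,u$ (for the given structure and $t$). Formulas are $\mathcal{L}$-formulas without parameters. In a partitioned formula $\varphi(x;y)$ the variables are split into finite tuples $x,y$ of lengths $|x|,|y|$. For $b\in M^{|y|}$ put $\varphi(M^{|x|};b)=\{a\in M^{|x|}:\mathcal{M}\models\varphi(a,b)\}$. For $B\subseteq M^{|y|}$, a set $X\subseteq M^{|x|}$ is crossed by $\varphi(x;B)$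 if for some $b\in B$ both $X\cap\varphi(M^{|x|};b)$ and $X\setminus\varphi(M^{|x|};b)$ are nonempty. A distal cell decomposition $\mathcal{T}$ for a formula $\varphi(x;y)$ is given by a finite set $\Psi(x;y_1,\dots,y_k)$ of formulas with $|y_1|=\dots=|y_k|=|y|$ and, for each $\psi\in\Psi$, a formula $\theta_\psi(y;y_1,\dots,y_k)$ such that for each finite nonempty $B\subseteq M^{|y|}$ the following holds. Let $\mathcal{T}(B)$ be the set of all $\Delta=\psi(M^{|x|};b_1,\dots,b_k)$ with $\psi\in\Psi$, $b_1,\dots,b_k\in B$, such that no $b\in B$ satisfies $\theta_\psi(b;b_1,\dots,b_k)$. Then $\bigcup\mathcal{T}(B)=M^{|x|}$ and no element of $\mathcal{T}(B)$ is crossed by $\varphi(x;B)$. $\mathcal{T}$ has exponent $r$ if there is $C$ with $|\mathcal{T}(B)|\le C|B|^r$ for all finite nonempty $B\subseteq M^{|y|}$. This is applied to $\theta'(x;y,z)$ with parameter variables the concatenated tuple $(y,z)$. -}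

module Defs where

open import Algebra.Bundles using (CommutativeRing)
open import Data.Empty.Polymorphic using (⊥)
open import Data.Fin.Base using (Fin)
open import Data.List.Base using (List; length)
open import Data.List.Membership.Propositional using () renaming (_∈_ to _∈ˡ_)
import Data.List.Membership.Setoid as SetoidMembership
open import Data.List.Relation.Unary.Unique.Propositional using () renaming (Unique to Uniqueˡ)
open import Data.List.Relation.Unary.Unique.Setoid using (Unique)
open import Data.Nat.Base as ℕ using (ℕ)
open import Data.Product.Base using (Σ; Σ-syntax; ∃-syntax; _×_; _,_)
open import Data.Sum.Base using (_⊎_)
open import Data.Vec.Base using (Vec; []; _∷_; _++_; concat; lookup)
open import Data.Vec.Relation.Unary.All using (All)
open import Function.Bundles using (_⇔_)
open import Level using (Level; 0ℓ; _⊔_) renaming (suc to lsuc)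
open import Relation.Binary.Bundles using (Setoid)
open import Relation.Binary.Core using (Rel)
open import Relation.Binary.PropositionalEquality using (_≡_)
import Relation.Binary.PropositionalEquality as ≡
open import Relation.Binary.Structures using (IsTotalOrder)
open import Relation.Nullary.Negation using (¬_)
open import Relation.Unary using (Pred; _∈_; _∩_; _∖_; _≐_; _⟨×⟩_; Satisfiable)
open import Relation.Unary.Relation.Binary.Equality using (≐-setoid)

private
  variable
    ℓ : Level
    n p q : ℕ

-- The reals are characterised axiomatically, up to isomorphism, as the
-- Dedekind-complete ordered field.  The operations _⁻¹ and sup are total;
-- nothing is said about 0⁻¹, nor about sup of an empty or unbounded set.
record CompleteOrderedField : Set₁ where
  infix  4 _≤_
  infix  9 _⁻¹
  infixl 7 _/_
  infixr 8 _**_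

  field
    commutativeRing : CommutativeRing 0ℓ 0ℓ

  open CommutativeRing commutativeRing public

  field
    _≤_           : Rel Carrier 0ℓ
    isTotalOrder  : IsTotalOrder _≈_ _≤_
    +-monoˡ-≤     : ∀ {x y} z → x ≤ y → (x + z) ≤ (y + z)
    *-nonNegative : ∀ {x y} → 0# ≤ x → 0# ≤ y → 0# ≤ (x * y)
    0≉1           : ¬ (0# ≈ 1#)
    _⁻¹           : Carrier → Carrier
    ⁻¹-inverseʳ   : ∀ {x} → ¬ (x ≈ 0#) → (x * x ⁻¹) ≈ 1#

  IsUpperBound : Pred Carrier 0ℓ → Pred Carrier 0ℓ
  IsUpperBound S b = ∀ {x} → x ∈ S → x ≤ b

  field
    sup       : Pred Carrier 0ℓ → Carrier
    sup-upper : ∀ {S} → Satisfiable S → Satisfiable (IsUpperBound S) →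
                IsUpperBound S (sup S)
    sup-least : ∀ {S} → Satisfiable S → Satisfiable (IsUpperBound S) →
                ∀ {b} → IsUpperBound S b → sup S ≤ b

  open import Algebra.Properties.Semiring.Mult semiring public
    using () renaming (_×_ to _·_)
  open import Algebra.Properties.Semiring.Exp semiring public
    using (_^_)

  fromℕ : ℕ → Carrier
  fromℕ k = k · 1#

  _/_ : Carrier → Carrier → Carrier
  x / y = x * y ⁻¹

  -- The real power xᵉ for x ≥ 0 and e ≥ 0, with 0⁰ = 1: the supremum of the
  -- rational powers x^(a/b) with a/b ≤ e if x ≥ 1, and with a/b ≥ e if x ≤ 1.
  -- Roots are avoided by writing y ≤ x^(a/b) as y^b ≤ x^a.
  _**_ : Carrier → Carrier → Carrier
  x ** e = sup λ y → 0# ≤ y × (Σ[ a ∈ ℕ ] Σ[ b ∈ ℕ ] (0 ℕ.< b)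
    × ((1# ≤ x × fromℕ a ≤ (e * fromℕ b)) ⊎ (x ≤ 1# × (e * fromℕ b) ≤ fromℕ a))
    × (y ^ b) ≤ (x ^ a))

record FiniteSet (A : Set ℓ) : Set ℓ where
  field
    elements : List A
    unique   : Uniqueˡ elements

  members : Pred A ℓ
  members x = x ∈ˡ elements

  size : ℕ
  size = length elements

open FiniteSet public using (members; size)

-- P, as a subset of S up to the equality of S, has exactly k elements.
HasSize : ∀ {c e r} (S : Setoid c e) → Pred (Setoid.Carrier S) r → ℕ → Set (c ⊔ e ⊔ r)
HasSize S P k = Σ[ xs ∈ List (Setoid.Carrier S) ]
  Unique S xs × length xs ≡ k × (∀ x → x ∈ P ⇔ x ∈ₛ xs)
  where open SetoidMembership S using () renaming (_∈_ to _∈ₛ_)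

record Language ℓ : Set (lsuc ℓ) where
  field
    Function : ℕ → Set ℓ
    Relation : ℕ → Set ℓ

module _ (L : Language ℓ) where
  open Language L

  data Term (n : ℕ) : Set ℓ where
    var : Fin n → Term n
    app : ∀ {k} → Function k → Vec (Term n) k → Term n

  -- De Bruijn: a quantifier binds variable 0 of its body.
  data Formula (n : ℕ) : Set ℓ where
    rel         : ∀ {k} → Relation k → Vec (Term n) k → Formula n
    _≈′_        : Term n → Term n → Formula n
    ⊥′          : Formula n
    _∧′_ _∨′_ _⇒′_ : Formula n → Formula n → Formula n
    ∀′_ ∃′_     : Formula (ℕ.suc n) → Formula n

  record Structure : Set (lsuc ℓ) where
    field
      Universe  : Set ℓ
      function  : ∀ {k} → Function k → Vec Universe k → Universe
      relation  : ∀ {k} → Relation k → Pred (Vec Universe k) ℓ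

open Structure public using (Universe)

module _ {L : Language ℓ} (M : Structure L) where
  open Structure M using (function; relation)

  evalTerm  : Vec (Universe M) n → Term L n → Universe M
  evalTerms : ∀ {k} → Vec (Universe M) n → Vec (Term L n) k → Vec (Universe M) k

  evalTerm ρ (var i)    = lookup ρ i
  evalTerm ρ (app f ts) = function f (evalTerms ρ ts)

  evalTerms ρ []       = []
  evalTerms ρ (t ∷ ts) = evalTerm ρ t ∷ evalTerms ρ ts

  Sat : Formula L n → Pred (Vec (Universe M) n) ℓ
  Sat (rel R ts) ρ = relation R (evalTerms ρ ts)
  Sat (t ≈′ u)   ρ = evalTerm ρ t ≡ evalTerm ρ u
  Sat ⊥′         ρ = ⊥
  Sat (φ ∧′ ψ)   ρ = Sat φ ρ × Sat ψ ρ
  Sat (φ ∨′ ψ)   ρ = Sat φ ρ ⊎ Sat ψ ρ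
  Sat (φ ⇒′ ψ)   ρ = Sat φ ρ → Sat ψ ρ
  Sat (∀′ φ)     ρ = ∀ a → Sat φ (a ∷ ρ)
  Sat (∃′ φ)     ρ = ∃[ a ] Sat φ (a ∷ ρ)

  -- A partitioned formula φ(x;y) with |x| = p and |y| = q is a formula in
  -- p + q variables; this is the set φ(Mᵖ;b).
  fibre : Formula L (p ℕ.+ q) → Vec (Universe M) q → Pred (Vec (Universe M) p) ℓ
  fibre φ b a = Sat φ (a ++ b)

  Crossed : Formula L (p ℕ.+ q) → Pred (Vec (Universe M) q) ℓ →
            Pred (Vec (Universe M) p) ℓ → Set ℓ
  Crossed φ B X = ∃[ b ] b ∈ B
    × Satisfiable (X ∩ fibre φ b) × Satisfiable (X ∖ fibre φ b)

  record DistalCellDecomposition (φ : Formula L (p ℕ.+ q)) : Set (lsuc ℓ) where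
    field
      k : ℕ
      Ψ : List (Formula L (p ℕ.+ k ℕ.* q))
      -- Only the values of θ on members of Ψ are used.
      θ : Formula L (p ℕ.+ k ℕ.* q) → Formula L (q ℕ.+ k ℕ.* q)

    -- 𝒯(B) is a set of subsets of Mᵖ up to ≐: a cell arising from several ψ or
    -- bs is counted once in HasExponent.
    cells : Pred (Vec (Universe M) q) ℓ → Pred (Pred (Vec (Universe M) p) ℓ) ℓ
    cells B Δ = ∃[ ψ ] ψ ∈ˡ Ψ × (Σ[ bs ∈ Vec (Vec (Universe M) q) k ]
        All B bs
      × ¬ (∃[ b ] b ∈ B × Sat (θ ψ) (b ++ concat bs))
      × Δ ≐ fibre ψ (concat bs))

    field
      covers    : (B : FiniteSet (Vec (Universe M) q)) → 0 ℕ.< size B →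
                  ∀ a → ∃[ Δ ] Δ ∈ cells (members B) × a ∈ Δ
      uncrossed : (B : FiniteSet (Vec (Universe M) q)) → 0 ℕ.< size B →
                  ∀ Δ → Δ ∈ cells (members B) → ¬ Crossed φ (members B) Δ

  -- For nonempty B one has |B| ≥ 1, so for r ≥ 0 the power is the usual one.
  HasExponent : (ℝ : CompleteOrderedField) {φ : Formula L (p ℕ.+ q)} →
    DistalCellDecomposition φ → CompleteOrderedField.Carrier ℝ → Set (lsuc ℓ)
  HasExponent {p = p} {q = q} ℝ 𝒯 r =
    Σ[ C ∈ Carrier ] ((B : FiniteSet (Vec (Universe M) q)) → 0 ℕ.< size B →
      Σ[ N ∈ ℕ ] HasSize (≐-setoid (Vec (Universe M) p) ℓ) (cells (members B)) N
               × fromℕ N ≤ (C * fromℕ (size B) ** r))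
    where
    open CompleteOrderedField ℝ
    open DistalCellDecomposition 𝒯

  -- The relation E(x,y) = θ(x,y;c).  The same θ read as a formula partitioned
  -- into x and (y,z) is θ′(x;y,z).
  instanceOf : ∀ {x y z} → Formula L (x ℕ.+ (y ℕ.+ z)) → Vec (Universe M) z →
               Pred (Vec (Universe M) x × Vec (Universe M) y) ℓ
  instanceOf θ c (a , b) = Sat θ (a ++ (b ++ c))

ContainsK : {X Y : Set ℓ} → ℕ → ℕ → Pred (X × Y) ℓ → Set ℓ
ContainsK {X = X} {Y = Y} s u E =
  Σ[ A ∈ FiniteSet X ] Σ[ B ∈ FiniteSet Y ] size A ≡ s × size B ≡ u
    × (∀ {a b} → a ∈ members A → b ∈ members B → (a , b) ∈ E)

HasEdgeCount : {X Y : Set ℓ} → Pred (X × Y) ℓ → FiniteSet X → FiniteSet Y → ℕ → Set ℓ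
HasEdgeCount {X = X} {Y = Y} E P Q =
  HasSize (≡.setoid (X × Y)) (E ∩ (members P ⟨×⟩ members Q))

{-# OPTIONS --safe #-}
-- A random sample S of ρ curves cuts the points into cells.  Split a larger
-- sample into k + 2 blocks: a cell is determined by k curves, so it survives the
-- removal of one of the blocks, and that block avoids all curves crossing the
-- cell.  Hence cells crossed by many more than |Q| / ρ curves are rare, with
-- polynomial decay of any order, and a weighted pigeonhole argument, recursive
-- in the cells that are crossed too often, gives a set of at least |P| / O(rᵗ)
-- points crossed by at most |Q| / r curves.  If M ≥ s such points are crossed by
-- at most Mˢ curves, K_{s,u}-freeness yields a point among them of degree
-- O(Mˢ⁻¹).  For the least admissible M this is O(mᵃ⁻¹ nᵇ); deleting such points
-- one at a time and summing gives the bound.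
module Submission where

open import Defs
open import Axiom.ExcludedMiddle using (ExcludedMiddle)
open import Data.Nat.Base as ℕ using (ℕ)
open import Data.Product.Base using (Σ-syntax; _×_)
open import Data.Vec.Base using (Vec)
open import Relation.Nullary.Negation using (¬_)

import Algebra.Properties.CommutativeSemiring.Exp as CommutativeExp
import Algebra.Properties.Ring as RingProperties
import Algebra.Properties.Semiring.Exp as Exp
import Algebra.Properties.Semiring.Mult as Mult
import Algebra.Solver.Ring.NaturalCoefficients.Default as SemiringSolver
open import Data.Fin.Base using (Fin; zero; suc)
import Data.Fin.Properties as Fin
open import Data.List.Base as List using (List; []; _∷_; length; map; filter; allFin; take; deduplicate; cartesianProduct)
open import Data.List.Membership.Propositional using (find) renaming (_∈_ to _∈ˡ_)
import Data.List.Membership.Propositional.Properties as ∈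
import Data.List.Membership.Setoid as SetoidMembership
import Data.List.Membership.Setoid.Properties as ∈ₛ
import Data.List.Properties as List
open import Data.List.Relation.Binary.Sublist.Propositional using (_⊆_; ⊆-refl; ⊆-trans; minimum; []; _∷_; _∷ʳ_)
import Data.List.Relation.Binary.Sublist.Propositional.Properties as Sublist
open import Data.List.Relation.Unary.All using (All; []; _∷_)
open import Data.List.Relation.Unary.AllPairs using ([]; _∷_)
open import Data.List.Relation.Unary.Any as Any using (here; there)
open import Data.List.Relation.Unary.Unique.DecPropositional.Properties using (deduplicate-!)
open import Data.List.Relation.Unary.Unique.Propositional using () renaming (Unique to Uniqueˡ)
import Data.List.Relation.Unary.Unique.Propositional.Properties as Unique
import Data.List.Relation.Unary.Unique.Setoid as SetoidUnique
import Data.List.Relation.Unary.Unique.Setoid.Properties as SetoidUniqueP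
open import Data.Nat.Base using (zero; suc; z≤n; s≤s)
import Data.Nat.Properties as ℕ
open import Data.Nat.Tactic.RingSolver using (solve-∀)
open import Data.Product.Base using (∃-syntax; _,_; proj₁; proj₂)
open import Data.Sum.Base using (_⊎_; inj₁; inj₂)
open import Data.Vec.Base as Vec using ([]; _∷_; lookup; removeAt)
import Data.Vec.Properties as Vec
import Data.Vec.Relation.Unary.All as VecAll
import Data.Vec.Relation.Unary.All.Properties as VecAll
open import Function.Base using (_∘_; const)
open import Function.Bundles using (_⇔_; mk⇔; module Equivalence)
open import Level using (Level; 0ℓ; Lift; lift; lower)
open import Relation.Binary.Bundles using (Poset; Setoid)
open import Relation.Binary.Definitions using (DecidableEquality)
import Relation.Binary.PropositionalEquality as ≡
open import Relation.Binary.PropositionalEquality using (_≡_)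
import Relation.Binary.Reasoning.PartialOrder as PosetReasoning
open import Relation.Binary.Structures using (IsTotalOrder)
open import Relation.Nullary.Decidable.Core using (yes; no; ¬?; map′)
open import Relation.Nullary.Negation using (contradiction)
open import Relation.Unary using (Pred; _≐_)
open import Relation.Unary.Relation.Binary.Equality using (≐-setoid)

-- The weights in the pigeonhole argument are the price of the recursion. A cell crossed by about
-- j|Q|/r curves is treated again with parameter j, which loses a further factor `φ j`, at most a
-- constant times jᵈ; so the cell gets weight jᵈ. A block of size proportional to h r avoids it with
-- probability O((h j)⁻ᵈ⁻¹), while the larger sample multiplies the number of cells by O(hᵈ). One
-- factor h is left over, and h is chosen to absorb all constants. Rounding t up to an integer d is
-- harmless here: d enters constants only, and t survives in `φ r` itself. Probabilities are counts
-- over all tuples of curves, repetitions allowed, cleared of denominators.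
--
-- The exponents come from the critical M. Up to constants, r is n/Mˢ and m is rᵗM, so M^(ts-1) is
-- nᵗ/m, and the degree Mˢ⁻¹ is (nᵗ/m)^β with β = (s-1)/(ts-1). Since a = 1 - β and b = tβ, this is
-- mᵃ⁻¹nᵇ. The condition t ≥ 2 gives a ≥ 1/2, so summing the degrees over the deletions costs only a
-- factor 2.

private
  variable
    ℓ ℓ₁ ℓ₂ : Level
    A : Set ℓ₁
    B : Set ℓ₂

-- Incidences and cells

module Combinatorics where
  open import Data.Nat.Base
  open import Data.Nat.DivMod using (_/_; m/n*n≤m; m<n⇒m/n≡0; m≡m%n+[m/n]*n; m%n<n)
  open import Data.Nat.Properties
  open import Relation.Binary.PropositionalEquality

  -- Finite sums of natural numbers.

  ∑ : List A → (A → ℕ) → ℕ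
  ∑ []       f = 0
  ∑ (x ∷ xs) f = f x + ∑ xs f

  syntax ∑ xs (λ x → e) = ∑[ x ∈ xs ] e
  infix 5 ∑

  ∑-mono : ∀ (xs : List A) {f g} → (∀ {x} → x ∈ˡ xs → f x ≤ g x) → ∑ xs f ≤ ∑ xs g
  ∑-mono []       f≤g = z≤n
  ∑-mono (x ∷ xs) f≤g = +-mono-≤ (f≤g (here refl)) (∑-mono xs (f≤g ∘ there))

  ∑-cong : ∀ (xs : List A) {f g} → (∀ x → f x ≡ g x) → ∑ xs f ≡ ∑ xs g
  ∑-cong []       f≡g = refl
  ∑-cong (x ∷ xs) f≡g = cong₂ _+_ (f≡g x) (∑-cong xs f≡g)

  ∑-+ : ∀ (xs : List A) f g → ∑ xs (λ x → f x + g x) ≡ ∑ xs f + ∑ xs g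
  ∑-+ []       f g = refl
  ∑-+ (x ∷ xs) f g rewrite ∑-+ xs f g = rearrange (f x) (g x) (∑ xs f) (∑ xs g)
    where
    rearrange : ∀ p q r s → p + q + (r + s) ≡ p + r + (q + s)
    rearrange = solve-∀

  ∑-*ˡ : ∀ (xs : List A) c f → ∑ xs (λ x → c * f x) ≡ c * ∑ xs f
  ∑-*ˡ []       c f = sym (*-zeroʳ c)
  ∑-*ˡ (x ∷ xs) c f rewrite ∑-*ˡ xs c f = sym (*-distribˡ-+ c (f x) (∑ xs f))

  ∑-*ʳ : ∀ (xs : List A) c f → ∑ xs (λ x → f x * c) ≡ ∑ xs f * c
  ∑-*ʳ []       c f = refl
  ∑-*ʳ (x ∷ xs) c f rewrite ∑-*ʳ xs c f = sym (*-distribʳ-+ c (f x) (∑ xs f))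

  ∑-const : ∀ (xs : List A) c → ∑ xs (const c) ≡ length xs * c
  ∑-const []       c = refl
  ∑-const (x ∷ xs) c = cong (c +_) (∑-const xs c)

  ∑-bound : ∀ (xs : List A) {f c} → (∀ {x} → x ∈ˡ xs → f x ≤ c) → ∑ xs f ≤ length xs * c
  ∑-bound xs f≤c = ≤-trans (∑-mono xs f≤c) (≤-reflexive (∑-const xs _))

  ∑-swap : ∀ (xs : List A) (ys : List B) (f : A → B → ℕ) →
           ∑ xs (λ x → ∑ ys (f x)) ≡ ∑ ys (λ y → ∑ xs (λ x → f x y))
  ∑-swap []       ys f = sym (trans (∑-const ys 0) (*-zeroʳ (length ys)))
  ∑-swap (x ∷ xs) ys f =
    trans (cong (∑ ys (f x) +_) (∑-swap xs ys f)) (sym (∑-+ ys (f x) _))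

  ∑-++ : ∀ (xs ys : List A) f → ∑ (xs List.++ ys) f ≡ ∑ xs f + ∑ ys f
  ∑-++ []       ys f = refl
  ∑-++ (x ∷ xs) ys f = trans (cong (f x +_) (∑-++ xs ys f)) (sym (+-assoc (f x) _ _))

  ∑-map : ∀ (g : A → B) xs f → ∑ (map g xs) f ≡ ∑ xs (f ∘ g)
  ∑-map g []       f = refl
  ∑-map g (x ∷ xs) f = cong (f (g x) +_) (∑-map g xs f)

  ∈⇒≤∑ : ∀ {x : A} {xs} f → x ∈ˡ xs → f x ≤ ∑ xs f
  ∈⇒≤∑ f (here refl) = m≤m+n _ _
  ∈⇒≤∑ f (there x∈)  = ≤-trans (∈⇒≤∑ f x∈) (m≤n+m _ _)

  ∑-pigeonhole : ∀ (xs : List A) {f g} → 0 < length xs → ∑ xs f ≤ ∑ xs g →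
                 ∃[ x ] x ∈ˡ xs × f x ≤ g x
  ∑-pigeonhole {A = A} (x ∷ xs) {f} {g} _ h = go x xs h
    where
    go : ∀ x (xs : List A) → ∑ (x ∷ xs) f ≤ ∑ (x ∷ xs) g → ∃[ y ] y ∈ˡ x ∷ xs × f y ≤ g y
    go x xs h with f x ≤? g x
    go x xs       h | yes fx≤gx = x , here refl , fx≤gx
    go x []       h | no  fx≰gx = contradiction (subst₂ _≤_ (+-identityʳ (f x)) (+-identityʳ (g x)) h) fx≰gx
    go x (y ∷ ys) h | no  fx≰gx with go y ys (≮⇒≥ λ g<f → <⇒≱ (+-mono-< (≰⇒> fx≰gx) g<f) h)
    ... | z , z∈ , fz≤gz = z , there z∈ , fz≤gz

  ∑-average : ∀ (xs : List A) {f c} → 0 < length xs → ∑ xs f ≤ length xs * c →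
              ∃[ x ] x ∈ˡ xs × f x ≤ c
  ∑-average xs {c = c} nonempty h =
    ∑-pigeonhole xs nonempty (≤-trans h (≤-reflexive (sym (∑-const xs c))))

  module _ {c e} (S : Setoid c e) where
    open Setoid S renaming (refl to ≈-refl; sym to ≈-sym; trans to ≈-trans)
    open SetoidMembership S using (_∈_)
    open SetoidUnique S using (Unique)

    private
      extract : ∀ {x ys} → x ∈ ys → ∀ f → (∀ {y z} → y ≈ z → f y ≡ f z) →
        Σ[ zs ∈ List Carrier ] (∑ ys f ≡ f x + ∑ zs f) × (∀ {z} → z ∈ ys → ¬ (x ≈ z) → z ∈ zs)
      extract {x} {y ∷ ys} (here x≈y) f resp = ys , cong (_+ ∑ ys f) (resp (≈-sym x≈y)) ,
        λ { (here z≈y) x≉z → contradiction (≈-trans x≈y (≈-sym z≈y)) x≉z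
          ; (there z∈) x≉z → z∈ }
      extract {x} {y ∷ ys} (there x∈) f resp with extract x∈ f resp
      ... | zs , eq , keep = y ∷ zs
          , trans (cong (f y +_) eq) (rearrange (f y) (f x) (∑ zs f))
          , λ { (here z≈y) x≉z → here z≈y ; (there z∈) x≉z → there (keep z∈ x≉z) }
        where
        rearrange : ∀ p q r → p + (q + r) ≡ q + (p + r)
        rearrange = solve-∀

    -- Each term of `xs` is extracted from `ys` in turn; uniqueness of `xs` ensures that no term of
    -- `ys` is spent twice. Membership is up to the equality of `S` because cells are sets of
    -- points, known only up to `≐`.
    ∑-⊆ : ∀ {xs ys} → Unique xs → (∀ {x} → x ∈ xs → x ∈ ys) →
          ∀ f → (∀ {y z} → y ≈ z → f y ≡ f z) → ∑ xs f ≤ ∑ ys f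
    ∑-⊆ {[]}     _            _     f resp = z≤n
    ∑-⊆ {x ∷ xs} (x∉xs ∷ xs!) xs⊆ys f resp with extract (xs⊆ys (here ≈-refl)) f resp
    ... | zs , eq , keep = ≤-trans
      (+-monoʳ-≤ (f x) (∑-⊆ xs! (λ y∈xs → keep (xs⊆ys (there y∈xs)) (distinct x∉xs y∈xs)) f resp))
      (≤-reflexive (sym eq))
      where
      distinct : ∀ {y ws} → All (λ w → ¬ (x ≈ w)) ws → y ∈ ws → ¬ (x ≈ y)
      distinct (x≉w ∷ _)  (here y≈w) x≈y = x≉w (≈-trans x≈y y≈w)
      distinct (_ ∷ rest) (there y∈) x≈y = distinct rest y∈ x≈y

  -- Samples as tuples, and their blocks.

  tuples : List A → ∀ n → List (Vec A n)
  tuples xs zero    = [] ∷ []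
  tuples xs (suc n) = List.cartesianProductWith _∷_ xs (tuples xs n)

  ∑-tuples : ∀ (xs : List A) n f →
    ∑ (tuples xs (suc n)) f ≡ ∑ xs (λ x → ∑ (tuples xs n) (λ v → f (x ∷ v)))
  ∑-tuples xs n f = go xs
    where
    go : ∀ ys → ∑ (List.cartesianProductWith _∷_ ys (tuples xs n)) f
              ≡ ∑ ys (λ x → ∑ (tuples xs n) (λ v → f (x ∷ v)))
    go []       = refl
    go (y ∷ ys) = trans (∑-++ (map (y ∷_) (tuples xs n)) _ f)
      (cong₂ _+_ (∑-map (y ∷_) (tuples xs n) f) (go ys))

  length-tuples : ∀ (xs : List A) n → length (tuples xs n) ≡ length xs ^ n
  length-tuples xs zero    = refl
  length-tuples {A = A} xs (suc n) = go xs
    where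
    go : ∀ (ys : List A) → length (List.cartesianProductWith _∷_ ys (tuples xs n)) ≡ length ys * length xs ^ n
    go []       = refl
    go (y ∷ ys) = trans (List.length-++ (map (y ∷_) (tuples xs n)))
      (cong₂ _+_ (trans (List.length-map (y ∷_) (tuples xs n)) (length-tuples xs n)) (go ys))

  ∈-tuples⁻ : ∀ (xs : List A) n {v} → v ∈ˡ tuples xs n → VecAll.All (_∈ˡ xs) v
  ∈-tuples⁻ xs zero    {[]} _ = VecAll.[]
  ∈-tuples⁻ xs (suc n) v∈ with ∈.∈-cartesianProductWith⁻ _∷_ xs (tuples xs n) v∈
  ... | x , w , x∈ , w∈ , refl = x∈ VecAll.∷ ∈-tuples⁻ xs n w∈

  -- The entry at position i of a uniform tuple is independent of the others. With blocks as
  -- entries, this is the independence of the removed block from the remaining sample.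
  ∑-tuples-removeAt : ∀ (xs : List A) n (i : Fin (suc n)) (f : Vec A n → A → ℕ) →
    ∑ (tuples xs (suc n)) (λ v → f (removeAt v i) (lookup v i))
      ≡ ∑ (tuples xs n) (λ v → ∑ xs (f v))
  ∑-tuples-removeAt xs n zero f = trans (∑-tuples xs n _) (∑-swap xs (tuples xs n) _)
  ∑-tuples-removeAt xs (suc n) (suc i) f = begin
    ∑ (tuples xs (suc (suc n))) (λ v → f (removeAt v (suc i)) (lookup v (suc i)))
      ≡⟨ ∑-tuples xs (suc n) _ ⟩
    ∑ xs (λ x → ∑ (tuples xs (suc n)) (λ v → f (removeAt (x ∷ v) (suc i)) (lookup v i)))
      ≡⟨ ∑-cong xs (λ x → ∑-cong (tuples xs (suc n)) λ { (_ ∷ _) → refl }) ⟩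
    ∑ xs (λ x → ∑ (tuples xs (suc n)) (λ v → f (x ∷ removeAt v i) (lookup v i)))
      ≡⟨ ∑-cong xs (λ x → ∑-tuples-removeAt xs n i (λ v → f (x ∷ v))) ⟩
    ∑ xs (λ x → ∑ (tuples xs n) (λ v → ∑ xs (f (x ∷ v))))
      ≡⟨ ∑-tuples xs n (λ v → ∑ xs (f v)) ⟨
    ∑ (tuples xs (suc n)) (λ v → ∑ xs (f v)) ∎
    where open ≡-Reasoning

  -- For an indicator function `g`, this is the indicator that every entry has the property; the
  -- product form makes its sum over all tuples a power.
  weight : ∀ {n} → (A → ℕ) → Vec A n → ℕ
  weight g []       = 1
  weight g (x ∷ xs) = g x * weight g xs

  ∑-tuples-weight : ∀ (xs : List A) n g → ∑ (tuples xs n) (weight g) ≡ ∑ xs g ^ n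
  ∑-tuples-weight xs zero    g = refl
  ∑-tuples-weight xs (suc n) g = begin
    ∑ (tuples xs (suc n)) (weight g)                             ≡⟨ ∑-tuples xs n _ ⟩
    ∑ xs (λ x → ∑ (tuples xs n) (λ v → g x * weight g v))        ≡⟨ ∑-cong xs (λ x → ∑-*ˡ (tuples xs n) (g x) _) ⟩
    ∑ xs (λ x → g x * ∑ (tuples xs n) (weight g))                ≡⟨ ∑-*ʳ xs _ g ⟩
    ∑ xs g * ∑ (tuples xs n) (weight g)                          ≡⟨ cong (∑ xs g *_) (∑-tuples-weight xs n g) ⟩
    ∑ xs g * ∑ xs g ^ n                                          ∎
    where open ≡-Reasoning

  flatten : ∀ {m n} → Vec (Vec A n) m → List A
  flatten []      = []
  flatten (v ∷ w) = Vec.toList v List.++ flatten w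

  length-flatten : ∀ {m n} (w : Vec (Vec A n) m) → length (flatten w) ≡ m * n
  length-flatten []      = refl
  length-flatten (v ∷ w) = trans (List.length-++ (Vec.toList v))
    (cong₂ _+_ (Vec.length-toList v) (length-flatten w))

  ∈-flatten⁺ : ∀ {m n} (w : Vec (Vec A n) m) i {x} → x ∈ˡ Vec.toList (lookup w i) → x ∈ˡ flatten w
  ∈-flatten⁺ (v ∷ w) zero    x∈ = ∈.∈-++⁺ˡ x∈
  ∈-flatten⁺ (v ∷ w) (suc i) x∈ = ∈.∈-++⁺ʳ (Vec.toList v) (∈-flatten⁺ w i x∈)

  ∈-flatten⁻ : ∀ {m n} (w : Vec (Vec A n) m) {x} → x ∈ˡ flatten w → ∃[ i ] x ∈ˡ Vec.toList (lookup w i)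
  ∈-flatten⁻ (v ∷ w) x∈ with ∈.∈-++⁻ (Vec.toList v) x∈
  ... | inj₁ x∈v = zero , x∈v
  ... | inj₂ x∈w with ∈-flatten⁻ w x∈w
  ...   | i , x∈i = suc i , x∈i

  ∈-flatten-removeAt⁺ : ∀ {m n} (w : Vec (Vec A n) (suc m)) {i j x} → ¬ (j ≡ i) →
    x ∈ˡ Vec.toList (lookup w j) → x ∈ˡ flatten (removeAt w i)
  ∈-flatten-removeAt⁺ w@(_ ∷ _ ∷ _) {zero}  {zero}  j≢i x∈ = contradiction refl j≢i
  ∈-flatten-removeAt⁺ (_ ∷ [])      {zero}  {zero}  j≢i x∈ = contradiction refl j≢i
  ∈-flatten-removeAt⁺ (v ∷ w)       {zero}  {suc j} j≢i x∈ = ∈-flatten⁺ w j x∈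
  ∈-flatten-removeAt⁺ (v ∷ w@(_ ∷ _)) {suc i} {zero}  j≢i x∈ = ∈.∈-++⁺ˡ x∈
  ∈-flatten-removeAt⁺ (v ∷ w@(_ ∷ _)) {suc i} {suc j} j≢i x∈ =
    ∈.∈-++⁺ʳ (Vec.toList v) (∈-flatten-removeAt⁺ w (j≢i ∘ cong suc) x∈)

  ∈-flatten-removeAt⁻ : ∀ {m n} (w : Vec (Vec A n) (suc m)) i {x} →
    x ∈ˡ flatten (removeAt w i) → x ∈ˡ flatten w
  ∈-flatten-removeAt⁻ (v ∷ w)         zero    x∈ = ∈.∈-++⁺ʳ (Vec.toList v) x∈
  ∈-flatten-removeAt⁻ (v ∷ w@(_ ∷ _)) (suc i) x∈ with ∈.∈-++⁻ (Vec.toList v) x∈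
  ... | inj₁ x∈v = ∈.∈-++⁺ˡ x∈v
  ... | inj₂ x∈w = ∈.∈-++⁺ʳ (Vec.toList v) (∈-flatten-removeAt⁻ w i x∈w)

  -- An omitted block, and the decay of the probability of avoiding a set of curves.

  omitted : ∀ {m n} → m < n → (f : Fin m → Fin n) → ∃[ i ] ∀ j → ¬ (f j ≡ i)
  omitted {m} {n} m<n f with Fin.any? (λ i → Fin.all? (λ j → ¬? (f j Fin.≟ i)))
  ... | yes found = found
  ... | no  none  = contradiction (Fin.injective⇒≤ section-injective) (<⇒≱ m<n)
    where
    preimage : ∀ i → ∃[ j ] f j ≡ i
    preimage i with Fin.any? (λ j → f j Fin.≟ i)
    ... | yes found = found
    ... | no  none′ = contradiction (i , λ j fj≡i → none′ (j , fj≡i)) none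
    section-injective : ∀ {i i′} → proj₁ (preimage i) ≡ proj₁ (preimage i′) → i ≡ i′
    section-injective {i} {i′} eq = trans (sym (proj₂ (preimage i)))
      (trans (cong f eq) (proj₂ (preimage i′)))

  -- With p = κ/(κ + ν) this is (1 - p)^m (1 + m p) ≤ 1, an integral substitute for (1 - p)^m ≤
  -- e^(-mp). The induction step is (1 - p)(1 + (m + 1)p) ≤ 1 + m p.
  decay : ∀ m κ ν → ν ^ m * (κ + ν + m * κ) ≤ (κ + ν) ^ m * (κ + ν)
  decay zero    κ ν = ≤-reflexive (base κ ν)
    where
    base : ∀ κ ν → 1 * (κ + ν + 0) ≡ 1 * (κ + ν)
    base = solve-∀
  decay (suc m) κ ν = begin
    ν * ν ^ m * (κ + ν + (κ + m * κ))
      ≤⟨ m≤m+n _ (ν ^ m * (κ * (κ + m * κ))) ⟩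
    ν * ν ^ m * (κ + ν + (κ + m * κ)) + ν ^ m * (κ * (κ + m * κ))
      ≡⟨ expand ν (ν ^ m) κ (m * κ) ⟩
    (κ + ν) * (ν ^ m * (κ + ν + m * κ))
      ≤⟨ *-monoʳ-≤ (κ + ν) (decay m κ ν) ⟩
    (κ + ν) * ((κ + ν) ^ m * (κ + ν))
      ≡⟨ *-assoc (κ + ν) _ _ ⟨
    (κ + ν) ^ suc m * (κ + ν) ∎
    where
    open ≤-Reasoning
    expand : ∀ ν p κ x → ν * p * (κ + ν + (κ + x)) + p * (κ * (κ + x)) ≡ (κ + ν) * (p * (κ + ν + x))
    expand = solve-∀

  ^-distribʳ-* : ∀ x y n → (x * y) ^ n ≡ x ^ n * y ^ n
  ^-distribʳ-* x y zero    = refl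
  ^-distribʳ-* x y (suc n) rewrite ^-distribʳ-* x y n = swap x y (x ^ n) (y ^ n)
    where
    swap : ∀ x y p q → x * y * (p * q) ≡ x * p * (y * q)
    swap = solve-∀

  1≤m^n : ∀ {m} n → 1 ≤ m → 1 ≤ m ^ n
  1≤m^n n 1≤m = ≤-trans (≤-reflexive (sym (^-zeroˡ n))) (^-monoˡ-≤ n 1≤m)

  *-cancelˡ : ∀ c {m n} → 1 ≤ c → c * m ≤ c * n → m ≤ n
  *-cancelˡ (suc c) _ = *-cancelˡ-≤ (suc c)

  -- Put n = κ + ν and X = rκ/n > 1. Taking `decay` with m = h r to the power d + 1 bounds the share
  -- of avoiding blocks by (h X)^(-d-1). As j ≤ 2X, multiplication by j^d leaves at most 2^d
  -- h^(-d-1) / X.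
  decay-weighted : ∀ κ ν d h r j → 1 ≤ κ + ν → κ + ν < r * κ → j * (κ + ν) ≤ 2 * (r * κ) →
    h ^ suc d * (j ^ d * ν ^ (suc d * (h * r))) ≤ 2 ^ d * (κ + ν) ^ (suc d * (h * r))
  decay-weighted κ ν d h r j 1≤n n<rκ jn≤2rκ = *-cancelˡ (x ^ e * n ^ e)
    (*-mono-≤ (1≤m^n e (≤-trans 1≤n (<⇒≤ n<rκ))) (1≤m^n e 1≤n)) (begin
      x ^ e * n ^ e * (h ^ e * (j ^ d * ν ^ (e * m)))
        ≡⟨ cong (λ p → x ^ e * n ^ e * (h ^ e * (j ^ d * p))) (power ν) ⟩
      x ^ e * n ^ e * (h ^ e * (j ^ d * (ν ^ m) ^ e))
        ≡⟨ regroup (x ^ e) (n ^ e) (h ^ e) (j ^ d) ((ν ^ m) ^ e) ⟩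
      ((ν ^ m) ^ e * (h ^ e * x ^ e)) * (j ^ d * n ^ e)
        ≡⟨ cong (λ p → ((ν ^ m) ^ e * p) * (j ^ d * n ^ e)) (sym (^-distribʳ-* h x e)) ⟩
      ((ν ^ m) ^ e * (h * x) ^ e) * (j ^ d * n ^ e)
        ≡⟨ cong (_* (j ^ d * n ^ e)) (sym (^-distribʳ-* (ν ^ m) (h * x) e)) ⟩
      (ν ^ m * (h * x)) ^ e * (j ^ d * n ^ e)
        ≤⟨ *-mono-≤ (^-monoˡ-≤ e (≤-trans
             (*-monoʳ-≤ (ν ^ m) (≤-trans (≤-reflexive (sym (*-assoc h r κ))) (m≤n+m (h * r * κ) n)))
             (decay m κ ν))) bad ⟩
      (n ^ m * n) ^ e * (2 ^ d * x ^ e)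
        ≡⟨ cong (_* (2 ^ d * x ^ e)) (^-distribʳ-* (n ^ m) n e) ⟩
      (n ^ m) ^ e * n ^ e * (2 ^ d * x ^ e)
        ≡⟨ regroup′ ((n ^ m) ^ e) (n ^ e) (2 ^ d) (x ^ e) ⟩
      x ^ e * n ^ e * (2 ^ d * (n ^ m) ^ e)
        ≡⟨ cong (λ p → x ^ e * n ^ e * (2 ^ d * p)) (sym (power n)) ⟩
      x ^ e * n ^ e * (2 ^ d * n ^ (e * m)) ∎)
    where
    open ≤-Reasoning
    e = suc d
    m = h * r
    n = κ + ν
    x = r * κ
    power : ∀ y → y ^ (e * m) ≡ (y ^ m) ^ e
    power y = trans (cong (y ^_) (*-comm e m)) (sym (^-*-assoc y m e))
    regroup : ∀ p q s t u → p * q * (s * (t * u)) ≡ (u * (s * p)) * (t * q)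
    regroup = solve-∀
    regroup′ : ∀ p q s t → p * q * (s * t) ≡ t * q * (s * p)
    regroup′ = solve-∀
    pull : ∀ p q s → p * (q * s) ≡ q * (p * s)
    pull = solve-∀
    bad : j ^ d * n ^ e ≤ 2 ^ d * x ^ e
    bad = begin
      j ^ d * (n * n ^ d)      ≡⟨ pull (j ^ d) n (n ^ d) ⟩
      n * (j ^ d * n ^ d)      ≡⟨ cong (n *_) (sym (^-distribʳ-* j n d)) ⟩
      n * (j * n) ^ d          ≤⟨ *-mono-≤ (<⇒≤ n<rκ) (^-monoˡ-≤ d jn≤2rκ) ⟩
      x * (2 * x) ^ d          ≡⟨ cong (x *_) (^-distribʳ-* 2 x d) ⟩
      x * (2 ^ d * x ^ d)      ≡⟨ pull x (2 ^ d) (x ^ d) ⟩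
      2 ^ d * x ^ e            ∎

  abstract
    -- The price of treating again a cell crossed by κ of n curves: nothing if κ ≤ n/r, and
    -- otherwise j^d, where j is the least integer above rκ/n. Reducing the κ curves by the factor j
    -- brings them down to n/r.
    excess : (d n r κ : ℕ) → .{{NonZero n}} → ℕ
    excess d n r κ with r * κ ≤? n
    ... | yes _ = 0
    ... | no  _ = suc (r * κ / n) ^ d

    excess-decay : ∀ h d n r κ ν .{{_ : NonZero n}} → κ + ν ≡ n →
      h ^ suc d * (excess d n r κ * ν ^ (suc d * (h * r))) ≤ 2 ^ d * n ^ (suc d * (h * r))
    excess-decay h d n r κ ν refl with r * κ ≤? n
    ... | yes _ = ≤-trans (≤-reflexive (*-zeroʳ (h ^ suc d))) z≤n
    ... | no  rκ≰n = decay-weighted κ ν d h r (suc (r * κ / n)) (>-nonZero⁻¹ n) (≰⇒> rκ≰n)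
      (+-mono-≤ (≰⇒≥ rκ≰n) (≤-trans (m/n*n≤m (r * κ) n) (≤-reflexive (sym (+-identityʳ (r * κ))))))

    excess-cases : ∀ d n r κ .{{_ : NonZero n}} →
      (r * κ ≤ n) ⊎ (∃[ j ] 1 ≤ j × r * κ ≤ j * n × excess d n r κ ≡ j ^ d)
    excess-cases d n r κ with r * κ ≤? n
    ... | yes rκ≤n = inj₁ rκ≤n
    ... | no  _    = inj₂ (suc (r * κ / n) , s≤s z≤n
      , ≤-trans (≤-reflexive (m≡m%n+[m/n]*n (r * κ) n)) (+-monoˡ-≤ _ (<⇒≤ (m%n<n (r * κ) n)))
      , refl)

  -- Counting by indicators, and curves crossing a cell.

  module Counting (em : ExcludedMiddle ℓ) where

    ⟦_⟧ : Set ℓ → ℕ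
    ⟦ P ⟧ with em {P}
    ... | yes _ = 1
    ... | no  _ = 0

    ⟦⟧-true : ∀ {P} → P → ⟦ P ⟧ ≡ 1
    ⟦⟧-true {P} p with em {P}
    ... | yes _ = refl
    ... | no ¬p = contradiction p ¬p

    ⟦⟧-false : ∀ {P} → ¬ P → ⟦ P ⟧ ≡ 0
    ⟦⟧-false {P} ¬p with em {P}
    ... | yes p = contradiction p ¬p
    ... | no  _ = refl

    ⟦⟧-mono : ∀ {P Q} → (P → Q) → ⟦ P ⟧ ≤ ⟦ Q ⟧
    ⟦⟧-mono {P} {Q} P→Q with em {P}
    ... | yes p = ≤-reflexive (sym (⟦⟧-true (P→Q p)))
    ... | no  _ = z≤n

    ⟦⟧-complement : ∀ P → ⟦ P ⟧ + ⟦ ¬ P ⟧ ≡ 1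
    ⟦⟧-complement P with em {P}
    ... | yes p = cong suc (⟦⟧-false λ ¬p → ¬p p)
    ... | no ¬p = ⟦⟧-true ¬p

    count : Pred A ℓ → List A → ℕ
    count P xs = ∑ xs (λ x → ⟦ P x ⟧)

    count-mono : ∀ {P Q : Pred A ℓ} xs → (∀ {x} → P x → Q x) → count P xs ≤ count Q xs
    count-mono xs P⊆Q = ∑-mono xs λ _ → ⟦⟧-mono P⊆Q

    count-complement : ∀ (P : Pred A ℓ) xs → count P xs + count (¬_ ∘ P) xs ≡ length xs
    count-complement P xs = trans (sym (∑-+ xs _ _)) (trans (∑-cong xs (⟦⟧-complement ∘ P))
      (trans (∑-const xs 1) (*-identityʳ _)))

    select : Pred A ℓ → List A → List A
    select P = filter (λ x → em {P x})

    select-⊆ : ∀ (P : Pred A ℓ) xs → select P xs ⊆ xs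
    select-⊆ P = Sublist.filter-⊆ (λ x → em {P x})

    ∈-select⁻ : ∀ (P : Pred A ℓ) xs {x} → x ∈ˡ select P xs → x ∈ˡ xs × P x
    ∈-select⁻ P xs = ∈.∈-filter⁻ (λ x → em {P x})

    ∑-select : ∀ (P : Pred A ℓ) xs f → ∑ (select P xs) f ≡ ∑ xs (λ x → ⟦ P x ⟧ * f x)
    ∑-select P []       f = refl
    ∑-select P (x ∷ xs) f with em {P x}
    ... | yes _ = cong₂ _+_ (sym (+-identityʳ (f x))) (∑-select P xs f)
    ... | no  _ = ∑-select P xs f

    length-select : ∀ (P : Pred A ℓ) xs → length (select P xs) ≡ count P xs
    length-select P []       = refl
    length-select P (x ∷ xs) with em {P x}
    ... | yes _ = cong suc (length-select P xs)
    ... | no  _ = length-select P xs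

  module Crossing (em : ExcludedMiddle ℓ) {X Y : Set ℓ} (E : X → Y → Set ℓ) where
    open Counting em

    Crosses : Pred X ℓ → Pred Y ℓ
    Crosses Δ q = ∃[ x ] ∃[ x′ ] Δ x × Δ x′ × E x q × ¬ E x′ q

    Crosses-mono : ∀ {Δ Δ′ : Pred X ℓ} → (∀ {x} → Δ x → Δ′ x) → ∀ {q} → Crosses Δ q → Crosses Δ′ q
    Crosses-mono Δ⊆Δ′ (x , x′ , x∈ , x′∈ , e , ¬e) = x , x′ , Δ⊆Δ′ x∈ , Δ⊆Δ′ x′∈ , e , ¬e

    crossings : Pred X ℓ → List Y → ℕ
    crossings Δ Q = count (Crosses Δ) Q

  -- In a CellSystem, φ r bounds the number of cells of a sample of r curves, and k
  -- is the number of curves determining a cell.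
  record Growth : Set where
    field
      k d scale   : ℕ
      φ           : ℕ → ℕ
      1≤scale     : 1 ≤ scale
      φ-positive  : ∀ r → 1 ≤ r → 1 ≤ φ r
      φ-scale     : ∀ l r → 1 ≤ l → 1 ≤ r → φ (l * r) ≤ scale * l ^ d * φ r

  -- Constants of the sampling argument.

  module Constants (growth : Growth) where
    open Growth growth
    open ≤-Reasoning

    -- Already k + 1 blocks contain one that is free of the k determining curves; the additional one
    -- keeps the remaining sample nonempty even for k = 0. The order of decay `e` exceeds the growth
    -- order d by one, which is the source of the spare factor h.
    blocks e : ℕ
    blocks = suc (suc k)
    e = suc d

    abstract
      -- `F` is the coefficient in φ j ≤ F j^d. `G` collects the cost of a sample beyond h^d φ r,
      -- and `h` is chosen so that the spare factor h outweighs both `G` and the 2F demanded by the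
      -- pigeonhole argument. `C₂` bounds the number of cells of the full sample by C₂ φ r.
      F G h C₂ : ℕ
      F = scale * φ 1
      G = blocks * 2 ^ d * (scale * (suc k * e) ^ d)
      h = 2 * F * G
      C₂ = scale * (blocks * e * h) ^ d

      1≤F : 1 ≤ F
      1≤F = *-mono-≤ 1≤scale (φ-positive 1 ≤-refl)

      1≤G : 1 ≤ G
      1≤G = *-mono-≤ {1} {_} {1} (*-mono-≤ {1} {blocks} {1} (s≤s z≤n) (1≤m^n d (s≤s z≤n)))
        (*-mono-≤ {1} {_} {1} 1≤scale (1≤m^n d (s≤s z≤n)))

      1≤h : 1 ≤ h
      1≤h = *-mono-≤ {1} {2 * F} {1} (*-mono-≤ {1} {2} {1} (s≤s z≤n) 1≤F) 1≤G

      φ-power : ∀ j → 1 ≤ j → φ j ≤ F * j ^ d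
      φ-power j 1≤j = begin
        φ j                    ≡⟨ cong φ (*-identityʳ j) ⟨
        φ (j * 1)              ≤⟨ φ-scale j 1 1≤j ≤-refl ⟩
        scale * j ^ d * φ 1    ≡⟨ swap scale (j ^ d) (φ 1) ⟩
        F * j ^ d              ∎
        where
        swap : ∀ x y z → x * y * z ≡ x * z * y
        swap = solve-∀

      φ-sample : ∀ m r → 1 ≤ m → 1 ≤ r → φ (m * (e * (h * r))) ≤ scale * (m * e * h) ^ d * φ r
      φ-sample m r 1≤m 1≤r = begin
        φ (m * (e * (h * r)))           ≡⟨ cong φ (assoc m e h r) ⟩
        φ (m * e * h * r)               ≤⟨ φ-scale (m * e * h) r
                                             (*-mono-≤ {1} {m * e} {1} (*-mono-≤ {1} {m} {1} 1≤m (s≤s z≤n)) 1≤h) 1≤r ⟩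
        scale * (m * e * h) ^ d * φ r   ∎
        where
        assoc : ∀ m e h r → m * (e * (h * r)) ≡ m * e * h * r
        assoc = solve-∀

      φ-sample-blocks : ∀ r → 1 ≤ r → φ (blocks * (e * (h * r))) ≤ C₂ * φ r
      φ-sample-blocks r = φ-sample blocks r (s≤s z≤n)

      sample-cost : ∀ r → 1 ≤ r → blocks * (φ (suc k * (e * (h * r))) * 2 ^ d) ≤ h ^ d * (G * φ r)
      sample-cost r 1≤r = begin
        blocks * (φ (suc k * (e * (h * r))) * 2 ^ d)
          ≤⟨ *-monoʳ-≤ blocks (*-monoˡ-≤ (2 ^ d) (φ-sample (suc k) r (s≤s z≤n) 1≤r)) ⟩
        blocks * (scale * (suc k * e * h) ^ d * φ r * 2 ^ d)
          ≡⟨ cong (λ p → blocks * (scale * p * φ r * 2 ^ d)) (^-distribʳ-* (suc k * e) h d) ⟩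
        blocks * (scale * ((suc k * e) ^ d * h ^ d) * φ r * 2 ^ d)
          ≡⟨ regroup blocks scale ((suc k * e) ^ d) (h ^ d) (φ r) (2 ^ d) ⟩
        h ^ d * (G * φ r) ∎
        where
        regroup : ∀ b s p q f t → b * (s * (p * q) * f * t) ≡ q * (b * t * (s * p) * f)
        regroup = solve-∀

      -- The number of cells costs h^d and the decay gains h^(d+1). The surplus h = 2 F G cancels G
      -- and leaves the factor 2 F.
      cancel-sample-cost : ∀ r W → h ^ e * W ≤ h ^ d * (G * φ r) → 2 * F * W ≤ φ r
      cancel-sample-cost r W light = *-cancelˡ G 1≤G (begin
        G * (2 * F * W)   ≡⟨ rotate G (2 * F) W ⟩
        h * W             ≤⟨ *-cancelˡ (h ^ d) (1≤m^n d 1≤h)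
                               (≤-trans (≤-reflexive (pull (h ^ d) h W)) light) ⟩
        G * φ r           ∎)
        where
        rotate : ∀ x y z → x * (y * z) ≡ y * x * z
        rotate = solve-∀
        pull : ∀ x y z → x * (y * z) ≡ y * x * z
        pull = solve-∀

    abstract
      density-constant : ℕ
      density-constant = suc (2 * C₂)

      1≤density-constant : 1 ≤ density-constant
      1≤density-constant = s≤s z≤n

      -- Each summand takes at most half of the right-hand side: the number of cells because
      -- `density-constant` exceeds 2 C₂, the weights because of the factor 2 F in their bound.
      total-weight : ∀ l w f → l ≤ C₂ * f → 2 * F * w ≤ f → l + density-constant * F * w ≤ density-constant * f
      total-weight l w f l≤ w≤ = *-cancelˡ 2 (s≤s z≤n) (begin
        2 * (l + C₁ * F * w)
          ≡⟨ split l C₁ F w ⟩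
        2 * l + C₁ * (2 * F * w)
          ≤⟨ +-mono-≤ (*-monoʳ-≤ 2 l≤) (*-monoʳ-≤ C₁ w≤) ⟩
        2 * (C₂ * f) + C₁ * f
          ≤⟨ m≤m+n _ f ⟩
        2 * (C₂ * f) + C₁ * f + f
          ≡⟨ collect C₂ f ⟩
        2 * (C₁ * f) ∎)
        where
        C₁ : ℕ
        C₁ = density-constant
        split : ∀ l c f w → 2 * (l + c * f * w) ≡ 2 * l + c * (2 * f * w)
        split = solve-∀
        collect : ∀ c f → 2 * (c * f) + suc (2 * c) * f + f ≡ 2 * (suc (2 * c) * f)
        collect = solve-∀

  -- Samples are lists because random samples repeat curves. `IsCell` is kept apart from its
  -- enumeration `cells` so that one and the same set can be recognised as a cell of two samples,
  -- which is how `local` is used.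
  record CellSystem {X Y : Set ℓ} (em : ExcludedMiddle ℓ) (E : X → Y → Set ℓ) (growth : Growth) :
    Set (Level.suc ℓ) where
    open Growth growth using (k; φ)
    open Crossing em E public
    open Setoid (≐-setoid X ℓ) using () renaming (Carrier to Cell)
    open SetoidMembership (≐-setoid X ℓ) using () renaming (_∈_ to _∈ᶜ_)
    field
      IsCell      : List Y → Cell → Set ℓ
      cells       : List Y → List Cell
      cells!      : ∀ S → 1 ≤ length S → SetoidUnique.Unique (≐-setoid X ℓ) (cells S)
      cells⇔      : ∀ S → 1 ≤ length S → ∀ Δ → IsCell S Δ ⇔ Δ ∈ᶜ cells S
      cells-size  : ∀ S → 1 ≤ length S → length (cells S) ≤ φ (length S)
      covers      : ∀ S → 1 ≤ length S → ∀ x → ∃[ Δ ] IsCell S Δ × Δ x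
      uncrossed   : ∀ S → 1 ≤ length S → ∀ {Δ} → IsCell S Δ → ∀ {q} → q ∈ˡ S → ¬ Crosses Δ q
      local       : ∀ S {Δ} → IsCell S Δ → Σ[ D ∈ (Fin k → Y) ] (∀ i → D i ∈ˡ S) ×
                      (∀ S′ → (∀ {q} → q ∈ˡ S′ → q ∈ˡ S) → (∀ i → D i ∈ˡ S′) → IsCell S′ Δ)

  -- Many points crossed by few curves.

  module Density (em : ExcludedMiddle ℓ) {X Y : Set ℓ} {E : X → Y → Set ℓ}
    {growth : Growth} (𝒞 : CellSystem em E growth) where
    open Growth growth
    open Constants growth
    open CellSystem 𝒞
    open Counting em
    open Setoid (≐-setoid X ℓ) using () renaming (Carrier to Cell)
    open ≤-Reasoning

    crossings-cong : ∀ {Δ Δ′} → Δ ≐ Δ′ → ∀ Q → crossings Δ Q ≡ crossings Δ′ Q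
    crossings-cong (Δ⊆Δ′ , Δ′⊆Δ) Q = ≤-antisym
      (count-mono Q (Crosses-mono Δ⊆Δ′)) (count-mono Q (Crosses-mono Δ′⊆Δ))

    avoidance : ∀ {n} → Cell → Vec Y n → ℕ
    avoidance Δ = weight (λ q → ⟦ ¬ Crosses Δ q ⟧)

    avoidance-cong : ∀ {Δ Δ′} → Δ ≐ Δ′ → ∀ {n} (b : Vec Y n) → avoidance Δ b ≡ avoidance Δ′ b
    avoidance-cong _ [] = refl
    avoidance-cong Δ≐@(Δ⊆Δ′ , Δ′⊆Δ) (q ∷ b) = cong₂ _*_
      (≤-antisym (⟦⟧-mono λ ¬c c → ¬c (Crosses-mono Δ′⊆Δ c)) (⟦⟧-mono λ ¬c c → ¬c (Crosses-mono Δ⊆Δ′ c)))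
      (avoidance-cong Δ≐ b)

    avoidance-one : ∀ {Δ n} (b : Vec Y n) → (∀ {q} → q ∈ˡ Vec.toList b → ¬ Crosses Δ q) → avoidance Δ b ≡ 1
    avoidance-one []      _ = refl
    avoidance-one (q ∷ b) h = cong₂ _*_ (⟦⟧-true (h (here refl))) (avoidance-one b (h ∘ there))

    ∈⇒IsCell : ∀ {S Δ} → 1 ≤ length S → Δ ∈ˡ cells S → IsCell S Δ
    ∈⇒IsCell {S} 1≤S Δ∈ = Equivalence.from (cells⇔ S 1≤S _)
      (Any.map (λ { refl → Setoid.refl (≐-setoid X ℓ) }) Δ∈)

    nonempty-flatten : ∀ {m ρ} → 1 ≤ m → 1 ≤ ρ → (v : Vec (Vec Y ρ) m) → 1 ≤ length (flatten v)
    nonempty-flatten 1≤m 1≤ρ v = ≤-trans (*-mono-≤ 1≤m 1≤ρ) (≤-reflexive (sym (length-flatten v)))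

    -- A cell of a sample of k + 2 blocks is determined by at most k of its
    -- curves, hence survives the removal of some block, and it is not crossed by
    -- the removed block.
    remove-block : ∀ {ρ} → 1 ≤ ρ → (v : Vec (Vec Y ρ) blocks) (w : Cell → ℕ) →
      (∀ {Δ Δ′} → Δ ≐ Δ′ → w Δ ≡ w Δ′) →
      ∑ (cells (flatten v)) w ≤
        ∑ (allFin blocks) (λ i → ∑ (cells (flatten (removeAt v i))) (λ Δ → w Δ * avoidance Δ (lookup v i)))
    remove-block {ρ} 1≤ρ v w w-cong = begin
      ∑ (cells S) w
        ≤⟨ ∑-mono (cells S) (λ {Δ} Δ∈ → let i , survives = survivor (∈⇒IsCell 1≤S Δ∈) in begin
             w Δ                                    ≡⟨ +-identityʳ (w Δ) ⟨
             1 * w Δ                                ≡⟨ cong (_* w Δ) (⟦⟧-true survives) ⟨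
             ⟦ Survives i Δ ⟧ * w Δ                 ≤⟨ ∈⇒≤∑ (λ i → ⟦ Survives i Δ ⟧ * w Δ) (∈.∈-allFin i) ⟩
             ∑ (allFin blocks) (λ i → ⟦ Survives i Δ ⟧ * w Δ) ∎) ⟩
      ∑ (cells S) (λ Δ → ∑ (allFin blocks) (λ i → ⟦ Survives i Δ ⟧ * w Δ))
        ≡⟨ ∑-swap (cells S) (allFin blocks) _ ⟩
      ∑ (allFin blocks) (λ i → ∑ (cells S) (λ Δ → ⟦ Survives i Δ ⟧ * w Δ))
        ≤⟨ ∑-mono (allFin blocks) (λ {i} _ → begin
             ∑ (cells S) (λ Δ → ⟦ Survives i Δ ⟧ * w Δ)
               ≡⟨ ∑-select (Survives i) (cells S) w ⟨
             ∑ (select (Survives i) (cells S)) w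
               ≤⟨ ∑-mono (select (Survives i) (cells S)) (λ {Δ} Δ∈ → ≤-reflexive (begin-equality
                    w Δ                              ≡⟨ *-identityʳ (w Δ) ⟨
                    w Δ * 1                          ≡⟨ cong (w Δ *_) (avoidance-one (lookup v i)
                                                          (proj₂ (proj₂ (∈-select⁻ (Survives i) (cells S) Δ∈)))) ⟨
                    w Δ * avoidance Δ (lookup v i)   ∎)) ⟩
             ∑ (select (Survives i) (cells S)) (λ Δ → w Δ * avoidance Δ (lookup v i))
               -- The sum is enlarged to all cells of the remaining blocks. Its range then no longer
               -- depends on block i, so that this block can be averaged independently.
               ≤⟨ ∑-⊆ (≐-setoid X ℓ)
                    (SetoidUniqueP.filter⁺ (≐-setoid X ℓ) (λ Δ → em {Survives i Δ}) (cells! S 1≤S))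
                    (λ Δ∈ → let Δ₀ , Δ₀∈ , Δ≐Δ₀ = find Δ∈ in
                      ∈ₛ.∈-resp-≈ (≐-setoid X ℓ) (Setoid.sym (≐-setoid X ℓ) Δ≐Δ₀)
                        (Equivalence.to (cells⇔ _ (nonempty-flatten (s≤s z≤n) 1≤ρ (removeAt v i)) Δ₀)
                          (proj₁ (proj₂ (∈-select⁻ (Survives i) (cells S) Δ₀∈)))))
                    _ (λ Δ≐ → cong₂ _*_ (w-cong Δ≐) (avoidance-cong Δ≐ (lookup v i))) ⟩
             ∑ (cells (flatten (removeAt v i))) (λ Δ → w Δ * avoidance Δ (lookup v i)) ∎) ⟩
      ∑ (allFin blocks) (λ i → ∑ (cells (flatten (removeAt v i))) (λ Δ → w Δ * avoidance Δ (lookup v i))) ∎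
      where
      S = flatten v
      1≤S = nonempty-flatten (s≤s z≤n) 1≤ρ v
      Survives : Fin blocks → Cell → Set ℓ
      Survives i Δ = IsCell (flatten (removeAt v i)) Δ × (∀ {q} → q ∈ˡ Vec.toList (lookup v i) → ¬ Crosses Δ q)
      survivor : ∀ {Δ} → IsCell S Δ → ∃[ i ] Survives i Δ
      survivor {Δ} Δ-cell with local S Δ-cell
      ... | D , D∈S , restrict with omitted (n≤1+n (suc k)) (λ j → proj₁ (∈-flatten⁻ v (D∈S j)))
      ...   | i , unused = i
            , restrict (flatten (removeAt v i)) (∈-flatten-removeAt⁻ v i)
                (λ j → ∈-flatten-removeAt⁺ v (unused j) (proj₂ (∈-flatten⁻ v (D∈S j))))
            , λ q∈ → uncrossed S 1≤S Δ-cell (∈-flatten⁺ v i q∈)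

    -- The quotient g/c bounds the weight of a cell times the probability that a random block avoids
    -- it. By `remove-block` and independence, the average weight is at most this quotient times the
    -- number of cells of k + 1 blocks, once for each choice of the removed block.
    average-weight : ∀ (Q : List Y) ρ → 1 ≤ ρ → (w : Cell → ℕ) → (∀ {Δ Δ′} → Δ ≐ Δ′ → w Δ ≡ w Δ′) →
      ∀ c g → (∀ Δ → c * (w Δ * count (¬_ ∘ Crosses Δ) Q ^ ρ) ≤ g * length Q ^ ρ) →
      let samples = tuples (tuples Q ρ) blocks in
      ∑ samples (λ v → c * ∑ (cells (flatten v)) w)
        ≤ length samples * (blocks * (φ (suc k * ρ) * g))
    average-weight Q ρ 1≤ρ w w-cong c g bound = begin
      ∑ samples (λ v → c * ∑ (cells (flatten v)) w)
        ≡⟨ ∑-*ˡ samples c _ ⟩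
      c * ∑ samples (λ v → ∑ (cells (flatten v)) w)
        ≤⟨ *-monoʳ-≤ c (∑-mono samples (λ {v} _ → remove-block 1≤ρ v w w-cong)) ⟩
      c * ∑ samples (λ v → ∑ (allFin blocks) (λ i → total (removeAt v i) (lookup v i)))
        ≡⟨ cong (c *_) (∑-swap samples (allFin blocks) _) ⟩
      c * ∑ (allFin blocks) (λ i → ∑ samples (λ v → total (removeAt v i) (lookup v i)))
        ≡⟨ cong (c *_) (∑-cong (allFin blocks) (λ i → ∑-tuples-removeAt W (suc k) i total)) ⟩
      c * ∑ (allFin blocks) (λ _ → ∑ samples′ (λ v → ∑ W (total v)))
        ≡⟨ cong (c *_) (trans (∑-const (allFin blocks) (∑ samples′ (λ v → ∑ W (total v))))
             (cong (_* ∑ samples′ (λ v → ∑ W (total v))) (List.length-tabulate {n = blocks} (λ i → i)))) ⟩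
      c * (blocks * ∑ samples′ (λ v → ∑ W (total v)))
        ≡⟨ pull c blocks _ ⟩
      blocks * (c * ∑ samples′ (λ v → ∑ W (total v)))
        ≡⟨ cong (blocks *_) (∑-*ˡ samples′ c _) ⟨
      blocks * ∑ samples′ (λ v → c * ∑ W (total v))
        ≤⟨ *-monoʳ-≤ blocks (∑-bound samples′ λ {v} _ → per-sample v) ⟩
      blocks * (length samples′ * (φ (suc k * ρ) * (g * length W)))
        ≡⟨ regroup blocks (length samples′) (φ (suc k * ρ)) g (length W) ⟩
      length W * length samples′ * (blocks * (φ (suc k * ρ) * g))
        ≡⟨ cong (λ p → length W * p * (blocks * (φ (suc k * ρ) * g))) (length-tuples W (suc k)) ⟩
      length W ^ blocks * (blocks * (φ (suc k * ρ) * g))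
        ≡⟨ cong (_* (blocks * (φ (suc k * ρ) * g))) (length-tuples W blocks) ⟨
      length samples * (blocks * (φ (suc k * ρ) * g)) ∎
      where
      W = tuples Q ρ
      samples = tuples W blocks
      samples′ = tuples W (suc k)
      total : Vec (Vec Y ρ) (suc k) → Vec Y ρ → ℕ
      total v b = ∑ (cells (flatten v)) (λ Δ → w Δ * avoidance Δ b)
      pull : ∀ p q s → p * (q * s) ≡ q * (p * s)
      pull = solve-∀
      regroup : ∀ p q s t u → p * (q * (s * (t * u))) ≡ u * q * (p * (s * t))
      regroup = solve-∀
      per-sample : ∀ v → c * ∑ W (total v) ≤ φ (suc k * ρ) * (g * length W)
      per-sample v = begin
        c * ∑ W (λ b → ∑ (cells (flatten v)) (λ Δ → w Δ * avoidance Δ b))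
          ≡⟨ cong (c *_) (∑-swap W (cells (flatten v)) _) ⟩
        c * ∑ (cells (flatten v)) (λ Δ → ∑ W (λ b → w Δ * avoidance Δ b))
          ≡⟨ cong (c *_) (∑-cong (cells (flatten v)) (λ Δ → trans (∑-*ˡ W (w Δ) (avoidance Δ))
               (cong (w Δ *_) (∑-tuples-weight Q ρ _)))) ⟩
        c * ∑ (cells (flatten v)) (λ Δ → w Δ * count (¬_ ∘ Crosses Δ) Q ^ ρ)
          ≡⟨ ∑-*ˡ (cells (flatten v)) c _ ⟨
        ∑ (cells (flatten v)) (λ Δ → c * (w Δ * count (¬_ ∘ Crosses Δ) Q ^ ρ))
          ≤⟨ ∑-bound (cells (flatten v)) (λ {Δ} _ → bound Δ) ⟩
        length (cells (flatten v)) * (g * length Q ^ ρ)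
          ≤⟨ *-mono-≤ (≤-trans (cells-size (flatten v) (nonempty-flatten (s≤s z≤n) 1≤ρ v))
               (≤-reflexive (cong φ (length-flatten v))))
               (≤-reflexive (cong (g *_) (sym (length-tuples Q ρ)))) ⟩
        φ (suc k * ρ) * (g * length W) ∎

    Dense : List X → List Y → ℕ → Set ℓ
    Dense P Q r = ∃[ P′ ] P′ ⊆ P × length P ≤ density-constant * φ r * length P′
                  × r * crossings (_∈ˡ P′) Q ≤ length Q

    -- A sample whose weight is at most the average. The curve q is recorded because no cell of the
    -- sample is crossed by it, so every cell is crossed by fewer than |Q| curves and the recursion
    -- terminates.
    light-sample : ∀ Q r .{{_ : NonZero (length Q)}} → 1 ≤ r → ∃[ S ] 1 ≤ length S × (∃[ q ] q ∈ˡ S × q ∈ˡ Q)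
      × 2 * F * ∑ (cells S) (λ Δ → excess d (length Q) r (crossings Δ Q)) ≤ φ r
      × length (cells S) ≤ C₂ * φ r
    light-sample Q r 1≤r = at (e * (h * r)) refl (*-mono-≤ {1} {e} {1} (s≤s z≤n) (*-mono-≤ {1} {h} {1} 1≤h 1≤r))
      where
      n = length Q
      w : Cell → ℕ
      w Δ = excess d n r (crossings Δ Q)
      first : ∀ {m} → 1 ≤ m → (b : Vec Y m) → VecAll.All (_∈ˡ Q) b → ∃[ q ] q ∈ˡ Vec.toList b × q ∈ˡ Q
      first _ (q ∷ _) (q∈Q VecAll.∷ _) = q , here refl , q∈Q
      at : ∀ ρ → e * (h * r) ≡ ρ → 1 ≤ ρ → ∃[ S ] 1 ≤ length S × (∃[ q ] q ∈ˡ S × q ∈ˡ Q)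
        × 2 * F * ∑ (cells S) w ≤ φ r × length (cells S) ≤ C₂ * φ r
      at ρ ρ≡ 1≤ρ = from-average (∑-average (tuples (tuples Q ρ) blocks) nonempty average)
        where
        W : Vec (Vec Y ρ) blocks → ℕ
        W v = ∑ (cells (flatten v)) w
        nonempty : 1 ≤ length (tuples (tuples Q ρ) blocks)
        nonempty = ≤-trans (1≤m^n blocks (≤-trans (1≤m^n ρ (>-nonZero⁻¹ n)) (≤-reflexive (sym (length-tuples Q ρ)))))
          (≤-reflexive (sym (length-tuples (tuples Q ρ) blocks)))
        average : ∑ (tuples (tuples Q ρ) blocks) (λ v → h ^ e * W v)
          ≤ length (tuples (tuples Q ρ) blocks) * (h ^ d * (G * φ r))
        average = ≤-trans
          (average-weight Q ρ 1≤ρ w (λ Δ≐ → cong (λ κ → excess d n r κ) (crossings-cong Δ≐ Q)) (h ^ e) (2 ^ d)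
            (λ Δ → subst (λ ρ → h ^ e * (w Δ * count (¬_ ∘ Crosses Δ) Q ^ ρ) ≤ 2 ^ d * n ^ ρ) ρ≡
              (excess-decay h d n r _ _ (count-complement (Crosses Δ) Q))))
          (*-monoʳ-≤ (length (tuples (tuples Q ρ) blocks))
            (subst (λ ρ → blocks * (φ (suc k * ρ) * 2 ^ d) ≤ h ^ d * (G * φ r)) ρ≡ (sample-cost r 1≤r)))
        from-average : ∃[ v ] v ∈ˡ tuples (tuples Q ρ) blocks × h ^ e * W v ≤ h ^ d * (G * φ r) →
          ∃[ S ] 1 ≤ length S × (∃[ q ] q ∈ˡ S × q ∈ˡ Q) × 2 * F * ∑ (cells S) w ≤ φ r × length (cells S) ≤ C₂ * φ r
        from-average (v , v∈ , light) = flatten v , nonempty-flatten (s≤s z≤n) 1≤ρ v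
          , (let q , q∈b , q∈Q = first 1≤ρ (lookup v zero)
                   (∈-tuples⁻ Q ρ (VecAll.lookup⁺ (∈-tuples⁻ (tuples Q ρ) blocks v∈) zero))
             in q , ∈-flatten⁺ v zero q∈b , q∈Q)
          , cancel-sample-cost r (W v) light
          , (begin
              length (cells (flatten v))  ≤⟨ cells-size (flatten v) (nonempty-flatten (s≤s z≤n) 1≤ρ v) ⟩
              φ (length (flatten v))      ≡⟨ cong φ (length-flatten v) ⟩
              φ (blocks * ρ)              ≤⟨ subst (λ ρ → φ (blocks * ρ) ≤ C₂ * φ r) ρ≡ (φ-sample-blocks r 1≤r) ⟩
              C₂ * φ r                    ∎)

    covering : ∀ S → 1 ≤ length S → ∀ P → length P ≤ ∑ (cells S) (λ Δ → count Δ P)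
    covering S 1≤S P = begin
      length P                                             ≡⟨ trans (∑-const P 1) (*-identityʳ _) ⟨
      ∑ P (const 1)                                        ≤⟨ ∑-mono P (λ {x} _ → covered x) ⟩
      ∑ P (λ x → ∑ (cells S) (λ Δ → ⟦ Δ x ⟧))              ≡⟨ ∑-swap P (cells S) _ ⟩
      ∑ (cells S) (λ Δ → count Δ P)                        ∎
      where
      covered : ∀ x → 1 ≤ ∑ (cells S) (λ Δ → ⟦ Δ x ⟧)
      covered x with covers S 1≤S x
      ... | Δ , Δ-cell , x∈Δ with find (Equivalence.to (cells⇔ S 1≤S Δ) Δ-cell)
      ...   | Δ₀ , Δ₀∈ , (Δ⊆Δ₀ , _) = ≤-trans (≤-reflexive (sym (⟦⟧-true (Δ⊆Δ₀ x∈Δ))))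
                                        (∈⇒≤∑ (λ Δ → ⟦ Δ x ⟧) Δ₀∈)

    -- The weights 1 + C₁ F w Δ sum to at most C₁ f, while the cells cover every point; so some cell
    -- contains its proportional share of `P`. The summand 1 serves a cell that is good enough as it
    -- is, the other summand one that must be subdivided.
    heavy-cell-of : ∀ P S → 1 ≤ length P → 1 ≤ length S → ∀ f (w : Cell → ℕ) →
      2 * F * ∑ (cells S) w ≤ f → length (cells S) ≤ C₂ * f →
      ∃[ Δ ] Δ ∈ˡ cells S × length P * suc (density-constant * F * w Δ) ≤ density-constant * f * count Δ P
    heavy-cell-of P S 1≤m 1≤S f w weight≤ size≤ = ∑-pigeonhole (cells S) nonempty comparison
      where
      m = length P
      C₁ = density-constant
      nonempty : 0 < length (cells S)
      nonempty with cells S | covering S 1≤S P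
      ... | []    | m≤0 = ≤-trans 1≤m m≤0
      ... | _ ∷ _ | _   = s≤s z≤n
      comparison : ∑ (cells S) (λ Δ → m * suc (C₁ * F * w Δ)) ≤ ∑ (cells S) (λ Δ → C₁ * f * count Δ P)
      comparison = begin
        ∑ (cells S) (λ Δ → m * suc (C₁ * F * w Δ))
          ≡⟨ ∑-*ˡ (cells S) m _ ⟩
        m * ∑ (cells S) (λ Δ → 1 + C₁ * F * w Δ)
          ≡⟨ cong (m *_) (∑-+ (cells S) (const 1) (λ Δ → C₁ * F * w Δ)) ⟩
        m * (∑ (cells S) (const 1) + ∑ (cells S) (λ Δ → C₁ * F * w Δ))
          ≡⟨ cong (m *_) (cong₂ _+_ (trans (∑-const (cells S) 1) (*-identityʳ _)) (∑-*ˡ (cells S) (C₁ * F) w)) ⟩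
        m * (length (cells S) + C₁ * F * ∑ (cells S) w)
          ≤⟨ *-mono-≤ (covering S 1≤S P) (total-weight (length (cells S)) (∑ (cells S) w) f size≤ weight≤) ⟩
        ∑ (cells S) (λ Δ → count Δ P) * (C₁ * f)
          ≡⟨ *-comm (∑ (cells S) (λ Δ → count Δ P)) (C₁ * f) ⟩
        C₁ * f * ∑ (cells S) (λ Δ → count Δ P)
          ≡⟨ ∑-*ˡ (cells S) (C₁ * f) (λ Δ → count Δ P) ⟨
        ∑ (cells S) (λ Δ → C₁ * f * count Δ P) ∎

    heavy-cell : ∀ P Q r .{{_ : NonZero (length Q)}} → 1 ≤ length P → 1 ≤ r →
      ∃[ Δ ] (∃[ q ] q ∈ˡ Q × ¬ Crosses Δ q) ×
        length P * suc (density-constant * F * excess d (length Q) r (crossings Δ Q))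
          ≤ density-constant * φ r * count Δ P
    heavy-cell P Q r 1≤m 1≤r =
      let S , 1≤S , (q , q∈S , q∈Q) , weight≤ , size≤ = light-sample Q r 1≤r
          Δ , Δ∈ , heavy = heavy-cell-of P S 1≤m 1≤S (φ r) _ weight≤ size≤
      in Δ , (q , q∈Q , uncrossed S 1≤S (∈⇒IsCell 1≤S Δ∈) q∈S) , heavy

    dense-cell : ∀ P Q r Δ → r * crossings Δ Q ≤ length Q →
      length P ≤ density-constant * φ r * count Δ P → Dense P Q r
    dense-cell P Q r Δ few heavy = select Δ P , select-⊆ Δ P
      , ≤-trans heavy (≤-reflexive (cong (density-constant * φ r *_) (sym (length-select Δ P))))
      , ≤-trans (*-monoʳ-≤ r (count-mono Q (Crosses-mono λ x∈ → proj₂ (∈-select⁻ Δ P x∈)))) few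

    crossings-restrict : ∀ {Δ : Cell} {P} Q → (∀ {x} → x ∈ˡ P → Δ x) →
      crossings (_∈ˡ P) Q ≤ crossings (_∈ˡ P) (select (Crosses Δ) Q)
    crossings-restrict {Δ} {P} Q P⊆Δ = ≤-trans (∑-mono Q λ {q} _ → step q)
      (≤-reflexive (sym (∑-select (Crosses Δ) Q _)))
      where
      step : ∀ q → ⟦ Crosses (_∈ˡ P) q ⟧ ≤ ⟦ Crosses Δ q ⟧ * ⟦ Crosses (_∈ˡ P) q ⟧
      step q with em {Crosses (_∈ˡ P) q}
      ... | no  _       = z≤n
      ... | yes crossed = ≤-reflexive (sym (trans (*-identityʳ _) (⟦⟧-true (Crosses-mono P⊆Δ crossed))))

    -- Both conditions of `Dense` multiply along the recursion. The share of points inside Δ is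
    -- larger by F j^d, which cancels the bound on φ j. Of the at most j|Q|/r curves crossing Δ, at
    -- most one j-th crosses the smaller set.
    dense-subdivision : ∀ P Q r j Δ → 1 ≤ j → r * crossings Δ Q ≤ j * length Q →
      length P * (density-constant * F * j ^ d) ≤ density-constant * φ r * count Δ P →
      Dense (select Δ P) (select (Crosses Δ) Q) j → Dense P Q r
    dense-subdivision P Q r j Δ 1≤j rκ≤jn heavy (P′ , P′⊆ , dense , sparse) =
      P′ , ⊆-trans P′⊆ (select-⊆ Δ P)
      , *-cancelˡ (C₁ * F * j ^ d)
          (*-mono-≤ {1} {C₁ * F} {1} (*-mono-≤ {1} {C₁} {1} 1≤density-constant 1≤F) (1≤m^n d 1≤j)) (begin
          C₁ * F * j ^ d * m                        ≡⟨ *-comm (C₁ * F * j ^ d) m ⟩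
          m * (C₁ * F * j ^ d)                      ≤⟨ heavy ⟩
          C₁ * φ r * count Δ P                      ≡⟨ cong (C₁ * φ r *_) (length-select Δ P) ⟨
          C₁ * φ r * length (select Δ P)            ≤⟨ *-monoʳ-≤ (C₁ * φ r) dense ⟩
          C₁ * φ r * (C₁ * φ j * length P′)         ≤⟨ *-monoʳ-≤ (C₁ * φ r) (*-monoˡ-≤ (length P′)
                                                         (*-monoʳ-≤ C₁ (φ-power j 1≤j))) ⟩
          C₁ * φ r * (C₁ * (F * j ^ d) * length P′) ≡⟨ regroup C₁ (φ r) F (j ^ d) (length P′) ⟩
          C₁ * F * j ^ d * (C₁ * φ r * length P′)   ∎)
      , *-cancelˡ j 1≤j (begin
          j * (r * crossings (_∈ˡ P′) Q)                         ≤⟨ *-monoʳ-≤ j (*-monoʳ-≤ r (crossings-restrict Q λ x∈ →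
                                                                      proj₂ (∈-select⁻ Δ P (Sublist.Any-resp-⊆ P′⊆ x∈)))) ⟩
          j * (r * crossings (_∈ˡ P′) (select (Crosses Δ) Q))    ≡⟨ pull j r _ ⟩
          r * (j * crossings (_∈ˡ P′) (select (Crosses Δ) Q))    ≤⟨ *-monoʳ-≤ r sparse ⟩
          r * length (select (Crosses Δ) Q)                      ≡⟨ cong (r *_) (length-select (Crosses Δ) Q) ⟩
          r * crossings Δ Q                                      ≤⟨ rκ≤jn ⟩
          j * length Q                                           ∎)
      where
      m C₁ : ℕ
      m = length P
      C₁ = density-constant
      regroup : ∀ c f g p l → c * f * (c * (g * p) * l) ≡ c * g * p * (c * f * l)
      regroup = solve-∀
      pull : ∀ x y z → x * (y * z) ≡ y * (x * z)
      pull = solve-∀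

    crossings<length : ∀ {Δ Q q} → q ∈ˡ Q → ¬ Crosses Δ q → crossings Δ Q < length Q
    crossings<length {Δ} {Q} {q} q∈Q q-avoids = begin-strict
      crossings Δ Q                              ≡⟨ +-identityʳ _ ⟨
      crossings Δ Q + 0                          <⟨ +-monoʳ-< (crossings Δ Q) (≤-trans
                                                      (≤-reflexive (sym (⟦⟧-true q-avoids)))
                                                      (∈⇒≤∑ (λ q → ⟦ ¬ Crosses Δ q ⟧) q∈Q)) ⟩
      crossings Δ Q + count (¬_ ∘ Crosses Δ) Q   ≡⟨ count-complement (Crosses Δ) Q ⟩
      length Q                                   ∎

    -- A heavy cell crossed too often is subdivided recursively; its extra weight
    -- pays for the loss φ j of the recursive step.
    density : ∀ P Q r → 1 ≤ r → Dense P Q r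
    density P Q = bounded (length Q) P Q ≤-refl
      where
      bounded : ∀ N P Q → length Q ≤ N → ∀ r → 1 ≤ r → Dense P Q r
      bounded N [] Q Q≤N r 1≤r = [] , ⊆-refl , z≤n
        , ≤-trans (≤-reflexive (trans (cong (r *_) none) (*-zeroʳ r))) z≤n
        where
        none : crossings (_∈ˡ []) Q ≡ 0
        none = trans (∑-cong Q (λ q → ⟦⟧-false λ { (_ , _ , () , _) })) (trans (∑-const Q 0) (*-zeroʳ (length Q)))
      bounded N P@(_ ∷ _) [] Q≤N r 1≤r = P , ⊆-refl
        , m≤n*m (length P) (density-constant * φ r)
            {{>-nonZero (*-mono-≤ {1} {density-constant} {1} 1≤density-constant (φ-positive r 1≤r))}}
        , ≤-reflexive (*-zeroʳ r)
      -- The cell Δ is not crossed by the sampled curve q of `Q`, so passing to the curves that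
      -- cross Δ decreases N.
      bounded (suc N) P@(_ ∷ _) Q@(_ ∷ _) Q≤N r 1≤r =
        let Δ , (q , q∈Q , q-avoids) , heavy = heavy-cell P Q r (s≤s z≤n) 1≤r
        in split Δ heavy (≤-pred (≤-trans (≤-trans (≤-reflexive (cong suc (length-select (Crosses Δ) Q)))
             (crossings<length q∈Q q-avoids)) Q≤N)) (excess-cases d (length Q) r (crossings Δ Q))
        where
        split : ∀ Δ → length P * suc (density-constant * F * excess d (length Q) r (crossings Δ Q))
                        ≤ density-constant * φ r * count Δ P →
                length (select (Crosses Δ) Q) ≤ N →
                (r * crossings Δ Q ≤ length Q) ⊎
                (∃[ j ] 1 ≤ j × r * crossings Δ Q ≤ j * length Q × excess d (length Q) r (crossings Δ Q) ≡ j ^ d) →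
                Dense P Q r
        split Δ heavy _     (inj₁ few) = dense-cell P Q r Δ few
          (≤-trans (m≤m*n (length P) (suc (density-constant * F * excess d (length Q) r (crossings Δ Q)))) heavy)
        split Δ heavy fewer (inj₂ (j , 1≤j , rκ≤jn , excess≡)) = dense-subdivision P Q r j Δ 1≤j rκ≤jn
          (≤-trans (*-monoʳ-≤ (length P) (≤-trans (≤-reflexive (cong (density-constant * F *_) (sym excess≡))) (n≤1+n _)))
            heavy)
          (bounded N (select Δ P) (select (Crosses Δ) Q) fewer j 1≤j)

  m<[1+m/n]*n : ∀ m n .{{_ : NonZero n}} → m < suc (m / n) * n
  m<[1+m/n]*n m n = begin-strict
    m                      ≡⟨ m≡m%n+[m/n]*n m n ⟩
    _                      <⟨ +-monoˡ-< (m / n * n) (m%n<n m n) ⟩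
    suc (m / n) * n        ∎
    where open ≤-Reasoning

  -- Incidences without K_{s,u}.

  module Incidence (em : ExcludedMiddle ℓ) {X Y : Set ℓ} (E : X → Y → Set ℓ) where
    open Crossing em E
    open Counting em
    open ≤-Reasoning

    degree : List X → Y → ℕ
    degree P q = count (λ p → E p q) P

    incidences : List X → List Y → ℕ
    incidences P Q = ∑ P (λ p → count (E p) Q)

    incidences-swap : ∀ P Q → incidences P Q ≡ ∑ Q (degree P)
    incidences-swap P Q = ∑-swap P Q (λ p q → ⟦ E p q ⟧)

    count≤length : ∀ (p : A → Set ℓ) xs → count p xs ≤ length xs
    count≤length p xs = ≤-trans (m≤m+n (count p xs) _) (≤-reflexive (count-complement p xs))

    -- Stated with sublists and the bound |B| ≤ u, the condition is inherited by sublists and still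
    -- has content for s = 0, where it bounds the number of curves. That is the base of the
    -- induction in `∑-stars`.
    Free : ℕ → ℕ → List X → List Y → Set ℓ
    Free s u P Q = ∀ A B → A ⊆ P → B ⊆ Q → length A ≡ s →
      (∀ {a b} → a ∈ˡ A → b ∈ˡ B → E a b) → length B ≤ u

    Free-⊆ : ∀ {s u P P′ Q Q′} → P′ ⊆ P → Q′ ⊆ Q → Free s u P Q → Free s u P′ Q′
    Free-⊆ P′⊆P Q′⊆Q free A B A⊆ B⊆ = free A B (⊆-trans A⊆ P′⊆P) (⊆-trans B⊆ Q′⊆Q)

    -- Equals the binomial coefficient of degree P q over s.
    stars : ℕ → List X → Y → ℕ
    stars zero    P       q = 1
    stars (suc s) []      q = 0
    stars (suc s) (p ∷ P) q = ⟦ E p q ⟧ * stars s P q + stars (suc s) P q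

    -- For a degree δ this is δ ≤ C(δ, s + 1) + s + 1: every neighbour beyond the first s + 1 adds
    -- at least one to the binomial coefficient.
    degree≤stars : ∀ s P q → degree P q ≤ stars (suc s) P q + suc s
    degree≤stars s [] q = z≤n
    degree≤stars s (p ∷ P) q with em {E p q}
    ... | no  _ = degree≤stars s P q
    ... | yes _ = step s
      where
      step : ∀ s → suc (degree P q) ≤ 1 * stars s P q + stars (suc s) P q + suc s
      step zero    = s≤s (degree≤stars zero P q)
      step (suc s) with stars (suc s) P q | degree≤stars s P q
      ... | zero  | deg≤ = ≤-trans (s≤s deg≤) (m≤n+m (suc (suc s)) (stars (suc (suc s)) P q))
      ... | suc c | _    = s≤s (≤-trans (degree≤stars (suc s) P q)
        (+-monoˡ-≤ (suc (suc s)) (m≤n+m (stars (suc (suc s)) P q) (c + 0))))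

    -- The double counting of Kővári, Sós and Turán: every s-set of points has at most u common
    -- neighbours. The induction splits the s-sets by whether they contain the first point p; those
    -- that do become (s-1)-sets over the neighbours of p, where K_{s-1,u} is excluded in the sense
    -- of `Free`.
    ∑-stars : ∀ s {u} P K → Free s u P K → ∑ K (stars s P) ≤ u * length P ^ s
    ∑-stars zero    {u} P K free = begin
      ∑ K (const 1)       ≡⟨ trans (∑-const K 1) (*-identityʳ _) ⟩
      length K            ≤⟨ free [] K (minimum P) ⊆-refl refl (λ ()) ⟩
      u                   ≡⟨ *-identityʳ u ⟨
      u * 1               ∎
    ∑-stars (suc s) {u} [] K free = ≤-trans (≤-reflexive (trans (∑-const K 0) (*-zeroʳ (length K)))) z≤n
    ∑-stars (suc s) {u} (p ∷ P) K free = begin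
      ∑ K (λ q → ⟦ E p q ⟧ * stars s P q + stars (suc s) P q)
        ≡⟨ ∑-+ K (λ q → ⟦ E p q ⟧ * stars s P q) (stars (suc s) P) ⟩
      ∑ K (λ q → ⟦ E p q ⟧ * stars s P q) + ∑ K (stars (suc s) P)
        ≡⟨ cong (_+ ∑ K (stars (suc s) P)) (∑-select (E p) K (stars s P)) ⟨
      ∑ (select (E p) K) (stars s P) + ∑ K (stars (suc s) P)
        ≤⟨ +-mono-≤ (∑-stars s P (select (E p) K) neighbours-free)
             (∑-stars (suc s) P K (Free-⊆ (p ∷ʳ ⊆-refl) ⊆-refl free)) ⟩
      u * l ^ s + u * (l * l ^ s)
        ≡⟨ collect u l (l ^ s) ⟩
      u * (suc l * l ^ s)
        ≤⟨ *-monoʳ-≤ u (*-monoʳ-≤ (suc l) (^-monoˡ-≤ s (n≤1+n l))) ⟩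
      u * suc l ^ suc s ∎
      where
      l = length P
      collect : ∀ u l p → u * p + u * (l * p) ≡ u * (suc l * p)
      collect = solve-∀
      neighbours-free : Free s u P (select (E p) K)
      neighbours-free A B A⊆ B⊆ |A|≡s complete = free (p ∷ A) B (refl ∷ A⊆) (⊆-trans B⊆ (select-⊆ (E p) K))
        (cong suc |A|≡s)
        λ { (here refl) b∈ → proj₂ (∈-select⁻ (E p) K (Sublist.Any-resp-⊆ B⊆ b∈))
          ; (there a∈)  b∈ → complete a∈ b∈ }

    ∑-degree : ∀ s {u} P K → Free (suc s) u P K → ∑ K (degree P) ≤ u * length P ^ suc s + length K * suc s
    ∑-degree s {u} P K free = begin
      ∑ K (degree P)                                  ≤⟨ ∑-mono K (λ {q} _ → degree≤stars s P q) ⟩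
      ∑ K (λ q → stars (suc s) P q + suc s)           ≡⟨ ∑-+ K (stars (suc s) P) (const (suc s)) ⟩
      ∑ K (stars (suc s) P) + ∑ K (const (suc s))     ≤⟨ +-mono-≤ (∑-stars (suc s) P K free) (≤-reflexive (∑-const K (suc s))) ⟩
      u * length P ^ suc s + length K * suc s         ∎

    Full : List X → Y → Set ℓ
    Full P q = ∀ {p} → p ∈ˡ P → E p q

    degree-uncrossed : ∀ P q → ¬ Crosses (_∈ˡ P) q → degree P q ≤ length P * ⟦ Full P q ⟧
    degree-uncrossed P q uncrossed with em {Full P q}
    ... | yes _     = ≤-trans (count≤length (λ p → E p q) P) (≤-reflexive (sym (*-identityʳ (length P))))
    ... | no  ¬full = ≤-trans (∑-bound P λ {p} p∈ → ≤-reflexive (⟦⟧-false λ e →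
        ¬full λ {p′} p′∈ → spread p∈ e p′∈)) ≤-refl
      where
      spread : ∀ {p p′} → p ∈ˡ P → E p q → p′ ∈ˡ P → E p′ q
      spread {p} {p′} p∈ e p′∈ with em {E p′ q}
      ... | yes e′ = e′
      ... | no ¬e′ = contradiction (p , p′ , p∈ , p′∈ , e , ¬e′) uncrossed

    -- An average over `P`. An uncrossed curve through one of the points contains them all, and
    -- since |P| ≥ s + 1 there are at most u of these. For the crossing curves, their number bound
    -- makes both terms of `∑-degree` of order |P|^(s+1).
    low-degree : ∀ s {u} P Q → Free (suc s) u P Q → suc s ≤ length P →
      crossings (_∈ˡ P) Q ≤ length P ^ suc s →
      ∃[ p ] p ∈ˡ P × count (E p) Q ≤ (2 * u + suc s) * length P ^ s
    low-degree s {u} P Q free s<M few = ∑-average P (≤-trans (s≤s z≤n) s<M) (begin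
      incidences P Q
        ≡⟨ incidences-swap P Q ⟩
      ∑ Q (degree P)
        ≤⟨ ∑-mono Q (λ {q} _ → split q) ⟩
      ∑ Q (λ q → ⟦ C q ⟧ * degree P q + ⟦ Full P q ⟧ * M)
        ≡⟨ ∑-+ Q (λ q → ⟦ C q ⟧ * degree P q) (λ q → ⟦ Full P q ⟧ * M) ⟩
      ∑ Q (λ q → ⟦ C q ⟧ * degree P q) + ∑ Q (λ q → ⟦ Full P q ⟧ * M)
        ≡⟨ cong₂ _+_ (sym (∑-select C Q (degree P))) (∑-*ʳ Q M (λ q → ⟦ Full P q ⟧)) ⟩
      ∑ (select C Q) (degree P) + count (Full P) Q * M
        ≤⟨ +-mono-≤ (∑-degree s P (select C Q) (Free-⊆ ⊆-refl (select-⊆ C Q) free)) (*-monoˡ-≤ M full≤u) ⟩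
      u * (M * M ^ s) + length (select C Q) * suc s + u * M
        ≤⟨ +-mono-≤ (+-monoʳ-≤ (u * (M * M ^ s)) (*-monoˡ-≤ (suc s)
             (≤-trans (≤-reflexive (length-select C Q)) few)))
             (*-monoʳ-≤ u (≤-trans (≤-reflexive (sym (*-identityʳ M))) (*-monoʳ-≤ M (1≤m^n s 1≤M)))) ⟩
      u * (M * M ^ s) + (M * M ^ s) * suc s + u * (M * M ^ s)
        ≡⟨ collect u M (M ^ s) (suc s) ⟩
      M * ((2 * u + suc s) * M ^ s) ∎)
      where
      M = length P
      C = Crosses (_∈ˡ P)
      1≤M : 1 ≤ M
      1≤M = ≤-trans (s≤s z≤n) s<M
      collect : ∀ u m p s → u * (m * p) + (m * p) * s + u * (m * p) ≡ m * ((2 * u + s) * p)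
      collect = solve-∀
      split : ∀ q → degree P q ≤ ⟦ C q ⟧ * degree P q + ⟦ Full P q ⟧ * M
      split q with em {C q}
      ... | yes _ = ≤-trans (≤-reflexive (sym (+-identityʳ _))) (m≤m+n _ _)
      ... | no ¬c = ≤-trans (degree-uncrossed P q ¬c) (≤-reflexive (*-comm M _))
      full≤u : count (Full P) Q ≤ u
      full≤u = ≤-trans (≤-reflexive (sym (length-select (Full P) Q)))
        (free (take (suc s) P) (select (Full P) Q) (Sublist.take-⊆ (suc s) P) (select-⊆ (Full P) Q)
          (trans (List.length-take (suc s) P) (m≤n⇒m⊓n≡m s<M))
          λ a∈ b∈ → proj₂ (∈-select⁻ (Full P) Q b∈) (Sublist.Any-resp-⊆ (Sublist.take-⊆ (suc s) P) a∈))

  -- Finding a point of low degree.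

  module IncidenceConstants (growth : Growth) (s u : ℕ) where
    open Growth growth using (φ; φ-positive)
    open Constants growth using (density-constant; 1≤density-constant)

    S C₁ D g : ℕ
    S = suc s
    C₁ = density-constant
    D = 2 * u + S
    g = C₁ * φ 1

    1≤g : 1 ≤ g
    1≤g = *-mono-≤ {1} {C₁} {1} 1≤density-constant (φ-positive 1 ≤-refl)

    -- `sparse-constant` adds up the constants of the two cases in which the incidences are O(n)
    -- outright. `low-constant` is the degree bound D M^s at the smallest value M = S. The 2^s in
    -- `degree-constant` pays for replacing M by M - 1.
    sparse-constant low-constant degree-constant : ℕ
    sparse-constant = g * S + (u * (2 * g) ^ S + S)
    low-constant    = D * S ^ s
    degree-constant = D * 2 ^ s

  module Zarankiewicz (em : ExcludedMiddle ℓ) {X Y : Set ℓ} {E : X → Y → Set ℓ}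
    {growth : Growth} (𝒞 : CellSystem em E growth) (s u : ℕ) where
    open Growth growth using (φ; φ-positive)
    open Constants growth using (1≤density-constant)
    open IncidenceConstants growth s u
    open CellSystem 𝒞 using (crossings; Crosses; Crosses-mono)
    open Counting em
    open Density em 𝒞 using (density)
    open Incidence em E
    open ≤-Reasoning

    low-degree-point : ∀ P Q → Free S u P Q → ∀ M r → S ≤ M → 1 ≤ r → length Q ≤ r * M ^ S →
      C₁ * φ r * M ≤ length P → ∃[ p ] p ∈ˡ P × count (E p) Q ≤ D * M ^ s
    low-degree-point P Q free M r S≤M 1≤r n≤rM^S C₁φM≤m =
      let P′ , P′⊆P , dense , sparse = density P Q r 1≤r
          M≤|P′| = *-cancelˡ (C₁ * φ r) (*-mono-≤ {1} {C₁} {1} 1≤density-constant (φ-positive r 1≤r))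
                     (≤-trans C₁φM≤m dense)
          -- The degree bound grows with the number of points, so exactly M of them are kept; fewer
          -- points are crossed by no more curves.
          P″   = take M P′
          P″⊆P′ = Sublist.take-⊆ M P′
          |P″|≡M = trans (List.length-take M P′) (m≤n⇒m⊓n≡m M≤|P′|)
          few = *-cancelˡ r 1≤r (begin
            r * crossings (_∈ˡ P″) Q   ≤⟨ *-monoʳ-≤ r (count-mono Q (Crosses-mono (Sublist.Any-resp-⊆ P″⊆P′))) ⟩
            r * crossings (_∈ˡ P′) Q   ≤⟨ sparse ⟩
            length Q                   ≤⟨ n≤rM^S ⟩
            r * M ^ S                  ≡⟨ cong (λ l → r * l ^ S) |P″|≡M ⟨
            r * length P″ ^ S          ∎)
          p , p∈ , low = low-degree s P″ Q (Free-⊆ (⊆-trans P″⊆P′ P′⊆P) ⊆-refl free)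
                           (≤-trans S≤M (≤-reflexive (sym |P″|≡M))) few
      in p , Sublist.Any-resp-⊆ (⊆-trans P″⊆P′ P′⊆P) p∈ , subst (λ l → count (E p) Q ≤ D * l ^ s) |P″|≡M low

    module _ (m n : ℕ) where
      instance
        power-nonZero : ∀ {w} → NonZero (suc w ^ S)
        power-nonZero {w} = m^n≢0 (suc w) S

      -- Here w stands for M - 1, so that the divisor Mˢ is positive.
      rate : ℕ → ℕ
      rate w = suc (n / suc w ^ S)

      Available : ℕ → Set
      Available w = C₁ * φ (rate w) * suc w ≤ m

      -- Availability is not monotone, since very large w fail as well. The search therefore
      -- descends from an available value; all that matters later is a pair of neighbours of which
      -- the larger is available and the smaller is not.
      first-available : ∀ j → Available (s + j) → Available s ⊎
        (∃[ w ] s ≤ w × suc w ≤ s + j × Available (suc w) × ¬ Available w)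
      first-available zero    available = inj₁ (subst Available (+-identityʳ s) available)
      first-available (suc j) available with C₁ * φ (rate (s + j)) * suc (s + j) ≤? m
      ... | no  ¬available = inj₂ (s + j , m≤m+n s j , ≤-reflexive (sym (+-suc s j))
                                 , subst Available (+-suc s j) available , ¬available)
      ... | yes available′ with first-available j available′
      ...   | inj₁ available-s = inj₁ available-s
      ...   | inj₂ (w , s≤w , w<s+j , rest) = inj₂ (w , s≤w , ≤-trans w<s+j (+-monoʳ-≤ s (n≤1+n j)) , rest)

      n≤rate : ∀ w → n ≤ rate w * suc w ^ S
      n≤rate w = <⇒≤ (m<[1+m/n]*n n (suc w ^ S))

      rate-one : ∀ {w} → n < suc w ^ S → rate w ≡ 1
      rate-one n< = cong suc (m<n⇒m/n≡0 n<)

    -- Either the incidences are few or some point is cheap to delete. In the last case w is M - 1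
    -- for the critical M, and r is the rate belonging to M - 1: the failure of M - 1 to be
    -- available bounds |P| from above, hence w from below in terms of r.
    Alternatives : List X → List Y → Set ℓ
    Alternatives P Q =
        incidences P Q ≤ sparse-constant * length Q
      ⊎ (∃[ p ] p ∈ˡ P × count (E p) Q ≤ low-constant)
      ⊎ (∃[ p ] p ∈ˡ P × ∃[ w ] ∃[ r ] 1 ≤ w × 1 ≤ r × count (E p) Q ≤ degree-constant * w ^ s
          × r * w ^ S ≤ 2 * length Q × length P ≤ C₁ * φ r * w)

    alternatives : ∀ P Q → Free S u P Q → Alternatives P Q
    alternatives P Q free = by-size (m / g) refl
      where
      m n : ℕ
      m = length P
      n = length Q
      instance
        g-nonZero : NonZero g
        g-nonZero = >-nonZero 1≤g

      by-minimal : ∀ w₀ → g * suc w₀ ≤ m → Available m n s ⊎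
        (∃[ w ] s ≤ w × suc w ≤ w₀ × Available m n (suc w) × ¬ Available m n w) → Alternatives P Q
      by-minimal _ _ (inj₁ available) = inj₂ (inj₁
        (low-degree-point P Q free S (rate m n s) ≤-refl (s≤s z≤n) (n≤rate m n s) available))
      by-minimal w₀ gw₀≤m (inj₂ (w , s≤w , w<w₀ , available , ¬available)) =
        let p , p∈ , low = low-degree-point P Q free (suc (suc w)) (rate m n (suc w)) (s≤s (≤-trans s≤w (n≤1+n w)))
                             (s≤s z≤n) (n≤rate m n (suc w)) available
        in inj₂ (inj₂ (p , p∈ , suc w , rate m n w , s≤s z≤n , s≤s z≤n , (begin
          count (E p) Q                    ≤⟨ low ⟩
          D * suc (suc w) ^ s              ≤⟨ *-monoʳ-≤ D (^-monoˡ-≤ s (+-mono-≤ {1} {suc w} (s≤s z≤n) (≤-reflexive (sym (+-identityʳ (suc w)))))) ⟩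
          D * (2 * suc w) ^ s              ≡⟨ cong (D *_) (^-distribʳ-* 2 (suc w) s) ⟩
          D * (2 ^ s * suc w ^ s)          ≡⟨ *-assoc D (2 ^ s) (suc w ^ s) ⟨
          degree-constant * suc w ^ s      ∎)
        , (begin
          rate m n w * suc w ^ S                     ≡⟨⟩
          suc w ^ S + n / suc w ^ S * suc w ^ S      ≤⟨ +-mono-≤ w^S≤n (m/n*n≤m n (suc w ^ S)) ⟩
          n + n                                      ≡⟨ cong (n +_) (+-identityʳ n) ⟨
          2 * n                                      ∎)
        , <⇒≤ (≰⇒> ¬available)))
        where
        instance
          _ : NonZero (suc w ^ S)
          _ = m^n≢0 (suc w) S
        w^S≤n : suc w ^ S ≤ n
        -- If (M - 1)^S exceeded n, the rate of M - 1 would be 1, and M - 1 would be available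
        -- because g (M - 1) ≤ m.
        w^S≤n = ≮⇒≥ λ n<w^S → ¬available (begin
          C₁ * φ (rate m n w) * suc w   ≡⟨ cong (λ r → C₁ * φ r * suc w) (rate-one m n n<w^S) ⟩
          g * suc w                     ≤⟨ *-monoʳ-≤ g (s≤s (≤-trans (n≤1+n w) w<w₀)) ⟩
          g * suc w₀                    ≤⟨ gw₀≤m ⟩
          m                             ∎)

      -- M₀ is the largest M that m points can afford at rate 1. If M₀ < S, there are boundedly many
      -- points; if M₀^S ≤ n, then m^S = O(n) and `∑-degree` suffices. Otherwise the rate at M₀ is
      -- 1, so M₀ is available and the search starts there.
      by-size : ∀ M₀ → m / g ≡ M₀ → Alternatives P Q
      by-size M₀ m/g≡M₀ with S ≤? M₀
      ... | no S≰M₀ = inj₁ (begin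
        incidences P Q       ≤⟨ ∑-bound P (λ {p} _ → count≤length (E p) Q) ⟩
        m * n                ≤⟨ *-monoˡ-≤ n (begin
          m                    ≤⟨ <⇒≤ (m<[1+m/n]*n m g) ⟩
          suc (m / g) * g      ≤⟨ *-monoˡ-≤ g (≤-trans (≤-reflexive (cong suc m/g≡M₀)) (≰⇒> S≰M₀)) ⟩
          S * g                ≡⟨ *-comm S g ⟩
          g * S                ≤⟨ m≤m+n (g * S) _ ⟩
          sparse-constant      ∎) ⟩
        sparse-constant * n  ∎)
      ... | yes S≤M₀ with n <? M₀ ^ S
      ...   | no n≮M₀^S = inj₁ (begin
        incidences P Q                 ≡⟨ incidences-swap P Q ⟩
        ∑ Q (degree P)                 ≤⟨ ∑-degree s P Q free ⟩
        u * m ^ S + n * S              ≤⟨ +-monoˡ-≤ (n * S) (*-monoʳ-≤ u (begin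
          m ^ S                          ≤⟨ ^-monoˡ-≤ S m≤2gM₀ ⟩
          (2 * g * M₀) ^ S               ≡⟨ ^-distribʳ-* (2 * g) M₀ S ⟩
          (2 * g) ^ S * M₀ ^ S           ≤⟨ *-monoʳ-≤ ((2 * g) ^ S) (≮⇒≥ n≮M₀^S) ⟩
          (2 * g) ^ S * n                ∎)) ⟩
        u * ((2 * g) ^ S * n) + n * S  ≡⟨ collect u ((2 * g) ^ S) n S ⟩
        (u * (2 * g) ^ S + S) * n      ≤⟨ *-monoˡ-≤ n (m≤n+m (u * (2 * g) ^ S + S) (g * S)) ⟩
        sparse-constant * n            ∎)
        where
        collect : ∀ u p n s → u * (p * n) + n * s ≡ (u * p + s) * n
        collect = solve-∀
        double : ∀ g M → (M + M) * g ≡ 2 * g * M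
        double = solve-∀
        m≤2gM₀ : m ≤ 2 * g * M₀
        m≤2gM₀ = begin
          m                  ≤⟨ <⇒≤ (m<[1+m/n]*n m g) ⟩
          suc (m / g) * g    ≡⟨ cong (λ l → suc l * g) m/g≡M₀ ⟩
          suc M₀ * g         ≤⟨ *-monoˡ-≤ g (+-monoˡ-≤ M₀ (≤-trans (s≤s z≤n) S≤M₀)) ⟩
          (M₀ + M₀) * g      ≡⟨ double g M₀ ⟩
          2 * g * M₀         ∎
      by-size zero      m/g≡M₀ | yes () | yes n<M₀^S
      by-size (suc w₀)  m/g≡M₀ | yes (s≤s s≤w₀) | yes n<M₀^S =
        by-minimal w₀ gM₀≤m (subst (λ w → Available m n s ⊎ (∃[ v ] s ≤ v × suc v ≤ w × Available m n (suc v) × ¬ Available m n v))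
          s+j≡w₀ (first-available m n (w₀ ∸ s) (subst (Available m n) (sym s+j≡w₀) (begin
            C₁ * φ (rate m n w₀) * suc w₀   ≡⟨ cong (λ r → C₁ * φ r * suc w₀) (rate-one m n n<M₀^S) ⟩
            g * suc w₀                      ≤⟨ gM₀≤m ⟩
            m                               ∎))))
        where
        s+j≡w₀ : s + (w₀ ∸ s) ≡ w₀
        s+j≡w₀ = m+[n∸m]≡n s≤w₀
        gM₀≤m : g * suc w₀ ≤ m
        gM₀≤m = begin
          g * suc w₀     ≡⟨ cong (g *_) m/g≡M₀ ⟨
          g * (m / g)    ≡⟨ *-comm g (m / g) ⟩
          m / g * g      ≤⟨ m/n*n≤m m g ⟩
          m              ∎

open Combinatorics

-- Real powers

module OrderedField (em : ExcludedMiddle 0ℓ) (ℝ : CompleteOrderedField) where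
  open CompleteOrderedField ℝ
  open IsTotalOrder isTotalOrder public
    using (total)
    renaming (reflexive to ≤-reflexive; trans to ≤-trans; antisym to ≤-antisym)
  open Mult semiring using (×-homo-+; ×1-homo-*)
  open Exp semiring using (^-congˡ; ^-homo-*; ^-assocʳ)
  open CommutativeExp commutativeSemiring using (^-distrib-*)
  module S = SemiringSolver commutativeSemiring
  open S using (con; _:+_; _:*_; _:=_)

  ≤-poset : Poset 0ℓ 0ℓ 0ℓ
  ≤-poset = record { isPartialOrder = IsTotalOrder.isPartialOrder isTotalOrder }

  open PosetReasoning ≤-poset

  ≤-refl : ∀ {x} → x ≤ x
  ≤-refl = ≤-reflexive refl

  ≰⇒≥ : ∀ {x y} → ¬ (x ≤ y) → y ≤ x
  ≰⇒≥ {x} {y} x≰y with total x y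
  ... | inj₁ x≤y = contradiction x≤y x≰y
  ... | inj₂ y≤x = y≤x

  +-mono-≤ : ∀ {x y u v} → x ≤ y → u ≤ v → x + u ≤ y + v
  +-mono-≤ {x} {y} {u} {v} x≤y u≤v = begin
    x + u  ≤⟨ +-monoˡ-≤ u x≤y ⟩
    y + u  ≈⟨ +-comm y u ⟩
    u + y  ≤⟨ +-monoˡ-≤ y u≤v ⟩
    v + y  ≈⟨ +-comm v y ⟩
    y + v  ∎

  x-y+y≈x : ∀ x y → (x - y) + y ≈ x
  x-y+y≈x x y = trans (+-assoc x (- y) y) (trans (+-congˡ (-‿inverseˡ y)) (+-identityʳ x))

  x+y-y≈x : ∀ x y → (x + y) - y ≈ x
  x+y-y≈x x y = trans (+-assoc x y (- y)) (trans (+-congˡ (-‿inverseʳ y)) (+-identityʳ x))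

  +-cancelʳ-≤ : ∀ z {x y} → x + z ≤ y + z → x ≤ y
  +-cancelʳ-≤ z {x} {y} h = begin
    x            ≈⟨ x+y-y≈x x z ⟨
    (x + z) - z  ≤⟨ +-monoˡ-≤ (- z) h ⟩
    (y + z) - z  ≈⟨ x+y-y≈x y z ⟩
    y            ∎

  x≤y⇒0≤y-x : ∀ {x y} → x ≤ y → 0# ≤ y - x
  x≤y⇒0≤y-x {x} {y} x≤y = begin
    0#     ≈⟨ -‿inverseʳ x ⟨
    x - x  ≤⟨ +-monoˡ-≤ (- x) x≤y ⟩
    y - x  ∎

  x≤x+y : ∀ x {y} → 0# ≤ y → x ≤ x + y
  x≤x+y x {y} 0≤y = begin
    x       ≈⟨ +-identityʳ x ⟨
    x + 0#  ≤⟨ +-mono-≤ ≤-refl 0≤y ⟩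
    x + y   ∎

  x≤y+x : ∀ x {y} → 0# ≤ y → x ≤ y + x
  x≤y+x x {y} 0≤y = ≤-trans (x≤x+y x 0≤y) (≤-reflexive (+-comm x y))

  *-monoˡ-≤ : ∀ {z} → 0# ≤ z → ∀ {x y} → x ≤ y → x * z ≤ y * z
  *-monoˡ-≤ {z} 0≤z {x} {y} x≤y = begin
    x * z                ≤⟨ x≤y+x (x * z) (*-nonNegative (x≤y⇒0≤y-x x≤y) 0≤z) ⟩
    (y - x) * z + x * z  ≈⟨ distribʳ z (y - x) x ⟨
    ((y - x) + x) * z    ≈⟨ *-congʳ (x-y+y≈x y x) ⟩
    y * z                ∎

  *-monoʳ-≤ : ∀ {z} → 0# ≤ z → ∀ {x y} → x ≤ y → z * x ≤ z * y
  *-monoʳ-≤ {z} 0≤z {x} {y} x≤y = begin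
    z * x  ≈⟨ *-comm z x ⟩
    x * z  ≤⟨ *-monoˡ-≤ 0≤z x≤y ⟩
    y * z  ≈⟨ *-comm y z ⟩
    z * y  ∎

  *-mono-≤ : ∀ {x y u v} → 0# ≤ x → 0# ≤ v → x ≤ y → u ≤ v → x * u ≤ y * v
  *-mono-≤ 0≤x 0≤v x≤y u≤v = ≤-trans (*-monoʳ-≤ 0≤x u≤v) (*-monoˡ-≤ 0≤v x≤y)

  0≤1 : 0# ≤ 1#
  0≤1 with total 0# 1#
  ... | inj₁ 0≤1 = 0≤1
  ... | inj₂ 1≤0 = begin
    0#             ≤⟨ *-nonNegative 0≤-1 0≤-1 ⟩
    - 1# * - 1#    ≈⟨ -1*x≈-x (- 1#) ⟩
    - (- 1#)       ≈⟨ -‿involutive 1# ⟩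
    1#             ∎
    where
    open RingProperties ring
    0≤-1 : 0# ≤ - 1#
    0≤-1 = ≤-trans (x≤y⇒0≤y-x 1≤0) (≤-reflexive (+-identityˡ (- 1#)))

  0≤x+y : ∀ {x y} → 0# ≤ x → 0# ≤ y → 0# ≤ x + y
  0≤x+y {x} 0≤x 0≤y = ≤-trans 0≤x (x≤x+y x 0≤y)

  1≰0 : ¬ (1# ≤ 0#)
  1≰0 1≤0 = 0≉1 (≤-antisym 0≤1 1≤0)

  x+1≰x : ∀ x → ¬ (x + 1# ≤ x)
  x+1≰x x h = 1≰0 (+-cancelʳ-≤ x (begin
    1# + x  ≈⟨ +-comm 1# x ⟩
    x + 1#  ≤⟨ h ⟩
    x       ≈⟨ +-identityˡ x ⟨
    0# + x  ∎))

  1≤⇒0≤ : ∀ {x} → 1# ≤ x → 0# ≤ x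
  1≤⇒0≤ = ≤-trans 0≤1

  1≤⇒≰0 : ∀ {x} → 1# ≤ x → ¬ (x ≤ 0#)
  1≤⇒≰0 1≤x x≤0 = 1≰0 (≤-trans 1≤x x≤0)

  1≤x*y : ∀ {x y} → 1# ≤ x → 1# ≤ y → 1# ≤ x * y
  1≤x*y 1≤x 1≤y = ≤-trans (≤-reflexive (sym (*-identityˡ 1#)))
    (*-mono-≤ 0≤1 (1≤⇒0≤ 1≤y) 1≤x 1≤y)

  *-cancelʳ-≤ : ∀ {z} → ¬ (z ≤ 0#) → ∀ {x y} → x * z ≤ y * z → x ≤ y
  *-cancelʳ-≤ {z} z≰0 {x} {y} xz≤yz with total x y
  ... | inj₁ x≤y = x≤y
  ... | inj₂ y≤x = ≤-reflexive (begin-equality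
    x               ≈⟨ undo x ⟨
    (x * z) * z ⁻¹  ≈⟨ *-congʳ (≤-antisym xz≤yz (*-monoˡ-≤ (≰⇒≥ z≰0) y≤x)) ⟩
    (y * z) * z ⁻¹  ≈⟨ undo y ⟩
    y               ∎)
    where
    undo : ∀ w → (w * z) * z ⁻¹ ≈ w
    undo w = trans (*-assoc w z (z ⁻¹))
      (trans (*-congˡ (⁻¹-inverseʳ λ z≈0 → z≰0 (≤-reflexive z≈0))) (*-identityʳ w))

  *-cancelˡ-≤ : ∀ {z} → ¬ (z ≤ 0#) → ∀ {x y} → z * x ≤ z * y → x ≤ y
  *-cancelˡ-≤ {z} z≰0 {x} {y} h =
    *-cancelʳ-≤ z≰0 (≤-trans (≤-reflexive (*-comm x z)) (≤-trans h (≤-reflexive (*-comm z y))))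

  ⁻¹-nonNegative : ∀ {x} → ¬ (x ≤ 0#) → 0# ≤ x ⁻¹
  ⁻¹-nonNegative {x} x≰0 = *-cancelˡ-≤ x≰0 (begin
    x * 0#      ≈⟨ zeroʳ x ⟩
    0#          ≤⟨ 0≤1 ⟩
    1#          ≈⟨ ⁻¹-inverseʳ (λ x≈0 → x≰0 (≤-reflexive x≈0)) ⟨
    x * x ⁻¹    ∎)

  fromℕ-+ : ∀ m n → fromℕ (m ℕ.+ n) ≈ fromℕ m + fromℕ n
  fromℕ-+ = ×-homo-+ 1#

  fromℕ-* : ∀ m n → fromℕ (m ℕ.* n) ≈ fromℕ m * fromℕ n
  fromℕ-* = ×1-homo-*

  fromℕ-1 : fromℕ 1 ≈ 1#
  fromℕ-1 = +-identityʳ 1#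

  fromℕ-^ : ∀ m n → fromℕ (m ℕ.^ n) ≈ fromℕ m ^ n
  fromℕ-^ m zero    = fromℕ-1
  fromℕ-^ m (suc n) = trans (fromℕ-* m (m ℕ.^ n)) (*-congˡ (fromℕ-^ m n))

  0≤fromℕ : ∀ n → 0# ≤ fromℕ n
  0≤fromℕ zero    = ≤-refl
  0≤fromℕ (suc n) = 0≤x+y 0≤1 (0≤fromℕ n)

  fromℕ-mono : ∀ {m n} → m ℕ.≤ n → fromℕ m ≤ fromℕ n
  fromℕ-mono {n = n} z≤n = 0≤fromℕ n
  fromℕ-mono (s≤s m≤n)   = +-mono-≤ ≤-refl (fromℕ-mono m≤n)

  1≤fromℕ : ∀ {n} → 1 ℕ.≤ n → 1# ≤ fromℕ n
  1≤fromℕ 1≤n = ≤-trans (≤-reflexive (sym fromℕ-1)) (fromℕ-mono 1≤n)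

  fromℕ-cancel : ∀ {m n} → fromℕ m ≤ fromℕ n → m ℕ.≤ n
  fromℕ-cancel {m} {n} h with m ℕ.≤? n
  ... | yes m≤n = m≤n
  ... | no  m≰n = contradiction (begin
    fromℕ n + 1#   ≈⟨ +-comm (fromℕ n) 1# ⟩
    fromℕ (suc n)  ≤⟨ fromℕ-mono (ℕ.≰⇒> m≰n) ⟩
    fromℕ m        ≤⟨ h ⟩
    fromℕ n        ∎) (x+1≰x (fromℕ n))

  archimedean : ∀ x → ∃[ n ] x ≤ fromℕ n
  archimedean x with em {∃[ n ] x ≤ fromℕ n}
  ... | yes found = found
  ... | no  none  = contradiction
    (sup-least nonempty bounded λ { (n , ≡.refl) → +-cancelʳ-≤ 1# (begin
      fromℕ n + 1#            ≈⟨ +-comm (fromℕ n) 1# ⟩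
      fromℕ (suc n)           ≤⟨ sup-upper nonempty bounded (suc n , ≡.refl) ⟩
      sup Naturals            ≈⟨ x-y+y≈x (sup Naturals) 1# ⟨
      (sup Naturals - 1#) + 1#  ∎) })
    λ h → x+1≰x (sup Naturals) (begin
      sup Naturals + 1#         ≤⟨ +-monoˡ-≤ 1# h ⟩
      (sup Naturals - 1#) + 1#  ≈⟨ x-y+y≈x (sup Naturals) 1# ⟩
      sup Naturals              ∎)
    where
    Naturals : Carrier → Set
    Naturals y = ∃[ n ] y ≡ fromℕ n
    nonempty : ∃[ y ] Naturals y
    nonempty = fromℕ 0 , 0 , ≡.refl
    bounded : ∃[ b ] IsUpperBound Naturals b
    bounded = x , λ { (n , ≡.refl) → ≰⇒≥ λ x≤n → none (n , x≤n) }

  floor : ∀ {x} → 0# ≤ x → ∃[ a ] fromℕ a ≤ x × x ≤ fromℕ (suc a)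
  floor {x} 0≤x = search (proj₁ (archimedean x)) (proj₂ (archimedean x))
    where
    search : ∀ n → x ≤ fromℕ n → ∃[ a ] fromℕ a ≤ x × x ≤ fromℕ (suc a)
    search zero    x≤0 = 0 , 0≤x , ≤-trans x≤0 (0≤fromℕ 1)
    search (suc n) x≤  with total x (fromℕ n)
    ... | inj₁ x≤n = search n x≤n
    ... | inj₂ n≤x = n , n≤x , x≤

  ^-nonNegative : ∀ {x} n → 0# ≤ x → 0# ≤ x ^ n
  ^-nonNegative zero    0≤x = 0≤1
  ^-nonNegative (suc n) 0≤x = *-nonNegative 0≤x (^-nonNegative n 0≤x)

  ^-mono : ∀ n {x y} → 0# ≤ x → x ≤ y → x ^ n ≤ y ^ n
  ^-mono zero    0≤x x≤y = ≤-refl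
  ^-mono (suc n) 0≤x x≤y =
    *-mono-≤ 0≤x (^-nonNegative n (≤-trans 0≤x x≤y)) x≤y (^-mono n 0≤x x≤y)

  1≤x^n : ∀ {x} n → 1# ≤ x → 1# ≤ x ^ n
  1≤x^n zero    1≤x = ≤-refl
  1≤x^n (suc n) 1≤x = 1≤x*y 1≤x (1≤x^n n 1≤x)

  ^-monoʳ : ∀ {x m n} → 1# ≤ x → m ℕ.≤ n → x ^ m ≤ x ^ n
  ^-monoʳ {n = n} 1≤x z≤n  = 1≤x^n n 1≤x
  ^-monoʳ 1≤x (s≤s m≤n) = *-monoʳ-≤ (1≤⇒0≤ 1≤x) (^-monoʳ 1≤x m≤n)

  1^n≈1 : ∀ n → 1# ^ n ≈ 1#
  1^n≈1 zero    = refl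
  1^n≈1 (suc n) = trans (*-identityˡ (1# ^ n)) (1^n≈1 n)

  *-positive : ∀ {x y} → ¬ (x ≤ 0#) → ¬ (y ≤ 0#) → ¬ (x * y ≤ 0#)
  *-positive {x} {y} x≰0 y≰0 xy≤0 =
    x≰0 (*-cancelʳ-≤ y≰0 (≤-trans xy≤0 (≤-reflexive (sym (zeroˡ y)))))

  ^-positive : ∀ {x} n → ¬ (x ≤ 0#) → ¬ (x ^ n ≤ 0#)
  ^-positive zero    x≰0 = 1≰0
  ^-positive (suc n) x≰0 = *-positive x≰0 (^-positive n x≰0)

  ^-cancel : ∀ n {x y} → 0# ≤ y → x ^ suc n ≤ y ^ suc n → x ≤ y
  ^-cancel n {x} {y} 0≤y h with total x y
  ... | inj₁ x≤y = x≤y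
  ... | inj₂ y≤x with em {x ≤ 0#}
  ...   | yes x≤0 = ≤-trans x≤0 0≤y
  ...   | no  x≰0 = *-cancelʳ-≤ (^-positive n x≰0)
          (≤-trans h (*-monoʳ-≤ 0≤y (^-mono n 0≤y y≤x)))

  private
    scaleStep : ∀ {K δ} → 0# ≤ K → ¬ (δ ≤ 0#) →
                ∃[ ε ] 0# ≤ ε × ε ≤ 1# × ¬ (ε ≤ 0#) × ε * K ≤ δ
    scaleStep {K} {δ} 0≤K δ≰0 with em {K ≤ δ}
    ... | yes K≤δ = 1# , 0≤1 , ≤-refl , 1≰0 , ≤-trans (≤-reflexive (*-identityˡ K)) K≤δ
    ... | no  K≰δ = δ * K ⁻¹ , *-nonNegative (≰⇒≥ δ≰0) (⁻¹-nonNegative K≰0)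
                  , *-cancelʳ-≤ K≰0 (begin
                      δ * K ⁻¹ * K  ≈⟨ undo ⟩
                      δ             ≤⟨ ≰⇒≥ K≰δ ⟩
                      K             ≈⟨ *-identityˡ K ⟨
                      1# * K        ∎)
                  , (λ ε≤0 → δ≰0 (begin
                      δ             ≈⟨ undo ⟨
                      δ * K ⁻¹ * K  ≤⟨ *-monoˡ-≤ 0≤K ε≤0 ⟩
                      0# * K        ≈⟨ zeroˡ K ⟩
                      0#            ∎))
                  , ≤-reflexive undo
      where
      K≰0 : ¬ (K ≤ 0#)
      K≰0 K≤0 = K≰δ (≤-trans K≤0 (≰⇒≥ δ≰0))
      undo : δ * K ⁻¹ * K ≈ δ
      undo = trans (*-assoc δ (K ⁻¹) K) (trans (*-congˡ (trans (*-comm (K ⁻¹) K)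
        (⁻¹-inverseʳ λ K≈0 → K≰0 (≤-reflexive K≈0)))) (*-identityʳ δ))

    -- A Lipschitz bound takes the place of continuity in the construction of roots; `scaleStep`
    -- then supplies a step min(1, δ/K) that changes the power by at most δ.
    ^-lipschitz : ∀ n {Z} → 0# ≤ Z → ∃[ K ] 0# ≤ K × (∀ {z ε} →
      0# ≤ z → z ≤ Z → 0# ≤ ε → ε ≤ 1# → (z + ε) ^ n ≤ z ^ n + ε * K)
    ^-lipschitz zero    {Z} 0≤Z = 0# , ≤-refl , λ {z} {ε} _ _ _ _ →
      x≤x+y 1# (≤-reflexive (sym (zeroʳ ε)))
    ^-lipschitz (suc n) {Z} 0≤Z with ^-lipschitz n 0≤Z
    ... | K , 0≤K , bound =
      Z ^ n + Z * K + K
      , 0≤x+y (0≤x+y (^-nonNegative n 0≤Z) (*-nonNegative 0≤Z 0≤K)) 0≤K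
      , λ {z} {ε} 0≤z z≤Z 0≤ε ε≤1 → begin
          (z + ε) * (z + ε) ^ n
            ≤⟨ *-monoʳ-≤ (0≤x+y 0≤z 0≤ε) (bound 0≤z z≤Z 0≤ε ε≤1) ⟩
          (z + ε) * (z ^ n + ε * K)
            ≈⟨ S.solve 4 (λ z ε p k → (z :+ ε) :* (p :+ ε :* k)
                 := z :* p :+ ε :* (p :+ z :* k :+ ε :* k)) refl z ε (z ^ n) K ⟩
          z * z ^ n + ε * (z ^ n + z * K + ε * K)
            ≤⟨ +-mono-≤ ≤-refl (*-monoʳ-≤ 0≤ε (+-mono-≤
                 (+-mono-≤ (^-mono n 0≤z z≤Z) (*-monoˡ-≤ 0≤K z≤Z))
                 (≤-trans (*-monoˡ-≤ 0≤K ε≤1) (≤-reflexive (*-identityˡ K))))) ⟩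
          z * z ^ n + ε * (Z ^ n + Z * K + K) ∎

  -- The root is the supremum of the y ≥ 0 with y^b ≤ c. If its power fell short of c, a small step
  -- up would stay in the set; if it exceeded c, a small step down would still be an upper bound.
  root : ∀ n {c} → 1# ≤ c → ∃[ ρ ] 1# ≤ ρ × ρ ^ suc n ≈ c
  root n {c} 1≤c = ρ , 1≤ρ , ≤-antisym ρ^b≤c c≤ρ^b
    where
    b = suc n
    Below : Carrier → Set
    Below y = 0# ≤ y × y ^ b ≤ c
    1∈Below : Below 1#
    1∈Below = 0≤1 , ≤-trans (≤-reflexive (1^n≈1 b)) 1≤c
    bounded : ∃[ z ] IsUpperBound Below z
    bounded = c , λ (_ , y^b≤c) → ^-cancel n (1≤⇒0≤ 1≤c) (≤-trans y^b≤c (begin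
      c         ≈⟨ *-identityʳ c ⟨
      c * 1#    ≤⟨ *-monoʳ-≤ (1≤⇒0≤ 1≤c) (1≤x^n n 1≤c) ⟩
      c ^ b     ∎))
    ρ = sup Below
    1≤ρ : 1# ≤ ρ
    1≤ρ = sup-upper (1# , 1∈Below) bounded 1∈Below
    lipschitz = ^-lipschitz b (1≤⇒0≤ 1≤ρ)
    K = proj₁ lipschitz
    ρ+ε≰ρ : ∀ {ε} → ¬ (ε ≤ 0#) → ¬ (ρ + ε ≤ ρ)
    ρ+ε≰ρ {ε} ε≰0 h = ε≰0 (+-cancelʳ-≤ ρ (begin
      ε + ρ   ≈⟨ +-comm ε ρ ⟩
      ρ + ε   ≤⟨ h ⟩
      ρ       ≈⟨ +-identityˡ ρ ⟨
      0# + ρ  ∎))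
    gap : ∀ {x y} → ¬ (x ≤ y) → ¬ (x - y ≤ 0#)
    gap {x} {y} x≰y h = x≰y (begin
      x          ≈⟨ x-y+y≈x x y ⟨
      x - y + y  ≤⟨ +-monoˡ-≤ y h ⟩
      0# + y     ≈⟨ +-identityˡ y ⟩
      y          ∎)
    c≤ρ^b : c ≤ ρ ^ b
    c≤ρ^b with em {c ≤ ρ ^ b}
    ... | yes c≤ρ^b = c≤ρ^b
    ... | no  c≰ρ^b with scaleStep (proj₁ (proj₂ lipschitz)) (gap c≰ρ^b)
    ...   | ε , 0≤ε , ε≤1 , ε≰0 , εK≤δ = contradiction
      (sup-upper (1# , 1∈Below) bounded (0≤x+y (1≤⇒0≤ 1≤ρ) 0≤ε , (begin
        (ρ + ε) ^ b            ≤⟨ proj₂ (proj₂ lipschitz) (1≤⇒0≤ 1≤ρ) ≤-refl 0≤ε ε≤1 ⟩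
        ρ ^ b + ε * K          ≤⟨ +-mono-≤ ≤-refl εK≤δ ⟩
        ρ ^ b + (c - ρ ^ b)    ≈⟨ +-comm (ρ ^ b) _ ⟩
        (c - ρ ^ b) + ρ ^ b    ≈⟨ x-y+y≈x c (ρ ^ b) ⟩
        c                      ∎)))
      (ρ+ε≰ρ ε≰0)
    ρ^b≤c : ρ ^ b ≤ c
    ρ^b≤c with em {ρ ^ b ≤ c}
    ... | yes ρ^b≤c = ρ^b≤c
    ... | no  ρ^b≰c with scaleStep (proj₁ (proj₂ lipschitz)) (gap ρ^b≰c)
    ...   | ε , 0≤ε , ε≤1 , ε≰0 , εK≤δ = contradiction
      (begin
        ρ + ε        ≤⟨ +-monoˡ-≤ ε (sup-least (1# , 1∈Below) bounded λ (_ , y^b≤c) →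
                          ^-cancel n 0≤z (≤-trans y^b≤c c≤z^b)) ⟩
        (ρ - ε) + ε  ≈⟨ x-y+y≈x ρ ε ⟩
        ρ            ∎)
      (ρ+ε≰ρ ε≰0)
      where
      0≤z : 0# ≤ ρ - ε
      0≤z = x≤y⇒0≤y-x (≤-trans ε≤1 1≤ρ)
      z≤ρ : ρ - ε ≤ ρ
      z≤ρ = ≤-trans (x≤x+y (ρ - ε) 0≤ε) (≤-reflexive (x-y+y≈x ρ ε))
      c≤z^b : c ≤ (ρ - ε) ^ b
      c≤z^b = +-cancelʳ-≤ (ρ ^ b - c) (begin
        c + (ρ ^ b - c)                ≈⟨ +-comm c _ ⟩
        (ρ ^ b - c) + c                ≈⟨ x-y+y≈x (ρ ^ b) c ⟩
        ρ ^ b                          ≈⟨ ^-congˡ b (x-y+y≈x ρ ε) ⟨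
        ((ρ - ε) + ε) ^ b              ≤⟨ proj₂ (proj₂ lipschitz) 0≤z z≤ρ 0≤ε ε≤1 ⟩
        (ρ - ε) ^ b + ε * K            ≤⟨ +-mono-≤ ≤-refl εK≤δ ⟩
        (ρ - ε) ^ b + (ρ ^ b - c)      ∎)

  -- Real powers enclosed by rational ones.

  module _ {x e} (1≤x : 1# ≤ x) (0≤e : 0# ≤ e) where
    private
      -- The set from the definition of `**`, repeated verbatim so that its supremum is `x ** e` by
      -- definition.
      InPower : Carrier → Set
      InPower = λ y → 0# ≤ y × (Σ[ a ∈ ℕ ] Σ[ b ∈ ℕ ] (0 ℕ.< b)
        × ((1# ≤ x × fromℕ a ≤ (e * fromℕ b)) ⊎ (x ≤ 1# × (e * fromℕ b) ≤ fromℕ a))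
        × (y ^ b) ≤ (x ^ a))

      -- From a′/b′ ≤ e ≤ a/b, compared after raising both sides to powers that clear the
      -- denominators. In the alternative x ≤ 1, the base is 1, and y ≤ 1.
      InPower-bound : ∀ {y} a b → InPower y → e * fromℕ b ≤ fromℕ a → y ^ b ≤ x ^ a
      InPower-bound {y} a b (0≤y , a′ , suc b′ , _ , inj₁ (_ , a′≤eb′) , y^b′≤x^a′) eb≤a =
        ^-cancel b′ (^-nonNegative a (1≤⇒0≤ 1≤x)) (begin
          (y ^ b) ^ suc b′      ≈⟨ ^-assocʳ y b (suc b′) ⟩
          y ^ (b ℕ.* suc b′)    ≡⟨ ≡.cong (y ^_) (ℕ.*-comm b (suc b′)) ⟩
          y ^ (suc b′ ℕ.* b)    ≈⟨ ^-assocʳ y (suc b′) b ⟨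
          (y ^ suc b′) ^ b      ≤⟨ ^-mono b (^-nonNegative (suc b′) 0≤y) y^b′≤x^a′ ⟩
          (x ^ a′) ^ b          ≈⟨ ^-assocʳ x a′ b ⟩
          x ^ (a′ ℕ.* b)        ≤⟨ ^-monoʳ 1≤x (fromℕ-cancel {a′ ℕ.* b} {a ℕ.* suc b′} a′b≤ab′) ⟩
          x ^ (a ℕ.* suc b′)    ≈⟨ ^-assocʳ x a (suc b′) ⟨
          (x ^ a) ^ suc b′      ∎)
        where
        a′b≤ab′ : fromℕ (a′ ℕ.* b) ≤ fromℕ (a ℕ.* suc b′)
        a′b≤ab′ = begin
          fromℕ (a′ ℕ.* b)                 ≈⟨ fromℕ-* a′ b ⟩
          fromℕ a′ * fromℕ b               ≤⟨ *-monoˡ-≤ (0≤fromℕ b) a′≤eb′ ⟩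
          e * fromℕ (suc b′) * fromℕ b     ≈⟨ S.solve 3 (λ e p q → e :* p :* q := e :* q :* p)
                                                refl e (fromℕ (suc b′)) (fromℕ b) ⟩
          e * fromℕ b * fromℕ (suc b′)     ≤⟨ *-monoˡ-≤ (0≤fromℕ (suc b′)) eb≤a ⟩
          fromℕ a * fromℕ (suc b′)         ≈⟨ fromℕ-* a (suc b′) ⟨
          fromℕ (a ℕ.* suc b′)             ∎
      InPower-bound {y} a b (0≤y , a′ , suc b′ , _ , inj₂ (x≤1 , _) , y^b′≤x^a′) eb≤a = begin
        y ^ b    ≤⟨ ^-mono b 0≤y (^-cancel b′ 0≤1 (begin
                      y ^ suc b′   ≤⟨ y^b′≤x^a′ ⟩
                      x ^ a′       ≤⟨ ^-mono a′ (1≤⇒0≤ 1≤x) x≤1 ⟩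
                      1# ^ a′      ≈⟨ 1^n≈1 a′ ⟩
                      1#           ≈⟨ 1^n≈1 (suc b′) ⟨
                      1# ^ suc b′  ∎)) ⟩
        1# ^ b   ≈⟨ 1^n≈1 b ⟩
        1#       ≤⟨ 1≤x^n a 1≤x ⟩
        x ^ a    ∎

      1∈InPower : InPower 1#
      1∈InPower = 0≤1 , 0 , 1 , s≤s z≤n , inj₁ (1≤x , *-nonNegative 0≤e (0≤fromℕ 1))
                , ≤-reflexive (*-identityˡ 1#)

      bounded : ∃[ z ] IsUpperBound InPower z
      bounded with archimedean (e * fromℕ 1)
      ... | a , e≤a = x ^ a , λ {y} y∈ → ≤-trans (≤-reflexive (sym (*-identityʳ y)))
        (InPower-bound a 1 y∈ e≤a)

    1≤** : 1# ≤ x ** e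
    1≤** = sup-upper (1# , 1∈InPower) bounded 1∈InPower

    -- The b-th root of x^a is an upper bound of the defining set when e ≤ a/b, and an element of it
    -- in `**-lower`. All laws of real powers below are drawn from these two comparisons.
    **-upper : ∀ a b → e * fromℕ b ≤ fromℕ a → (x ** e) ^ b ≤ x ^ a
    **-upper a zero    _    = 1≤x^n a 1≤x
    **-upper a (suc b) eb≤a with root b (1≤x^n a 1≤x)
    ... | ρ , 1≤ρ , ρ^b≈x^a = begin
      (x ** e) ^ suc b  ≤⟨ ^-mono (suc b) (1≤⇒0≤ 1≤**)
                             (sup-least (1# , 1∈InPower) bounded λ y∈ → ^-cancel b (1≤⇒0≤ 1≤ρ)
                               (≤-trans (InPower-bound a (suc b) y∈ eb≤a) (≤-reflexive (sym ρ^b≈x^a)))) ⟩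
      ρ ^ suc b         ≈⟨ ρ^b≈x^a ⟩
      x ^ a             ∎

    **-lower : ∀ a b → fromℕ a ≤ e * fromℕ b → x ^ a ≤ (x ** e) ^ b
    **-lower a zero    a≤eb with fromℕ-cancel {a} {0} (≤-trans a≤eb (≤-reflexive (zeroʳ e)))
    ... | z≤n = ≤-refl
    **-lower a (suc b) a≤eb with root b (1≤x^n a 1≤x)
    ... | ρ , 1≤ρ , ρ^b≈x^a = begin
      x ^ a             ≈⟨ ρ^b≈x^a ⟨
      ρ ^ suc b         ≤⟨ ^-mono (suc b) (1≤⇒0≤ 1≤ρ) (sup-upper (1# , 1∈InPower) bounded
                             (1≤⇒0≤ 1≤ρ , a , suc b , s≤s z≤n , inj₁ (1≤x , a≤eb) , ≤-reflexive ρ^b≈x^a)) ⟩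
      (x ** e) ^ suc b  ∎

  -- Bernoulli's inequality for (1 + δ/v)^b, multiplied by v^(b+1).
  bernoulli : ∀ {v δ} → 0# ≤ v → 0# ≤ δ → ∀ b → v ^ b * (v + fromℕ b * δ) ≤ (v + δ) ^ b * v
  bernoulli {v} {δ} 0≤v 0≤δ zero    = ≤-reflexive
    (*-congˡ (trans (+-congˡ (zeroˡ δ)) (+-identityʳ v)))
  bernoulli {v} {δ} 0≤v 0≤δ (suc b) = begin
    v * v ^ b * (v + (1# + fromℕ b) * δ)
      ≤⟨ x≤x+y _ (*-nonNegative (^-nonNegative b 0≤v)
           (*-nonNegative (*-nonNegative (0≤fromℕ b) 0≤δ) 0≤δ)) ⟩
    v * v ^ b * (v + (1# + fromℕ b) * δ) + v ^ b * (fromℕ b * δ * δ)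
      ≈⟨ S.solve 4 (λ v p b δ → v :* p :* (v :+ (con 1 :+ b) :* δ) :+ p :* (b :* δ :* δ)
           := (v :+ δ) :* (p :* (v :+ b :* δ))) refl v (v ^ b) (fromℕ b) δ ⟩
    (v + δ) * (v ^ b * (v + fromℕ b * δ))
      ≤⟨ *-monoʳ-≤ (0≤x+y 0≤v 0≤δ) (bernoulli 0≤v 0≤δ b) ⟩
    (v + δ) * ((v + δ) ^ b * v)
      ≈⟨ *-assoc (v + δ) _ v ⟨
    (v + δ) ^ suc b * v ∎

  -- A bounded ratio of all powers forces an inequality of the bases; the laws
  -- of ** follow by comparing integer powers up to a fixed factor.
  ^-coarse : ∀ c {u v} → 1# ≤ v → (∀ b → u ^ b ≤ c * v ^ b) → u ≤ v
  ^-coarse c {u} {v} 1≤v h with em {u ≤ v}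
  ... | yes u≤v = u≤v
  ... | no  u≰v = contradiction (+-cancelʳ-≤ (fromℕ N * δ) (begin
      (v + δ) + fromℕ N * δ   ≈⟨ S.solve 3 (λ v δ n → (v :+ δ) :+ n :* δ := v :+ (con 1 :+ n) :* δ)
                                   refl v δ (fromℕ N) ⟩
      v + fromℕ (suc N) * δ   ≤⟨ bound ⟩
      c * v                   ≈⟨ undo ⟨
      c * v * δ ⁻¹ * δ        ≤⟨ *-monoˡ-≤ 0≤δ (proj₂ (archimedean (c * v * δ ⁻¹))) ⟩
      fromℕ N * δ             ≈⟨ +-identityˡ _ ⟨
      0# + fromℕ N * δ        ∎))
      (1≤⇒≰0 (≤-trans 1≤v (x≤x+y v 0≤δ)))
    where
    0≤v = 1≤⇒0≤ 1≤v
    δ = u - v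
    0≤δ : 0# ≤ δ
    0≤δ = x≤y⇒0≤y-x (≰⇒≥ u≰v)
    δ≉0 : ¬ (δ ≈ 0#)
    δ≉0 δ≈0 = u≰v (begin
      u      ≈⟨ x-y+y≈x u v ⟨
      δ + v  ≈⟨ +-congʳ δ≈0 ⟩
      0# + v ≈⟨ +-identityˡ v ⟩
      v      ∎)
    -- Chosen so that N δ ≥ c v; by Bernoulli's inequality (u/v)^(N+1) then exceeds c.
    N = proj₁ (archimedean (c * v * δ ⁻¹))
    undo : c * v * δ ⁻¹ * δ ≈ c * v
    undo = trans (*-assoc _ (δ ⁻¹) δ) (trans (*-congˡ (trans (*-comm (δ ⁻¹) δ) (⁻¹-inverseʳ δ≉0)))
      (*-identityʳ _))
    v+δ≈u : v + δ ≈ u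
    v+δ≈u = trans (+-comm v δ) (x-y+y≈x u v)
    bound : v + fromℕ (suc N) * δ ≤ c * v
    bound = *-cancelˡ-≤ (1≤⇒≰0 (1≤x^n (suc N) 1≤v)) (begin
      v ^ suc N * (v + fromℕ (suc N) * δ)  ≤⟨ bernoulli 0≤v 0≤δ (suc N) ⟩
      (v + δ) ^ suc N * v                  ≈⟨ *-congʳ (^-congˡ (suc N) v+δ≈u) ⟩
      u ^ suc N * v                        ≤⟨ *-monoˡ-≤ 0≤v (h (suc N)) ⟩
      c * v ^ suc N * v                    ≈⟨ S.solve 3 (λ c p v → c :* p :* v := p :* (c :* v))
                                                refl c (v ^ suc N) v ⟩
      v ^ suc N * (c * v)                  ∎)

  ^-coarse-≈ : ∀ c {u v} → 0# ≤ c → 1# ≤ u → 1# ≤ v →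
    (∀ b → ∃[ w ] (w ≤ u ^ b × u ^ b ≤ c * w) × (w ≤ v ^ b × v ^ b ≤ c * w)) → u ≈ v
  ^-coarse-≈ c 0≤c 1≤u 1≤v h = ≤-antisym
    (^-coarse c 1≤v λ b → let _ , (_ , u≤) , (≤v , _) = h b in ≤-trans u≤ (*-monoʳ-≤ 0≤c ≤v))
    (^-coarse c 1≤u λ b → let _ , (≤u , _) , (_ , v≤) = h b in ≤-trans v≤ (*-monoʳ-≤ 0≤c ≤u))

  **-mono : ∀ {x y e f} → 1# ≤ x → 0# ≤ e → x ≤ y → e ≤ f → x ** e ≤ y ** f
  **-mono {x} {y} {e} {f} 1≤x 0≤e x≤y e≤f =
    ^-coarse x (1≤** (≤-trans 1≤x x≤y) (≤-trans 0≤e e≤f)) λ b →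
      let a , a≤eb , eb≤a+1 = floor (*-nonNegative 0≤e (0≤fromℕ b)) in begin
      (x ** e) ^ b      ≤⟨ **-upper 1≤x 0≤e (suc a) b eb≤a+1 ⟩
      x * x ^ a         ≤⟨ *-monoʳ-≤ (1≤⇒0≤ 1≤x) (^-mono a (1≤⇒0≤ 1≤x) x≤y) ⟩
      x * y ^ a         ≤⟨ *-monoʳ-≤ (1≤⇒0≤ 1≤x) (**-lower (≤-trans 1≤x x≤y) (≤-trans 0≤e e≤f) a b
                             (≤-trans a≤eb (*-monoˡ-≤ (0≤fromℕ b) e≤f))) ⟩
      x * (y ** f) ^ b  ∎

  **-cong : ∀ {x y e f} → 1# ≤ x → 0# ≤ e → x ≈ y → e ≈ f → x ** e ≈ y ** f
  **-cong 1≤x 0≤e x≈y e≈f = ≤-antisym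
    (**-mono 1≤x 0≤e (≤-reflexive x≈y) (≤-reflexive e≈f))
    (**-mono (≤-trans 1≤x (≤-reflexive x≈y)) (≤-trans 0≤e (≤-reflexive e≈f))
      (≤-reflexive (sym x≈y)) (≤-reflexive (sym e≈f)))

  **-+ : ∀ {x e f} → 1# ≤ x → 0# ≤ e → 0# ≤ f → x ** e * x ** f ≈ x ** (e + f)
  **-+ {x} {e} {f} 1≤x 0≤e 0≤f = ^-coarse-≈ (x * x) (1≤⇒0≤ (1≤x*y 1≤x 1≤x))
    (1≤x*y (1≤** 1≤x 0≤e) (1≤** 1≤x 0≤f)) (1≤** 1≤x 0≤e+f) λ b →
    let a₁ , a₁≤eb , eb≤a₁+1 = floor (*-nonNegative 0≤e (0≤fromℕ b))
        a₂ , a₂≤fb , fb≤a₂+1 = floor (*-nonNegative 0≤f (0≤fromℕ b))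
        factor : x ^ (suc a₁ ℕ.+ suc a₂) ≈ x * x * x ^ (a₁ ℕ.+ a₂)
        factor = trans (^-homo-* x (suc a₁) (suc a₂)) (trans
          (S.solve 3 (λ x p q → (x :* p) :* (x :* q) := x :* x :* (p :* q)) refl x (x ^ a₁) (x ^ a₂))
          (*-congˡ (sym (^-homo-* x a₁ a₂))))
    in x ^ (a₁ ℕ.+ a₂)
    , ((begin
        x ^ (a₁ ℕ.+ a₂)                ≈⟨ ^-homo-* x a₁ a₂ ⟩
        x ^ a₁ * x ^ a₂                ≤⟨ *-mono-≤ (0≤x^ a₁) (^-nonNegative b (1≤⇒0≤ (1≤** 1≤x 0≤f)))
                                            (**-lower 1≤x 0≤e a₁ b a₁≤eb) (**-lower 1≤x 0≤f a₂ b a₂≤fb) ⟩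
        (x ** e) ^ b * (x ** f) ^ b    ≈⟨ ^-distrib-* (x ** e) (x ** f) b ⟨
        (x ** e * x ** f) ^ b          ∎)
      , (begin
        (x ** e * x ** f) ^ b          ≈⟨ ^-distrib-* (x ** e) (x ** f) b ⟩
        (x ** e) ^ b * (x ** f) ^ b    ≤⟨ *-mono-≤ (^-nonNegative b (1≤⇒0≤ (1≤** 1≤x 0≤e))) (0≤x^ (suc a₂))
                                            (**-upper 1≤x 0≤e (suc a₁) b eb≤a₁+1) (**-upper 1≤x 0≤f (suc a₂) b fb≤a₂+1) ⟩
        x ^ suc a₁ * x ^ suc a₂        ≈⟨ ^-homo-* x (suc a₁) (suc a₂) ⟨
        x ^ (suc a₁ ℕ.+ suc a₂)        ≈⟨ factor ⟩
        x * x * x ^ (a₁ ℕ.+ a₂)        ∎))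
    , (**-lower 1≤x 0≤e+f (a₁ ℕ.+ a₂) b (begin
        fromℕ (a₁ ℕ.+ a₂)              ≈⟨ fromℕ-+ a₁ a₂ ⟩
        fromℕ a₁ + fromℕ a₂            ≤⟨ +-mono-≤ a₁≤eb a₂≤fb ⟩
        e * fromℕ b + f * fromℕ b      ≈⟨ distribʳ (fromℕ b) e f ⟨
        (e + f) * fromℕ b              ∎)
      , (≤-trans (**-upper 1≤x 0≤e+f (suc a₁ ℕ.+ suc a₂) b (begin
        (e + f) * fromℕ b              ≈⟨ distribʳ (fromℕ b) e f ⟩
        e * fromℕ b + f * fromℕ b      ≤⟨ +-mono-≤ eb≤a₁+1 fb≤a₂+1 ⟩
        fromℕ (suc a₁) + fromℕ (suc a₂) ≈⟨ fromℕ-+ (suc a₁) (suc a₂) ⟨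
        fromℕ (suc a₁ ℕ.+ suc a₂)      ∎)) (≤-reflexive factor)))
    where
    0≤e+f = 0≤x+y 0≤e 0≤f
    0≤x^ : ∀ n → 0# ≤ x ^ n
    0≤x^ n = ^-nonNegative n (1≤⇒0≤ 1≤x)

  **-distrib-* : ∀ {x y e} → 1# ≤ x → 1# ≤ y → 0# ≤ e → x ** e * y ** e ≈ (x * y) ** e
  **-distrib-* {x} {y} {e} 1≤x 1≤y 0≤e = ^-coarse-≈ (x * y) (1≤⇒0≤ 1≤xy)
    (1≤x*y (1≤** 1≤x 0≤e) (1≤** 1≤y 0≤e)) (1≤** 1≤xy 0≤e) λ b →
    let a , a≤eb , eb≤a+1 = floor (*-nonNegative 0≤e (0≤fromℕ b)) in
    (x * y) ^ a
    , ((begin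
        (x * y) ^ a                  ≈⟨ ^-distrib-* x y a ⟩
        x ^ a * y ^ a                ≤⟨ *-mono-≤ (^-nonNegative a (1≤⇒0≤ 1≤x)) (^-nonNegative b (1≤⇒0≤ (1≤** 1≤y 0≤e)))
                                          (**-lower 1≤x 0≤e a b a≤eb) (**-lower 1≤y 0≤e a b a≤eb) ⟩
        (x ** e) ^ b * (y ** e) ^ b  ≈⟨ ^-distrib-* (x ** e) (y ** e) b ⟨
        (x ** e * y ** e) ^ b        ∎)
      , (begin
        (x ** e * y ** e) ^ b        ≈⟨ ^-distrib-* (x ** e) (y ** e) b ⟩
        (x ** e) ^ b * (y ** e) ^ b  ≤⟨ *-mono-≤ (^-nonNegative b (1≤⇒0≤ (1≤** 1≤x 0≤e))) (^-nonNegative (suc a) (1≤⇒0≤ 1≤y))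
                                          (**-upper 1≤x 0≤e (suc a) b eb≤a+1) (**-upper 1≤y 0≤e (suc a) b eb≤a+1) ⟩
        x ^ suc a * y ^ suc a        ≈⟨ ^-distrib-* x y (suc a) ⟨
        (x * y) ^ suc a              ∎))
    , (**-lower 1≤xy 0≤e a b a≤eb , **-upper 1≤xy 0≤e (suc a) b eb≤a+1)
    where
    1≤xy = 1≤x*y 1≤x 1≤y

  -- There are two roundings, of f b to a and of e a to a′. The error of the first is multiplied by
  -- e, hence the power of x with an integer E ≥ e in the comparison factor.
  **-* : ∀ {x e f} → 1# ≤ x → 0# ≤ e → 0# ≤ f → (x ** e) ** f ≈ x ** (e * f)
  **-* {x} {e} {f} 1≤x 0≤e 0≤f = ^-coarse-≈ (z * x ^ suc E) (1≤⇒0≤ (1≤x*y 1≤z (1≤x^n (suc E) 1≤x)))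
    (1≤** 1≤z 0≤f) (1≤** 1≤x 0≤ef) λ b →
    let a  , a≤fb , fb≤a+1 = floor (*-nonNegative 0≤f (0≤fromℕ b))
        a′ , a′≤ea , ea≤a′+1 = floor (*-nonNegative 0≤e (0≤fromℕ a))
    in x ^ a′
    , ((begin
        x ^ a′              ≤⟨ **-lower 1≤x 0≤e a′ a a′≤ea ⟩
        z ^ a               ≤⟨ **-lower 1≤z 0≤f a b a≤fb ⟩
        (z ** f) ^ b        ∎)
      , (begin
        (z ** f) ^ b            ≤⟨ **-upper 1≤z 0≤f (suc a) b fb≤a+1 ⟩
        z * z ^ a               ≤⟨ *-monoʳ-≤ 0≤z (**-upper 1≤x 0≤e (suc a′) a ea≤a′+1) ⟩
        z * (x * x ^ a′)        ≤⟨ *-monoʳ-≤ 0≤z (*-monoˡ-≤ (0≤x^ a′) x≤x^) ⟩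
        z * (x ^ suc E * x ^ a′) ≈⟨ *-assoc z _ _ ⟨
        z * x ^ suc E * x ^ a′  ∎))
    , (**-lower 1≤x 0≤ef a′ b (begin
        fromℕ a′            ≤⟨ a′≤ea ⟩
        e * fromℕ a         ≤⟨ *-monoʳ-≤ 0≤e a≤fb ⟩
        e * (f * fromℕ b)   ≈⟨ *-assoc e f _ ⟨
        e * f * fromℕ b     ∎)
      , (begin
        (x ** (e * f)) ^ b             ≤⟨ **-upper 1≤x 0≤ef (suc a′ ℕ.+ E) b (begin
            e * f * fromℕ b              ≈⟨ *-assoc e f _ ⟩
            e * (f * fromℕ b)            ≤⟨ *-monoʳ-≤ 0≤e fb≤a+1 ⟩
            e * (1# + fromℕ a)           ≈⟨ S.solve 2 (λ e a → e :* (con 1 :+ a) := e :* a :+ e) refl e (fromℕ a) ⟩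
            e * fromℕ a + e              ≤⟨ +-mono-≤ ea≤a′+1 (proj₂ (archimedean e)) ⟩
            fromℕ (suc a′) + fromℕ E     ≈⟨ fromℕ-+ (suc a′) E ⟨
            fromℕ (suc a′ ℕ.+ E)         ∎) ⟩
        x ^ (suc a′ ℕ.+ E)             ≈⟨ ^-homo-* x (suc a′) E ⟩
        x * x ^ a′ * x ^ E             ≈⟨ S.solve 3 (λ x p q → x :* p :* q := con 1 :* (x :* q :* p))
                                            refl x (x ^ a′) (x ^ E) ⟩
        1# * (x ^ suc E * x ^ a′)      ≤⟨ *-monoˡ-≤ (1≤⇒0≤ (1≤x*y (1≤x^n (suc E) 1≤x) (1≤x^n a′ 1≤x))) 1≤z ⟩
        z * (x ^ suc E * x ^ a′)       ≈⟨ *-assoc z _ _ ⟨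
        z * x ^ suc E * x ^ a′         ∎))
    where
    z = x ** e
    E = proj₁ (archimedean e)
    1≤z : 1# ≤ z
    1≤z = 1≤** 1≤x 0≤e
    0≤z = 1≤⇒0≤ 1≤z
    0≤ef = *-nonNegative 0≤e 0≤f
    0≤x^ : ∀ n → 0# ≤ x ^ n
    0≤x^ n = ^-nonNegative n (1≤⇒0≤ 1≤x)
    x≤x^ : x ≤ x ^ suc E
    x≤x^ = ≤-trans (≤-reflexive (sym (*-identityʳ x))) (^-monoʳ {m = 1} {n = suc E} 1≤x (s≤s z≤n))

  **-fromℕ : ∀ {x} k → 1# ≤ x → x ** fromℕ k ≈ x ^ k
  **-fromℕ {x} k 1≤x = trans (sym (*-identityʳ _)) (≤-antisym
    (**-upper 1≤x (0≤fromℕ k) k 1 (≤-reflexive k*1≈k))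
    (**-lower 1≤x (0≤fromℕ k) k 1 (≤-reflexive (sym k*1≈k))))
    where
    k*1≈k : fromℕ k * fromℕ 1 ≈ fromℕ k
    k*1≈k = trans (*-congˡ fromℕ-1) (*-identityʳ _)

  **-identityʳ : ∀ {x} → 1# ≤ x → x ** 1# ≈ x
  **-identityʳ {x} 1≤x = trans (**-cong 1≤x 0≤1 refl (sym fromℕ-1))
    (trans (**-fromℕ 1 1≤x) (*-identityʳ x))

-- The exponents of the bound.

module Exponents (em : ExcludedMiddle 0ℓ) (ℝ : CompleteOrderedField)
  (t : CompleteOrderedField.Carrier ℝ)
  (2≤t : CompleteOrderedField._≤_ ℝ (CompleteOrderedField.fromℕ ℝ 2) t) (s : ℕ) where
  open CompleteOrderedField ℝ
  open OrderedField em ℝ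
  open S using (con; _:+_; _:*_; _:=_)
  open Exp semiring using (^-congˡ; ^-assocʳ)
  open PosetReasoning ≤-poset

  -- The paper's s is suc s here; a and b are its exponents of m and n.
  γ a b β : Carrier
  γ = t * fromℕ (suc s) - 1#
  a = ((t - 1#) * fromℕ (suc s)) / γ
  b = (t * (fromℕ (suc s) - 1#)) / γ
  β = fromℕ s * γ ⁻¹

  private
    σ fs fS : Carrier
    σ  = t - 1#
    fs = fromℕ s
    fS = fromℕ (suc s)

    σ+1≈t : σ + 1# ≈ t
    σ+1≈t = x-y+y≈x t 1#

    γ+1≈tS : γ + 1# ≈ t * fS
    γ+1≈tS = x-y+y≈x (t * fS) 1#

    fS-1≈fs : fS - 1# ≈ fs
    fS-1≈fs = trans (+-congʳ (+-comm 1# fs)) (x+y-y≈x fs 1#)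

    1≤σ : 1# ≤ σ
    1≤σ = +-cancelʳ-≤ 1# (begin
      1# + 1#   ≈⟨ +-congˡ fromℕ-1 ⟨
      fromℕ 2   ≤⟨ 2≤t ⟩
      t         ≈⟨ σ+1≈t ⟨
      σ + 1#    ∎)

    1≤fS : 1# ≤ fS
    1≤fS = 1≤fromℕ {suc s} (s≤s z≤n)

    σS+s≈γ : σ * fS + fs ≈ γ
    σS+s≈γ = trans (sym (x+y-y≈x (σ * fS + fs) 1#)) (+-congʳ (begin-equality
      σ * fS + fs + 1#   ≈⟨ S.solve 3 (λ σ S s → σ :* S :+ s :+ con 1 := σ :* S :+ (con 1 :+ s)) refl σ fS fs ⟩
      σ * fS + fS        ≈⟨ S.solve 2 (λ σ S → σ :* S :+ S := (σ :+ con 1) :* S) refl σ fS ⟩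
      (σ + 1#) * fS      ≈⟨ *-congʳ σ+1≈t ⟩
      t * fS             ∎))

    1≤γ : 1# ≤ γ
    1≤γ = begin
      1#            ≤⟨ 1≤x*y 1≤σ 1≤fS ⟩
      σ * fS        ≤⟨ x≤x+y (σ * fS) (0≤fromℕ s) ⟩
      σ * fS + fs   ≈⟨ σS+s≈γ ⟩
      γ             ∎

    γγ⁻¹≈1 : γ * γ ⁻¹ ≈ 1#
    γγ⁻¹≈1 = ⁻¹-inverseʳ (λ γ≈0 → 1≤⇒≰0 1≤γ (≤-reflexive γ≈0))

    0≤γ⁻¹ : 0# ≤ γ ⁻¹
    0≤γ⁻¹ = ⁻¹-nonNegative (1≤⇒≰0 1≤γ)

  0≤γ : 0# ≤ γ
  0≤γ = 1≤⇒0≤ 1≤γ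

  1≤t : 1# ≤ t
  1≤t = ≤-trans (1≤fromℕ {2} (s≤s z≤n)) 2≤t

  0≤t : 0# ≤ t
  0≤t = 1≤⇒0≤ 1≤t

  0≤a : 0# ≤ a
  0≤a = *-nonNegative (*-nonNegative (1≤⇒0≤ 1≤σ) (0≤fromℕ (suc s))) 0≤γ⁻¹

  0≤β : 0# ≤ β
  0≤β = *-nonNegative (0≤fromℕ s) 0≤γ⁻¹

  a+β≈1 : a + β ≈ 1#
  a+β≈1 = trans (sym (distribʳ (γ ⁻¹) (σ * fS) fs)) (trans (*-congʳ σS+s≈γ) γγ⁻¹≈1)

  γβ≈s : γ * β ≈ fromℕ s
  γβ≈s = trans (S.solve 3 (λ γ s i → γ :* (s :* i) := s :* (γ :* i)) refl γ fs (γ ⁻¹))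
    (trans (*-congˡ γγ⁻¹≈1) (*-identityʳ fs))

  tβ≈b : t * β ≈ b
  tβ≈b = trans (sym (*-assoc t fs (γ ⁻¹))) (*-congʳ (*-congˡ (sym fS-1≈fs)))

  0≤b : 0# ≤ b
  0≤b = ≤-trans (*-nonNegative 0≤t 0≤β) (≤-reflexive tβ≈b)

  -- Since a + β = 1, it suffices that β ≤ a, which is s ≤ (t - 1)(s + 1) and follows from t ≥ 2.
  1≤a2 : fromℕ 1 ≤ a * fromℕ 2
  1≤a2 = begin
    fromℕ 1       ≈⟨ fromℕ-1 ⟩
    1#            ≈⟨ a+β≈1 ⟨
    a + β         ≤⟨ +-mono-≤ ≤-refl (*-monoˡ-≤ 0≤γ⁻¹ (begin
      fs            ≤⟨ x≤y+x fs 0≤1 ⟩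
      fS            ≈⟨ *-identityˡ fS ⟨
      1# * fS       ≤⟨ *-monoˡ-≤ (0≤fromℕ (suc s)) 1≤σ ⟩
      σ * fS        ∎)) ⟩
    a + a         ≈⟨ S.solve 1 (λ a → a :+ a := a :* (con 1 :+ con 1)) refl a ⟩
    a * (1# + 1#) ≈⟨ *-congˡ (+-congˡ fromℕ-1) ⟨
    a * fromℕ 2   ∎

  -- Raise the hypothesis to the power β and multiply by mᵃ.
  balance : ∀ {K m w n} → 1# ≤ K → 1# ≤ m → 1# ≤ w → 1# ≤ n →
    w ** γ * m ≤ K * n ** t → m * w ^ s ≤ K ** β * (m ** a * n ** b)
  balance {K} {m} {w} {n} 1≤K 1≤m 1≤w 1≤n h = begin
    m * w ^ s
      ≈⟨ *-cong (sym (trans (**-+ 1≤m 0≤a 0≤β)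
           (trans (**-cong 1≤m (0≤x+y 0≤a 0≤β) refl a+β≈1) (**-identityʳ 1≤m))))
           (sym (trans (**-* 1≤w 0≤γ 0≤β)
             (trans (**-cong 1≤w (*-nonNegative 0≤γ 0≤β) refl γβ≈s) (**-fromℕ s 1≤w)))) ⟩
    m ** a * m ** β * (w ** γ) ** β
      ≈⟨ S.solve 3 (λ x y z → x :* y :* z := x :* (z :* y)) refl (m ** a) (m ** β) ((w ** γ) ** β) ⟩
    m ** a * ((w ** γ) ** β * m ** β)
      ≈⟨ *-congˡ (**-distrib-* (1≤** 1≤w 0≤γ) 1≤m 0≤β) ⟩
    m ** a * (w ** γ * m) ** β
      ≤⟨ *-monoʳ-≤ (1≤⇒0≤ (1≤** 1≤m 0≤a)) (**-mono (1≤x*y (1≤** 1≤w 0≤γ) 1≤m) 0≤β h ≤-refl) ⟩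
    m ** a * (K * n ** t) ** β
      ≈⟨ *-congˡ (**-distrib-* 1≤K (1≤** 1≤n 0≤t) 0≤β) ⟨
    m ** a * (K ** β * (n ** t) ** β)
      ≈⟨ *-congˡ (*-congˡ (trans (**-* 1≤n 0≤t 0≤β) (**-cong 1≤n (*-nonNegative 0≤t 0≤β) refl tβ≈b))) ⟩
    m ** a * (K ** β * n ** b)
      ≈⟨ S.solve 3 (λ x y z → x :* (y :* z) := y :* (x :* z)) refl (m ** a) (K ** β) (n ** b) ⟩
    K ** β * (m ** a * n ** b) ∎

  -- This eliminates r. As γ + 1 = t(s + 1), the product w^γ w is (w^(s+1))^t, which combines with
  -- r^t into (r w^(s+1))^t ≤ (2n)^t. Cancelling the remaining w accounts for the -1 in γ, the
  -- common denominator of the exponents.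
  w^γ-bound : ∀ {c m w r n} → 1# ≤ c → 1# ≤ w → 1# ≤ r → 1# ≤ n →
    r * w ^ suc s ≤ fromℕ 2 * n → m ≤ c * r ** t * w → w ** γ * m ≤ c * fromℕ 2 ** t * n ** t
  w^γ-bound {c} {m} {w} {r} {n} 1≤c 1≤w 1≤r 1≤n rw^S≤2n m≤ = *-cancelʳ-≤ (1≤⇒≰0 1≤w) (begin
    w ** γ * m * w
      ≈⟨ S.solve 3 (λ p m w → p :* m :* w := m :* (p :* w)) refl (w ** γ) m w ⟩
    m * (w ** γ * w)
      ≈⟨ *-congˡ w^γw≈ ⟩
    m * (w ^ suc s) ** t
      ≤⟨ *-monoˡ-≤ (1≤⇒0≤ (1≤** 1≤w^S 0≤t)) m≤ ⟩
    c * r ** t * w * (w ^ suc s) ** t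
      ≈⟨ S.solve 4 (λ c r w p → c :* r :* w :* p := c :* (r :* p) :* w) refl c (r ** t) w _ ⟩
    c * (r ** t * (w ^ suc s) ** t) * w
      ≈⟨ *-congʳ (*-congˡ (**-distrib-* 1≤r 1≤w^S 0≤t)) ⟩
    c * (r * w ^ suc s) ** t * w
      ≤⟨ *-monoˡ-≤ (1≤⇒0≤ 1≤w) (*-monoʳ-≤ (1≤⇒0≤ 1≤c)
           (**-mono (1≤x*y 1≤r 1≤w^S) 0≤t rw^S≤2n ≤-refl)) ⟩
    c * (fromℕ 2 * n) ** t * w
      ≈⟨ *-congʳ (trans (*-assoc c _ _) (*-congˡ (**-distrib-* (1≤fromℕ {2} (s≤s z≤n)) 1≤n 0≤t))) ⟨
    c * fromℕ 2 ** t * n ** t * w ∎)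
    where
    1≤w^S : 1# ≤ w ^ suc s
    1≤w^S = 1≤x^n (suc s) 1≤w
    w^γw≈ : w ** γ * w ≈ (w ^ suc s) ** t
    w^γw≈ = begin-equality
      w ** γ * w               ≈⟨ *-congˡ (**-identityʳ 1≤w) ⟨
      w ** γ * w ** 1#         ≈⟨ **-+ 1≤w 0≤γ 0≤1 ⟩
      w ** (γ + 1#)            ≈⟨ **-cong 1≤w (0≤x+y 0≤γ 0≤1) refl (trans γ+1≈tS (*-comm t fS)) ⟩
      w ** (fS * t)            ≈⟨ **-* 1≤w (0≤fromℕ (suc s)) 0≤t ⟨
      (w ** fS) ** t           ≈⟨ **-cong (1≤** 1≤w (0≤fromℕ (suc s))) 0≤t (**-fromℕ (suc s) 1≤w) refl ⟩
      (w ^ suc s) ** t         ∎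

  -- Since a ≥ 1/2, passing from j + 1 to j loses at least the factor 1 - 1/(2j + 2).
  power-drop : ∀ j → 1 ℕ.≤ j →
    fromℕ j ** a * fromℕ (2 ℕ.* suc j) ≤ fromℕ (suc j) ** a * fromℕ (suc (2 ℕ.* j))
  power-drop j 1≤j = begin
    J ** a * V                  ≈⟨ *-congˡ yW≈V ⟨
    J ** a * (y * W)            ≈⟨ *-assoc (J ** a) y W ⟨
    J ** a * y * W              ≤⟨ *-monoˡ-≤ (0≤fromℕ (suc (2 ℕ.* j)))
                                     (*-monoʳ-≤ (1≤⇒0≤ (1≤** 1≤J 0≤a)) y≤x^a) ⟩
    J ** a * x ** a * W         ≈⟨ *-congʳ (**-distrib-* 1≤J 1≤x 0≤a) ⟩
    (J * x) ** a * W            ≈⟨ *-congʳ (**-cong (1≤x*y 1≤J 1≤x) 0≤a Jx≈J′ refl) ⟩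
    J′ ** a * W                 ∎
    where
    J J′ V W x y : Carrier
    J  = fromℕ j
    J′ = fromℕ (suc j)
    V  = fromℕ (2 ℕ.* suc j)
    W  = fromℕ (suc (2 ℕ.* j))
    x  = J′ * J ⁻¹
    y  = V * W ⁻¹
    1≤J : 1# ≤ J
    1≤J = 1≤fromℕ 1≤j
    1≤W : 1# ≤ W
    1≤W = 1≤fromℕ {suc (2 ℕ.* j)} (s≤s z≤n)
    inverse : ∀ {z} → 1# ≤ z → z ⁻¹ * z ≈ 1#
    inverse {z} 1≤z = trans (*-comm (z ⁻¹) z) (⁻¹-inverseʳ λ z≈0 → 1≤⇒≰0 1≤z (≤-reflexive z≈0))
    yW≈V : y * W ≈ V
    yW≈V = trans (*-assoc V (W ⁻¹) W) (trans (*-congˡ (inverse 1≤W)) (*-identityʳ V))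
    xJ≈J′ : x * J ≈ J′
    xJ≈J′ = trans (*-assoc J′ (J ⁻¹) J) (trans (*-congˡ (inverse 1≤J)) (*-identityʳ J′))
    Jx≈J′ : J * x ≈ J′
    Jx≈J′ = trans (*-comm J x) xJ≈J′
    1≤x : 1# ≤ x
    1≤x = *-cancelʳ-≤ (1≤⇒≰0 1≤J) (begin
      1# * J   ≈⟨ *-identityˡ J ⟩
      J        ≤⟨ x≤y+x J 0≤1 ⟩
      J′       ≈⟨ xJ≈J′ ⟨
      x * J    ∎)
    0≤x^a : 0# ≤ x ** a
    0≤x^a = 1≤⇒0≤ (1≤** 1≤x 0≤a)
    V²J≤J′W² : V * V * J ≤ J′ * (W * W)
    V²J≤J′W² = begin
      V * V * J                 ≈⟨ trans (fromℕ-* (2 ℕ.* suc j ℕ.* (2 ℕ.* suc j)) j) (*-congʳ (fromℕ-* (2 ℕ.* suc j) (2 ℕ.* suc j))) ⟨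
      fromℕ (2 ℕ.* suc j ℕ.* (2 ℕ.* suc j) ℕ.* j)
        -- The two sides differ by exactly j + 1, because (2j + 1)² = 4j(j + 1) + 1.
        ≤⟨ fromℕ-mono (ℕ.≤-trans (ℕ.m≤m+n _ (suc j)) (ℕ.≤-reflexive (square j))) ⟩
      fromℕ (suc j ℕ.* (suc (2 ℕ.* j) ℕ.* suc (2 ℕ.* j)))
        ≈⟨ trans (fromℕ-* (suc j) (suc (2 ℕ.* j) ℕ.* suc (2 ℕ.* j))) (*-congˡ (fromℕ-* (suc (2 ℕ.* j)) (suc (2 ℕ.* j)))) ⟩
      J′ * (W * W)              ∎
      where
      square : ∀ j → 2 ℕ.* suc j ℕ.* (2 ℕ.* suc j) ℕ.* j ℕ.+ suc j
                   ≡ suc j ℕ.* (suc (2 ℕ.* j) ℕ.* suc (2 ℕ.* j))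
      square = solve-∀
    y²≤x : y ^ 2 ≤ x
    y²≤x = *-cancelʳ-≤ (1≤⇒≰0 (1≤x*y (1≤x*y 1≤W 1≤W) 1≤J)) (begin
      y ^ 2 * (W * W * J)           ≈⟨ S.solve 3 (λ y W J → y :* (y :* con 1) :* (W :* W :* J)
                                         := (y :* W) :* (y :* W) :* J) refl y W J ⟩
      (y * W) * (y * W) * J         ≈⟨ *-congʳ (*-cong yW≈V yW≈V) ⟩
      V * V * J                     ≤⟨ V²J≤J′W² ⟩
      J′ * (W * W)                  ≈⟨ *-congʳ xJ≈J′ ⟨
      x * J * (W * W)               ≈⟨ S.solve 3 (λ x J W → x :* J :* (W :* W) := x :* (W :* W :* J)) refl x J W ⟩
      x * (W * W * J)               ∎)
    y≤x^a : y ≤ x ** a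
    y≤x^a = ^-cancel 1 0≤x^a (begin
      y ^ 2            ≤⟨ y²≤x ⟩
      x                ≈⟨ *-identityʳ x ⟨
      x ^ 1            ≤⟨ **-lower 1≤x 0≤a 1 2 1≤a2 ⟩
      (x ** a) ^ 2     ∎)

  -- For x ≤ 1 the defining set contains 0 and is bounded by 1. This includes the base 0, which
  -- occurs when `P` or `Q` is empty.
  **-nonNegative : ∀ {x e} → 0# ≤ x → 0# ≤ e → 0# ≤ x ** e
  **-nonNegative {x} {e} 0≤x 0≤e with total 1# x
  ... | inj₁ 1≤x = 1≤⇒0≤ (1≤** 1≤x 0≤e)
  ... | inj₂ x≤1 with archimedean (e * fromℕ 1)
  ...   | k , e≤k = sup-upper (0# , 0∈) (1# , bounded) 0∈
    where
    InPower : Carrier → Set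
    InPower y = 0# ≤ y × (Σ[ a ∈ ℕ ] Σ[ b ∈ ℕ ] (0 ℕ.< b)
      × ((1# ≤ x × fromℕ a ≤ (e * fromℕ b)) ⊎ (x ≤ 1# × (e * fromℕ b) ≤ fromℕ a))
      × (y ^ b) ≤ (x ^ a))
    0∈ : InPower 0#
    0∈ = ≤-refl , k , 1 , s≤s z≤n , inj₂ (x≤1 , e≤k)
       , ≤-trans (≤-reflexive (zeroˡ 1#)) (^-nonNegative k 0≤x)
    bounded : IsUpperBound InPower 1#
    bounded {y} (0≤y , a , suc b , _ , _ , y^b≤x^a) = ^-cancel b 0≤1 (begin
      y ^ suc b    ≤⟨ y^b≤x^a ⟩
      x ^ a        ≤⟨ ^-mono a 0≤x x≤1 ⟩
      1# ^ a       ≈⟨ 1^n≈1 a ⟩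
      1#           ≈⟨ 1^n≈1 (suc b) ⟨
      1# ^ suc b   ∎)

  term : ℕ → ℕ → Carrier
  term m n = fromℕ m ** a * fromℕ n ** b

  0≤term : ∀ m n → 0# ≤ term m n
  0≤term m n = *-nonNegative (**-nonNegative (0≤fromℕ m) 0≤a) (**-nonNegative (0≤fromℕ n) 0≤b)

  term-mono : ∀ j n → 1 ℕ.≤ j → term j n ≤ term (suc j) n
  term-mono j n 1≤j = *-monoˡ-≤ (**-nonNegative (0≤fromℕ n) 0≤b)
    (**-mono (1≤fromℕ 1≤j) 0≤a (fromℕ-mono (ℕ.n≤1+n j)) ≤-refl)

  -- By `power-drop`, the last step of `term` from j to j + 1 gains at least the fraction 1/(2j + 2)
  -- of its final value. Multiplied by 2κ, this gain covers x. The factor 2 reflects a ≥ 1/2.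
  term-drop : ∀ {κ x} j n → 1 ℕ.≤ j → 0# ≤ κ → fromℕ (suc j) * x ≤ κ * term (suc j) n →
    x + κ * fromℕ 2 * term j n ≤ κ * fromℕ 2 * term (suc j) n
  term-drop {κ} {x} j n 1≤j 0≤κ h = *-cancelˡ-≤ (1≤⇒≰0 (1≤fromℕ {suc j} (s≤s z≤n))) (begin
    m * (x + κ * two * T)
      ≈⟨ S.solve 5 (λ m x κ c T → m :* (x :+ κ :* c :* T) := m :* x :+ κ :* (T :* (c :* m)))
           refl m x κ two T ⟩
    m * x + κ * (T * (two * m))
      ≤⟨ +-mono-≤ h (*-monoʳ-≤ 0≤κ drop) ⟩
    κ * T′ + κ * (T′ * fromℕ (suc (2 ℕ.* j)))
      ≈⟨ S.solve 3 (λ κ T c → κ :* T :+ κ :* (T :* c) := κ :* (T :* (con 1 :+ c)))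
           refl κ T′ (fromℕ (suc (2 ℕ.* j))) ⟩
    κ * (T′ * fromℕ (suc (suc (2 ℕ.* j))))
      ≡⟨ ≡.cong (λ k → κ * (T′ * fromℕ k)) (double j) ⟩
    κ * (T′ * fromℕ (2 ℕ.* suc j))
      ≈⟨ *-congˡ (*-congˡ (fromℕ-* 2 (suc j))) ⟩
    κ * (T′ * (two * m))
      ≈⟨ S.solve 4 (λ κ T c m → κ :* (T :* (c :* m)) := m :* (κ :* c :* T)) refl κ T′ two m ⟩
    m * (κ * two * T′) ∎)
    where
    m two T T′ : Carrier
    m   = fromℕ (suc j)
    two = fromℕ 2
    T   = term j n
    T′  = term (suc j) n
    double : ∀ j → suc (suc (2 ℕ.* j)) ≡ 2 ℕ.* suc j
    double = solve-∀
    drop : T * (two * m) ≤ T′ * fromℕ (suc (2 ℕ.* j))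
    drop = begin
      fromℕ j ** a * N * (two * m)                ≈⟨ *-congˡ (fromℕ-* 2 (suc j)) ⟨
      fromℕ j ** a * N * fromℕ (2 ℕ.* suc j)      ≈⟨ S.solve 3 (λ p n q → p :* n :* q := p :* q :* n)
                                                       refl (fromℕ j ** a) N _ ⟩
      fromℕ j ** a * fromℕ (2 ℕ.* suc j) * N      ≤⟨ *-monoˡ-≤ (**-nonNegative (0≤fromℕ n) 0≤b) (power-drop j 1≤j) ⟩
      m ** a * fromℕ (suc (2 ℕ.* j)) * N          ≈⟨ S.solve 3 (λ p n q → p :* q :* n := p :* n :* q)
                                                       refl (m ** a) N (fromℕ (suc (2 ℕ.* j))) ⟩
      m ** a * N * fromℕ (suc (2 ℕ.* j))          ∎
      where N = fromℕ n ** b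

  degree-bound : ∀ {c m n w r δ D} → 1# ≤ c → 1 ℕ.≤ m → 1 ℕ.≤ n → 1 ℕ.≤ w → 1 ℕ.≤ r →
    δ ℕ.≤ D ℕ.* w ℕ.^ s → r ℕ.* w ℕ.^ suc s ℕ.≤ 2 ℕ.* n → fromℕ m ≤ c * fromℕ r ** t * fromℕ w →
    fromℕ m * fromℕ δ ≤ fromℕ D * (c * fromℕ 2 ** t) ** β * term m n
  degree-bound {c} {m} {n} {w} {r} {δ} {D} 1≤c 1≤m 1≤n 1≤w 1≤r δ≤ rw^S≤2n m≤ = begin
    fromℕ m * fromℕ δ
      ≤⟨ *-monoʳ-≤ (0≤fromℕ m) (fromℕ-mono δ≤) ⟩
    fromℕ m * fromℕ (D ℕ.* w ℕ.^ s)
      ≈⟨ *-congˡ (trans (fromℕ-* D (w ℕ.^ s)) (*-congˡ (fromℕ-^ w s))) ⟩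
    fromℕ m * (fromℕ D * fromℕ w ^ s)
      ≈⟨ S.solve 3 (λ m d w → m :* (d :* w) := d :* (m :* w)) refl (fromℕ m) (fromℕ D) (fromℕ w ^ s) ⟩
    fromℕ D * (fromℕ m * fromℕ w ^ s)
      ≤⟨ *-monoʳ-≤ (0≤fromℕ D) (balance (1≤x*y 1≤c (1≤** (1≤fromℕ {2} (s≤s z≤n)) 0≤t))
           (1≤fromℕ 1≤m) (1≤fromℕ 1≤w) (1≤fromℕ 1≤n)
           (w^γ-bound 1≤c (1≤fromℕ 1≤w) (1≤fromℕ 1≤r) (1≤fromℕ 1≤n) rate m≤)) ⟩
    fromℕ D * ((c * fromℕ 2 ** t) ** β * term m n)
      ≈⟨ *-assoc (fromℕ D) _ (term m n) ⟨
    fromℕ D * (c * fromℕ 2 ** t) ** β * term m n ∎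
    where
    rate : fromℕ r * fromℕ w ^ suc s ≤ fromℕ 2 * fromℕ n
    rate = begin
      fromℕ r * fromℕ w ^ suc s          ≈⟨ trans (fromℕ-* r (w ℕ.^ suc s)) (*-congˡ (fromℕ-^ w (suc s))) ⟨
      fromℕ (r ℕ.* w ℕ.^ suc s)          ≤⟨ fromℕ-mono rw^S≤2n ⟩
      fromℕ (2 ℕ.* n)                    ≈⟨ fromℕ-* 2 n ⟩
      fromℕ 2 * fromℕ n                  ∎

  module Potential {κ : Carrier} (0≤κ : 0# ≤ κ) (low-constant sparse-constant : ℕ) where
    α low sparse : Carrier
    α      = κ * fromℕ 2
    low    = fromℕ low-constant
    -- The additional 1 covers the last remaining point, which lies on at most n curves.
    sparse = fromℕ (suc sparse-constant)

    0≤α : 0# ≤ α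
    0≤α = *-nonNegative 0≤κ (0≤fromℕ 2)

    -- A potential for the deletion of points: each deletion lowers it by at least the degree of the
    -- point, through the second summand in `low-step` and the first in `term-step`. The third
    -- summand covers the situations in which the deletion stops.
    bound : ℕ → ℕ → Carrier
    bound m n = α * term m n + low * fromℕ m + sparse * fromℕ n

    0≤αterm+low : ∀ m n → 0# ≤ α * term m n + low * fromℕ m
    0≤αterm+low m n = 0≤x+y (*-nonNegative 0≤α (0≤term m n)) (*-nonNegative (0≤fromℕ low-constant) (0≤fromℕ m))

    sparse≤bound : ∀ m n {e} → e ℕ.≤ suc sparse-constant ℕ.* n → fromℕ e ≤ bound m n
    sparse≤bound m n {e} e≤ = begin
      fromℕ e                                  ≤⟨ fromℕ-mono e≤ ⟩
      fromℕ (suc sparse-constant ℕ.* n)        ≈⟨ fromℕ-* (suc sparse-constant) n ⟩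
      sparse * fromℕ n                         ≤⟨ x≤y+x _ (0≤αterm+low m n) ⟩
      bound m n                                ∎

    low-step : ∀ {j n δ e} → 1 ℕ.≤ j → δ ℕ.≤ low-constant → fromℕ e ≤ bound j n →
               fromℕ (δ ℕ.+ e) ≤ bound (suc j) n
    low-step {j} {n} {δ} {e} 1≤j δ≤ e≤ = begin
      fromℕ (δ ℕ.+ e)                                  ≈⟨ fromℕ-+ δ e ⟩
      fromℕ δ + fromℕ e                                ≤⟨ +-mono-≤ (fromℕ-mono δ≤) e≤ ⟩
      low + bound j n                                  ≈⟨ S.solve 4 (λ l a j r → l :+ (a :+ l :* j :+ r)
                                                            := a :+ l :* (con 1 :+ j) :+ r)
                                                            refl low (α * term j n) (fromℕ j) (sparse * fromℕ n) ⟩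
      α * term j n + low * fromℕ (suc j) + sparse * fromℕ n
        ≤⟨ +-monoˡ-≤ _ (+-monoˡ-≤ _ (*-monoʳ-≤ 0≤α (term-mono j n 1≤j))) ⟩
      bound (suc j) n                                  ∎

    term-step : ∀ {j n δ e} → 1 ℕ.≤ j → fromℕ (suc j) * fromℕ δ ≤ κ * term (suc j) n → fromℕ e ≤ bound j n →
                fromℕ (δ ℕ.+ e) ≤ bound (suc j) n
    term-step {j} {n} {δ} {e} 1≤j δ≤ e≤ = begin
      fromℕ (δ ℕ.+ e)                                            ≈⟨ fromℕ-+ δ e ⟩
      fromℕ δ + fromℕ e                                          ≤⟨ +-mono-≤ ≤-refl e≤ ⟩
      fromℕ δ + bound j n                                        ≈⟨ S.solve 4 (λ d a b c → d :+ (a :+ b :+ c)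
                                                                      := d :+ a :+ b :+ c)
                                                                      refl (fromℕ δ) (α * term j n) (low * fromℕ j) (sparse * fromℕ n) ⟩
      fromℕ δ + α * term j n + low * fromℕ j + sparse * fromℕ n  ≤⟨ +-monoˡ-≤ _ (+-mono-≤ (term-drop j n 1≤j 0≤κ δ≤)
                                                                      (*-monoʳ-≤ (0≤fromℕ low-constant)
                                                                        (fromℕ-mono (ℕ.n≤1+n j)))) ⟩
      bound (suc j) n                                            ∎

    bound≤ : ∀ m n → bound m n ≤ (α + low + sparse) * (term m n + fromℕ m + fromℕ n)
    bound≤ m n = begin
      α * term m n + low * fromℕ m + sparse * fromℕ n
        ≤⟨ +-mono-≤ (+-mono-≤ (*-mono (≤-trans (x≤x+y α 0≤low) (x≤x+y (α + low) 0≤sparse)) (0≤term m n))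
             (*-mono (≤-trans (x≤y+x low 0≤α) (x≤x+y (α + low) 0≤sparse)) (0≤fromℕ m)))
             (*-mono (x≤y+x sparse (0≤x+y 0≤α 0≤low)) (0≤fromℕ n)) ⟩
      Σ′ * term m n + Σ′ * fromℕ m + Σ′ * fromℕ n
        ≈⟨ S.solve 4 (λ c p q r → c :* p :+ c :* q :+ c :* r := c :* (p :+ q :+ r))
             refl Σ′ (term m n) (fromℕ m) (fromℕ n) ⟩
      Σ′ * (term m n + fromℕ m + fromℕ n) ∎
      where
      Σ′ : Carrier
      Σ′ = α + low + sparse
      0≤low : 0# ≤ low
      0≤low = 0≤fromℕ low-constant
      0≤sparse : 0# ≤ sparse
      0≤sparse = 0≤fromℕ (suc sparse-constant)
      *-mono : ∀ {p q r} → p ≤ q → 0# ≤ r → p * r ≤ q * r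
      *-mono p≤q 0≤r = *-monoˡ-≤ 0≤r p≤q

-- Distal cell decompositions

lower-excludedMiddle : ExcludedMiddle ℓ → ExcludedMiddle 0ℓ
lower-excludedMiddle {ℓ} em {P} = map′ lower lift (em {Lift ℓ P})

Unique-⊆ : ∀ {xs ys : List A} → xs ⊆ ys → Uniqueˡ ys → Uniqueˡ xs
Unique-⊆ []           _            = []
Unique-⊆ (y ∷ʳ xs⊆)   (_ ∷ ys!)    = Unique-⊆ xs⊆ ys!
Unique-⊆ (≡.refl ∷ xs⊆) (y∉ys ∷ ys!) = Sublist.All-resp-⊆ xs⊆ y∉ys ∷ Unique-⊆ xs⊆ ys!

-- Integer growth bounds from a real exponent.

module RealGrowth (em : ExcludedMiddle 0ℓ) (ℝ : CompleteOrderedField)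
  (t : CompleteOrderedField.Carrier ℝ) (1≤t : CompleteOrderedField._≤_ ℝ (CompleteOrderedField.1# ℝ) t)
  (C : CompleteOrderedField.Carrier ℝ) (k : ℕ) where
  open CompleteOrderedField ℝ
  open OrderedField em ℝ
  open PosetReasoning ≤-poset

  private
    0≤t : 0# ≤ t
    0≤t = 1≤⇒0≤ 1≤t

    1≤power : ∀ j → 1# ≤ fromℕ (suc j) ** t
    1≤power j = 1≤** (1≤fromℕ {suc j} (s≤s z≤n)) 0≤t

  abstract
    C₀ d : ℕ
    C₀ = suc (proj₁ (archimedean C))
    d  = proj₁ (archimedean t)

    1≤C₀ : 1 ℕ.≤ C₀
    1≤C₀ = s≤s z≤n

    C≤C₀ : C ≤ fromℕ C₀
    C≤C₀ = ≤-trans (proj₂ (archimedean C)) (fromℕ-mono (ℕ.n≤1+n (proj₁ (archimedean C))))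

    t≤d : t ≤ fromℕ d
    t≤d = proj₂ (archimedean t)

    -- An integer stand-in for j^t, namely its floor plus one, which lies between j^t and 2 j^t. The
    -- value at 0 is a positive default.
    ψ : ℕ → ℕ
    ψ zero    = 1
    ψ (suc j) = suc (proj₁ (floor (1≤⇒0≤ (1≤power j))))

    1≤ψ : ∀ j → 1 ℕ.≤ ψ j
    1≤ψ zero    = s≤s z≤n
    1≤ψ (suc j) = s≤s z≤n

    ψ-lower : ∀ j → 1 ℕ.≤ j → fromℕ j ** t ≤ fromℕ (ψ j)
    ψ-lower (suc j) _ = proj₂ (proj₂ (floor (1≤⇒0≤ (1≤power j))))

    ψ-upper : ∀ j → 1 ℕ.≤ j → fromℕ (ψ j) ≤ fromℕ 2 * fromℕ j ** t
    ψ-upper (suc j) _ = begin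
      1# + fromℕ (proj₁ (floor (1≤⇒0≤ (1≤power j))))
        ≤⟨ +-mono-≤ (1≤power j) (proj₁ (proj₂ (floor (1≤⇒0≤ (1≤power j))))) ⟩
      fromℕ (suc j) ** t + fromℕ (suc j) ** t
        ≈⟨ S.solve 1 (λ x → x S.:+ x S.:= (S.con 1 S.:+ (S.con 1 S.:+ S.con 0)) S.:* x) refl (fromℕ (suc j) ** t) ⟩
      fromℕ 2 * fromℕ (suc j) ** t ∎

  -- Only the factor l^t is rounded up to an integer exponent; the dependence on r keeps the
  -- exponent t, on which the final bound rests.
  ψ-scale : ∀ l r → 1 ℕ.≤ l → 1 ℕ.≤ r → ψ (l ℕ.* r) ℕ.≤ 2 ℕ.* l ℕ.^ d ℕ.* ψ r
  ψ-scale l r 1≤l 1≤r = fromℕ-cancel {ψ (l ℕ.* r)} {2 ℕ.* l ℕ.^ d ℕ.* ψ r} (begin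
    fromℕ (ψ (l ℕ.* r))
      ≤⟨ ψ-upper (l ℕ.* r) (ℕ.*-mono-≤ 1≤l 1≤r) ⟩
    fromℕ 2 * fromℕ (l ℕ.* r) ** t
      ≈⟨ *-congˡ (trans (**-cong (1≤fromℕ {l ℕ.* r} (ℕ.*-mono-≤ 1≤l 1≤r)) 0≤t (fromℕ-* l r) refl)
           (sym (**-distrib-* (1≤fromℕ 1≤l) (1≤fromℕ 1≤r) 0≤t))) ⟩
    fromℕ 2 * (fromℕ l ** t * fromℕ r ** t)
      ≤⟨ *-monoʳ-≤ (0≤fromℕ 2) (*-mono-≤ (1≤⇒0≤ (1≤** (1≤fromℕ 1≤l) 0≤t)) (0≤fromℕ (ψ r)) l^t≤l^d (ψ-lower r 1≤r)) ⟩
    fromℕ 2 * (fromℕ (l ℕ.^ d) * fromℕ (ψ r))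
      ≈⟨ *-assoc _ _ _ ⟨
    fromℕ 2 * fromℕ (l ℕ.^ d) * fromℕ (ψ r)
      ≈⟨ trans (fromℕ-* (2 ℕ.* l ℕ.^ d) (ψ r)) (*-congʳ (fromℕ-* 2 (l ℕ.^ d))) ⟨
    fromℕ (2 ℕ.* l ℕ.^ d ℕ.* ψ r) ∎)
    where
    l^t≤l^d : fromℕ l ** t ≤ fromℕ (l ℕ.^ d)
    l^t≤l^d = begin
      fromℕ l ** t          ≤⟨ **-mono (1≤fromℕ 1≤l) 0≤t ≤-refl t≤d ⟩
      fromℕ l ** fromℕ d    ≈⟨ **-fromℕ d (1≤fromℕ 1≤l) ⟩
      fromℕ l ^ d           ≈⟨ fromℕ-^ l d ⟨
      fromℕ (l ℕ.^ d)       ∎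

  growth : Growth
  growth = record
    { k = k ; d = d ; scale = 2 ; φ = λ r → C₀ ℕ.* ψ r
    ; 1≤scale    = s≤s z≤n
    ; φ-positive = λ r _ → ℕ.*-mono-≤ 1≤C₀ (1≤ψ r)
    ; φ-scale    = λ l r 1≤l 1≤r → ℕ.≤-trans (ℕ.*-monoʳ-≤ C₀ (ψ-scale l r 1≤l 1≤r))
        (ℕ.≤-reflexive (pull C₀ (2 ℕ.* l ℕ.^ d) (ψ r)))
    }
    where
    pull : ∀ x y z → x ℕ.* (y ℕ.* z) ≡ y ℕ.* (x ℕ.* z)
    pull = solve-∀

  -- Here n is the length of a sample and m the number of its distinct parameters, which may be
  -- smaller.
  φ-lower : ∀ {N m n} → fromℕ N ≤ C * fromℕ m ** t → 1 ℕ.≤ m → m ℕ.≤ n → N ℕ.≤ Growth.φ growth n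
  φ-lower {N} {m} {n} N≤ 1≤m m≤n = fromℕ-cancel {N} {C₀ ℕ.* ψ n} (begin
    fromℕ N                    ≤⟨ N≤ ⟩
    C * fromℕ m ** t           ≤⟨ *-monoˡ-≤ (1≤⇒0≤ (1≤** (1≤fromℕ 1≤m) 0≤t)) C≤C₀ ⟩
    fromℕ C₀ * fromℕ m ** t    ≤⟨ *-monoʳ-≤ (0≤fromℕ C₀) (**-mono (1≤fromℕ 1≤m) 0≤t (fromℕ-mono m≤n) ≤-refl) ⟩
    fromℕ C₀ * fromℕ n ** t    ≤⟨ *-monoʳ-≤ (0≤fromℕ C₀) (ψ-lower n (ℕ.≤-trans 1≤m m≤n)) ⟩
    fromℕ C₀ * fromℕ (ψ n)     ≈⟨ fromℕ-* C₀ (ψ n) ⟨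
    fromℕ (C₀ ℕ.* ψ n)         ∎)

  φ-upper : ∀ r → 1 ℕ.≤ r → fromℕ (Growth.φ growth r) ≤ fromℕ C₀ * fromℕ 2 * fromℕ r ** t
  φ-upper r 1≤r = begin
    fromℕ (C₀ ℕ.* ψ r)                       ≈⟨ fromℕ-* C₀ (ψ r) ⟩
    fromℕ C₀ * fromℕ (ψ r)                   ≤⟨ *-monoʳ-≤ (0≤fromℕ C₀) (ψ-upper r 1≤r) ⟩
    fromℕ C₀ * (fromℕ 2 * fromℕ r ** t)      ≈⟨ *-assoc _ _ _ ⟨
    fromℕ C₀ * fromℕ 2 * fromℕ r ** t        ∎

  size-upper : ∀ {C₁ m r w} → 1 ℕ.≤ r → m ℕ.≤ C₁ ℕ.* Growth.φ growth r ℕ.* w →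
    fromℕ m ≤ fromℕ C₁ * (fromℕ C₀ * fromℕ 2) * fromℕ r ** t * fromℕ w
  size-upper {C₁} {m} {r} {w} 1≤r m≤ = begin
    fromℕ m
      ≤⟨ fromℕ-mono m≤ ⟩
    fromℕ (C₁ ℕ.* φ ℕ.* w)
      ≈⟨ trans (fromℕ-* (C₁ ℕ.* φ) w) (*-congʳ (fromℕ-* C₁ φ)) ⟩
    fromℕ C₁ * fromℕ φ * fromℕ w
      ≤⟨ *-monoˡ-≤ (0≤fromℕ w) (*-monoʳ-≤ (0≤fromℕ C₁) (φ-upper r 1≤r)) ⟩
    fromℕ C₁ * (fromℕ C₀ * fromℕ 2 * fromℕ r ** t) * fromℕ w
      ≈⟨ *-congʳ (*-assoc (fromℕ C₁) _ _) ⟨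
    fromℕ C₁ * (fromℕ C₀ * fromℕ 2) * fromℕ r ** t * fromℕ w ∎
    where
    φ : ℕ
    φ = Growth.φ growth r

module DistalCells (em : ExcludedMiddle ℓ) (ℝ : CompleteOrderedField)
  {L : Language ℓ} (M : Structure L)
  (t : CompleteOrderedField.Carrier ℝ) (1≤t : CompleteOrderedField._≤_ ℝ (CompleteOrderedField.1# ℝ) t)
  {x y z : ℕ} (θ : Formula L (x ℕ.+ (y ℕ.+ z)))
  (𝒯 : DistalCellDecomposition M {p = x} {q = y ℕ.+ z} θ) (exponent : HasExponent M ℝ 𝒯 t) where
  open DistalCellDecomposition 𝒯 using (k; covers; uncrossed) renaming (cells to IsDistalCell)

  -- The growth data are fixed before the parameter c of the instance, so every constant derived
  -- from them is uniform in c.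
  open RealGrowth (lower-excludedMiddle em) ℝ t 1≤t (proj₁ exponent) k public

  module _ (c : Vec (Universe M) z) where
    Point Curve Parameter : Set ℓ
    Point     = Vec (Universe M) x
    Curve     = Vec (Universe M) y
    Parameter = Vec (Universe M) (y ℕ.+ z)

    _≟_ : DecidableEquality Parameter
    p ≟ q = em

    -- A curve q corresponds to the parameter (q, c). Repetitions are removed because the
    -- decomposition is given for finite sets, whereas a sample may repeat a curve.
    parameters : List Curve → FiniteSet Parameter
    parameters S = record
      { elements = deduplicate _≟_ (map (Vec._++ c) S)
      ; unique   = deduplicate-! _≟_ (map (Vec._++ c) S)
      }

    ∈-parameters⁺ : ∀ {S q} → q ∈ˡ S → q Vec.++ c ∈ˡ FiniteSet.elements (parameters S)
    ∈-parameters⁺ q∈ = ∈.∈-deduplicate⁺ _≟_ (∈.∈-map⁺ (Vec._++ c) q∈)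

    ∈-parameters⁻ : ∀ {S p} → p ∈ˡ FiniteSet.elements (parameters S) → ∃[ q ] q ∈ˡ S × p ≡ q Vec.++ c
    ∈-parameters⁻ {S} p∈ = ∈.∈-map⁻ (Vec._++ c) (∈.∈-deduplicate⁻ _≟_ (map (Vec._++ c) S) p∈)

    nonempty : ∀ {S} → 1 ℕ.≤ length S → 1 ℕ.≤ size (parameters S)
    nonempty {_ ∷ _} _ = s≤s z≤n

    size-parameters : ∀ S → size (parameters S) ℕ.≤ length S
    size-parameters S = ℕ.≤-trans (List.length-deduplicate _≟_ (map (Vec._++ c) S))
      (ℕ.≤-reflexive (List.length-map (Vec._++ c) S))

    IsCellOf : List Curve → Pred Point ℓ → Set ℓ
    IsCellOf S = IsDistalCell (members (parameters S))

    enumerated : ∀ S → 1 ℕ.≤ length S → Σ[ N ∈ ℕ ] HasSize (≐-setoid Point ℓ) (IsCellOf S) N × N ℕ.≤ Growth.φ growth (length S)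
    enumerated S 1≤S with proj₂ exponent (parameters S) (nonempty {S} 1≤S)
    ... | N , has-size , N≤ = N , has-size , φ-lower N≤ (nonempty {S} 1≤S) (size-parameters S)

    cell-list : List Curve → List (Pred Point ℓ)
    -- A default value: the decomposition is only controlled for nonempty sets of parameters.
    cell-list []        = []
    cell-list S@(_ ∷ _) = proj₁ (proj₁ (proj₂ (enumerated S (s≤s z≤n))))

    -- A cell is described by a formula ψ and k parameters, and it is a cell as long as no parameter
    -- of the sample satisfies the conflict formula of ψ. A smaller sample that retains the k
    -- parameters can only have fewer conflicts.
    restrict-cell : ∀ S {Δ} → IsCellOf S Δ → Σ[ D ∈ (Fin k → Curve) ] (∀ i → D i ∈ˡ S) ×
      (∀ S′ → (∀ {q} → q ∈ˡ S′ → q ∈ˡ S) → (∀ i → D i ∈ˡ S′) → IsCellOf S′ Δ)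
    restrict-cell S (ψ , ψ∈ , bs , bs∈ , no-conflict , Δ≐) =
      (λ i → proj₁ (origin i)) , (λ i → proj₁ (proj₂ (origin i))) , λ S′ S′⊆S D∈S′ →
        ψ , ψ∈ , bs
        , VecAll.lookup⁻ (λ i → ≡.subst (_∈ˡ FiniteSet.elements (parameters S′)) (≡.sym (proj₂ (proj₂ (origin i))))
            (∈-parameters⁺ (D∈S′ i)))
        , (λ (b , b∈ , sat) → no-conflict (b , (let q , q∈S′ , b≡ = ∈-parameters⁻ {S′} b∈ in
            ≡.subst (_∈ˡ FiniteSet.elements (parameters S)) (≡.sym b≡) (∈-parameters⁺ (S′⊆S q∈S′))) , sat))
        , Δ≐
      where
      origin : ∀ i → ∃[ q ] q ∈ˡ S × lookup bs i ≡ q Vec.++ c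
      origin i = ∈-parameters⁻ {S} (VecAll.lookup⁺ bs∈ i)

    system : CellSystem em (λ p q → instanceOf M {x} {y} {z} θ c (p , q)) growth
    system = record
      { IsCell     = IsCellOf
      ; cells      = cell-list
      ; cells!     = λ { S@(_ ∷ _) _ → proj₁ (proj₂ (proj₁ (proj₂ (enumerated S (s≤s z≤n))))) }
      ; cells⇔     = λ { S@(_ ∷ _) _ → proj₂ (proj₂ (proj₂ (proj₁ (proj₂ (enumerated S (s≤s z≤n)))))) }
      ; cells-size = λ { S@(_ ∷ _) _ → ℕ.≤-trans
          (ℕ.≤-reflexive (proj₁ (proj₂ (proj₂ (proj₁ (proj₂ (enumerated S (s≤s z≤n))))))))
          (proj₂ (proj₂ (enumerated S (s≤s z≤n)))) }
      ; covers     = λ S 1≤S → covers (parameters S) (nonempty {S} 1≤S)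
      ; uncrossed  = λ { S 1≤S {Δ} Δ-cell {q} q∈ (p , p′ , p∈ , p′∈ , e , ¬e) →
          uncrossed (parameters S) (nonempty {S} 1≤S) Δ Δ-cell
            (q Vec.++ c , ∈-parameters⁺ q∈ , (p , p∈ , e) , (p′ , p′∈ , ¬e)) }
      ; local      = restrict-cell
      }

-- Edge counts and the deletion of points.

∑-remove : ∀ {x : A} {xs} → x ∈ˡ xs → ∃[ ys ] ys ⊆ xs × length xs ≡ suc (length ys)
         × (∀ f → ∑ xs f ≡ f x ℕ.+ ∑ ys f)
∑-remove {xs = x ∷ xs} (here ≡.refl) = xs , x ∷ʳ ⊆-refl , ≡.refl , λ f → ≡.refl
∑-remove {xs = y ∷ xs} (there x∈) with ∑-remove x∈
... | ys , ys⊆ , length≡ , sum≡ = y ∷ ys , ≡.refl ∷ ys⊆ , ≡.cong suc length≡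
    , λ f → ≡.trans (≡.cong (f y ℕ.+_) (sum≡ f)) (rearrange (f y) _ (∑ ys f))
  where
  rearrange : ∀ p q r → p ℕ.+ (q ℕ.+ r) ≡ q ℕ.+ (p ℕ.+ r)
  rearrange = solve-∀

∑-cartesianProduct : ∀ (xs : List A) (ys : List B) f →
  ∑ (cartesianProduct xs ys) f ≡ ∑ xs (λ x → ∑ ys (λ y → f (x , y)))
∑-cartesianProduct []       ys f = ≡.refl
∑-cartesianProduct (x ∷ xs) ys f = ≡.trans (∑-++ (map (x ,_) ys) _ f)
  (≡.cong₂ ℕ._+_ (∑-map (x ,_) ys f) (∑-cartesianProduct xs ys f))

module EdgeCounting (em : ExcludedMiddle ℓ) {X Y : Set ℓ} (E : Pred (X × Y) ℓ) where
  open Counting em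
  open Incidence em (λ p q → E (p , q))

  hasEdgeCount : (P : FiniteSet X) (Q : FiniteSet Y) →
    HasEdgeCount E P Q (incidences (FiniteSet.elements P) (FiniteSet.elements Q))
  hasEdgeCount P Q = select E (cartesianProduct ps qs)
    , Unique.filter⁺ (λ e → em {E e}) (Unique.cartesianProduct⁺ (FiniteSet.unique P) (FiniteSet.unique Q))
    , ≡.trans (length-select E (cartesianProduct ps qs)) (∑-cartesianProduct ps qs _)
    , λ e → mk⇔
        (λ (e∈E , p∈ , q∈) → ∈.∈-filter⁺ (λ e → em {E e}) (∈.∈-cartesianProduct⁺ p∈ q∈) e∈E)
        (λ e∈ → let e∈PQ , e∈E = ∈-select⁻ E (cartesianProduct ps qs) e∈
                in e∈E , ∈.∈-cartesianProduct⁻ ps qs e∈PQ)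
    where
    ps = FiniteSet.elements P
    qs = FiniteSet.elements Q

  free : ∀ {s u} → ¬ ContainsK s u E → (P : FiniteSet X) (Q : FiniteSet Y) →
         Free s u (FiniteSet.elements P) (FiniteSet.elements Q)
  free {s} {u} K-free P Q A B A⊆P B⊆Q |A|≡s complete = ℕ.≮⇒≥ λ u<|B| → K-free
    ( record { elements = A ; unique = Unique-⊆ A⊆P (FiniteSet.unique P) }
    , record { elements = take u B
             ; unique = Unique-⊆ (⊆-trans (Sublist.take-⊆ u B) B⊆Q) (FiniteSet.unique Q) }
    , |A|≡s
    , ≡.trans (List.length-take u B) (ℕ.m≤n⇒m⊓n≡m (ℕ.<⇒≤ u<|B|))
    , λ a∈ b∈ → complete a∈ (Sublist.Any-resp-⊆ (Sublist.take-⊆ u B) b∈))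

module Removal (em : ExcludedMiddle ℓ) (ℝ : CompleteOrderedField)
  (t : CompleteOrderedField.Carrier ℝ) (2≤t : CompleteOrderedField._≤_ ℝ (CompleteOrderedField.fromℕ ℝ 2) t)
  (s u : ℕ) {X Y : Set ℓ} (E : X → Y → Set ℓ) where
  open CompleteOrderedField ℝ
  open OrderedField (lower-excludedMiddle em) ℝ
  open Exponents (lower-excludedMiddle em) ℝ t 2≤t s
  open Incidence em E
  open Counting em using (count)

  module _ {κ : Carrier} (0≤κ : 0# ≤ κ) (low-constant sparse-constant : ℕ)
    (alternatives : ∀ P Q → Free (suc s) u P Q → 1 ℕ.≤ length P → 1 ℕ.≤ length Q →
        incidences P Q ℕ.≤ sparse-constant ℕ.* length Q
      ⊎ (∃[ p ] p ∈ˡ P × count (E p) Q ℕ.≤ low-constant)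
      ⊎ (∃[ p ] p ∈ˡ P × fromℕ (length P) * fromℕ (count (E p) Q) ≤ κ * term (length P) (length Q))) where
    open Potential {κ} 0≤κ low-constant sparse-constant

    incidences≤bound : ∀ P Q → Free (suc s) u P Q → fromℕ (incidences P Q) ≤ bound (length P) (length Q)
    incidences≤bound P Q = by-size (length P) P Q ℕ.≤-refl
      where
      by-size : ∀ N P Q → length P ℕ.≤ N → Free (suc s) u P Q →
                fromℕ (incidences P Q) ≤ bound (length P) (length Q)
      by-size N [] Q _ _ = sparse≤bound 0 (length Q) z≤n
      by-size N P@(_ ∷ _) [] _ _ = sparse≤bound (length P) 0 (ℕ.≤-trans
        (ℕ.≤-reflexive (≡.trans (∑-const P 0) (ℕ.*-zeroʳ (length P)))) z≤n)
      -- Stopping at one point keeps j ≥ 1 in the deletion steps, where the laws of `**` for bases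
      -- at least 1 apply.
      by-size N (p ∷ []) Q@(_ ∷ _) _ _ = sparse≤bound 1 (length Q) (ℕ.≤-trans
        (ℕ.≤-reflexive (ℕ.+-identityʳ _))
        (ℕ.≤-trans (count≤length (E p) Q) (ℕ.m≤n*m (length Q) (suc sparse-constant))))
      by-size (suc N) P@(_ ∷ P₁@(_ ∷ _)) Q@(_ ∷ _) P≤N free = conclude (alternatives P Q free (s≤s z≤n) (s≤s z≤n))
        where
        remove : ∀ {p} → p ∈ˡ P →
          (∀ {e} → fromℕ e ≤ bound (length P₁) (length Q) →
            fromℕ (count (E p) Q ℕ.+ e) ≤ bound (length P) (length Q)) →
          fromℕ (incidences P Q) ≤ bound (length P) (length Q)
        remove p∈ step with ∑-remove p∈
        ... | P′ , P′⊆P , length≡ , sum≡ =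
          ≡.subst (λ e → fromℕ e ≤ bound (length P) (length Q)) (≡.sym (sum≡ (λ p → count (E p) Q)))
            (step {incidences P′ Q} (≡.subst (λ l → fromℕ (incidences P′ Q) ≤ bound l (length Q))
              (≡.sym (ℕ.suc-injective length≡))
              (by-size N P′ Q (ℕ.≤-pred (ℕ.≤-trans (ℕ.≤-reflexive (≡.sym length≡)) P≤N))
                (Free-⊆ P′⊆P ⊆-refl free))))
        conclude : _ → fromℕ (incidences P Q) ≤ bound (length P) (length Q)
        conclude (inj₁ few) = sparse≤bound (length P) (length Q)
          (ℕ.≤-trans few (ℕ.m≤n+m _ (length Q)))
        conclude (inj₂ (inj₁ (p , p∈ , δ≤))) = remove p∈
          (low-step {length P₁} {length Q} {count (E p) Q} (s≤s z≤n) δ≤)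
        conclude (inj₂ (inj₂ (p , p∈ , δ≤))) = remove p∈
          (term-step {length P₁} {length Q} {count (E p) Q} (s≤s z≤n) δ≤)

module IncidenceBound (em : ExcludedMiddle ℓ) (ℝ : CompleteOrderedField)
  {L : Language ℓ} (M : Structure L)
  (t : CompleteOrderedField.Carrier ℝ) (2≤t : CompleteOrderedField._≤_ ℝ (CompleteOrderedField.fromℕ ℝ 2) t)
  (s u : ℕ) {x y z : ℕ} (ϑ : Formula L (x ℕ.+ (y ℕ.+ z)))
  (𝒯 : DistalCellDecomposition M {p = x} {q = y ℕ.+ z} ϑ) (exponent : HasExponent M ℝ 𝒯 t) where
  open CompleteOrderedField ℝ
  private
    em₀ : ExcludedMiddle 0ℓ
    em₀ = lower-excludedMiddle em
  open OrderedField em₀ ℝ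
  open Exponents em₀ ℝ t 2≤t s
  open DistalCells em ℝ M t 1≤t {x} {y} {z} ϑ 𝒯 exponent
  open IncidenceConstants growth s u

  private
    -- `c′` comes from |P| ≤ C₁ φ r w with φ r ≤ 2 C₀ r^t. In `κ`, the factor 2^t stems from r w^S ≤
    -- 2n, and the power β from `balance`.
    c′ κ : Carrier
    c′ = fromℕ C₁ * (fromℕ C₀ * fromℕ 2)
    κ  = fromℕ degree-constant * (c′ * fromℕ 2 ** t) ** β

    1≤c′ : 1# ≤ c′
    1≤c′ = 1≤x*y (1≤fromℕ {C₁} (Constants.1≤density-constant growth))
      (1≤x*y (1≤fromℕ {C₀} 1≤C₀) (1≤fromℕ {2} (s≤s z≤n)))

    0≤κ : 0# ≤ κ
    0≤κ = *-nonNegative (0≤fromℕ degree-constant)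
      (1≤⇒0≤ (1≤** (1≤x*y 1≤c′ (1≤** (1≤fromℕ {2} (s≤s z≤n)) 0≤t)) 0≤β))

  open Potential {κ} 0≤κ low-constant sparse-constant public

  module _ (c : Vec (Universe M) z) where
    private
      E : Vec (Universe M) x → Vec (Universe M) y → Set ℓ
      E p q = instanceOf M {x} {y} {z} ϑ c (p , q)
    open Incidence em E using (Free; incidences)
    open Counting em using (count)

    steps : ∀ P Q → Free (suc s) u P Q → 1 ℕ.≤ length P → 1 ℕ.≤ length Q →
        incidences P Q ℕ.≤ sparse-constant ℕ.* length Q
      ⊎ (∃[ p ] p ∈ˡ P × count (E p) Q ℕ.≤ low-constant)
      ⊎ (∃[ p ] p ∈ˡ P × fromℕ (length P) * fromℕ (count (E p) Q) ≤ κ * term (length P) (length Q))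
    steps P Q free 1≤m 1≤n = translate (Zarankiewicz.alternatives em (system c) s u P Q free)
      where
      translate : Zarankiewicz.Alternatives em (system c) s u P Q → _
      translate (inj₁ few)        = inj₁ few
      translate (inj₂ (inj₁ few)) = inj₂ (inj₁ few)
      translate (inj₂ (inj₂ (p , p∈ , w , r , 1≤w , 1≤r , δ≤ , rw^S≤2n , m≤))) = inj₂ (inj₂ (p , p∈ ,
        degree-bound {c′} {length P} {length Q} {w} {r} {count (E p) Q} {degree-constant}
          1≤c′ 1≤m 1≤n 1≤w 1≤r δ≤ rw^S≤2n (size-upper {C₁} {length P} {r} {w} 1≤r m≤)))

    incidences≤bound : ∀ P Q → Free (suc s) u P Q → fromℕ (incidences P Q) ≤ bound (length P) (length Q)
    incidences≤bound = Removal.incidences≤bound em ℝ t 2≤t s u E 0≤κ low-constant sparse-constant steps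

corollary8p8 : ∀ {ℓ} → ExcludedMiddle ℓ → (ℝ : CompleteOrderedField) →
    let open CompleteOrderedField ℝ in
    (L : Language ℓ) (M : Structure L)
    (t : Carrier) → fromℕ 2 ≤ t →
    (s u : ℕ) → 0 ℕ.< s → 0 ℕ.< u →
    (x y z : ℕ) (θ : Formula L (x ℕ.+ (y ℕ.+ z))) →
    (Σ[ 𝒯 ∈ DistalCellDecomposition M {p = x} {q = y ℕ.+ z} θ ] HasExponent M ℝ 𝒯 t) →
    Σ[ α ∈ Carrier ]
    ((c : Vec (Universe M) z) →
    ¬ ContainsK s u (instanceOf M {x} {y} {z} θ c) →
    (P : FiniteSet (Vec (Universe M) x)) (Q : FiniteSet (Vec (Universe M) y)) →
    Σ[ e ∈ ℕ ]
    HasEdgeCount (instanceOf M {x} {y} {z} θ c) P Q e ×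
    fromℕ e ≤ (α * (fromℕ (size P) ** (((t - 1#) * fromℕ s) / (t * fromℕ s - 1#))
    * fromℕ (size Q) ** ((t * (fromℕ s - 1#)) / (t * fromℕ s - 1#))
    + fromℕ (size P) + fromℕ (size Q))))
corollary8p8 em ℝ L M t 2≤t (suc s) u _ _ x y z θ (𝒯 , exponent) =
  α + low + sparse , λ c K-free P Q →
    let open EdgeCounting em (instanceOf M {x} {y} {z} θ c) in
    _ , hasEdgeCount P Q , ≤-trans
      (incidences≤bound c (FiniteSet.elements P) (FiniteSet.elements Q) (free K-free P Q))
      (bound≤ (size P) (size Q))
  where
  open CompleteOrderedField ℝ using (_+_)
  open OrderedField (lower-excludedMiddle em) ℝ using (≤-trans)
  open IncidenceBound em ℝ M t 2≤t s u {x} {y} {z} θ 𝒯 exponent
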